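{- The assignment $\mathsf{M}\mapsto\operatorname{Spec}_{\mathsf{M}}(t,q)\in\mathbb{Z}[t,q]$, sending a matroid to its spectrum polynomial, is a valuative invariant.
   Context: All matroids have finite ground sets contained in the positive integers. The spectrum polynomial of a matroid $\mathsf{M}$ is \[\operatorname{Spec}_{\mathsf{M}}(t,q)=\sum_{\substack{F_1,F_2\in\mathcal{L}(\mathsf{M}) \\ F_1\subseteq F_2}}|\tilde\chi(\mathsf{M}|_{F_1})|\cdot|\mu_{\mathcal{L}(\mathsf{M})}(F_1,F_2)|\cdot t^{\operatorname{rk}(F_2)}q^{|F_1|},\] where $\mathcal{L}(\mathsf{M})$ is the lattice of flats, $\mu_{\mathcal{L}(\mathsf{M})}$ its Möbius function, and $\tilde\chi(\mathsf{N})$ is the reduced Euler characteristic of the independence complex of $\mathsf{N}$ (so $|\tilde\chi(\mathsf{N})|=T_{\mathsf{N}}(0,1)$ with $T$ the Tutte polynomial). The base polytope of a matroid $\mathsf{M}$ on $E$ with bases $\mathscr{B}$ is $\mathscr{P}(\mathsf{M})=\operatorname{conv}\{\sum_{i\in B}e_i : B\in\mathscr{B}\}\subseteq\mathbb{R}^E$, with indicator function $\mathbf{1}_{\mathscr{P}(\mathsf{M})}:\mathbb{R}^E\to\mathbb{Z}$. A map $f$ from matroids to an abelian group is a valuation if $\sum_{i}a_if(\mathsf{M}_i)=0$ whenever $\mathsf{M}_1,\dots,\mathsf{M}_s$ are matroids on a common ground set and $a_i\in\mathbb{Z}$ satisfy $\sum_i a_i\mathbf{1}_{\mathscr{P}(\mathsf{M}_i)}=0$.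 (This is known to be equivalent to the inclusion–exclusion property under matroid subdivisions.) A valuative invariant is a valuation with $f(\mathsf{M})=f(\mathsf{N})$ whenever $\mathsf{M}\cong\mathsf{N}$. -}

module Defs where

open import Algebra.Bundles using (AbelianGroup)
import Algebra.Definitions.RawMonoid as RawMonoidDefinitions
open import Data.Bool.Base using (true; false; if_then_else_)
import Data.Bool.Properties as Bool
open import Data.Fin.Base using (Fin)
import Data.Fin.Properties as Fin
open import Data.Fin.Subset
  using (Subset; inside; outside; _∈_; _∉_; _⊆_; _⊂_; _∪_; _∩_; _-_; ⁅_⁆; ∣_∣)
open import Data.Fin.Subset.Induction using (⊂-wellFounded)
open import Data.Fin.Subset.Properties using (_∈?_; _⊆?_; _⊂?_; anySubset?)
open import Data.Integer.Base as ℤ using (ℤ; +_; -[1+_]; 0ℤ; 1ℤ; -1ℤ)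
import Data.Integer.Properties as ℤ
open import Data.List.Base as List
  using (List; []; _∷_; _++_; map; filter; length; foldr; cartesianProduct)
open import Data.List.Extrema.Nat using (max)
open import Data.List.Properties using (++-assoc; ++-identityʳ)
open import Data.List.Relation.Unary.All using (All)
open import Data.List.Relation.Unary.AllPairs using (AllPairs)
open import Data.Nat.Base as ℕ using (ℕ; zero; suc; _⊔_)
import Data.Nat.Properties as ℕ
open import Data.Product.Base using (Σ; ∃-syntax; _×_; _,_; proj₁; proj₂)
open import Data.Rational.Base as ℚ using (ℚ; 0ℚ; 1ℚ; ½)
import Data.Rational.Properties as ℚ
open import Data.Rational.Solver using (module +-*-Solver)
open import Data.Vec.Base using ([]; _∷_; lookup; tabulate)
open import Data.Vec.Functional as Vector using (Vector)
import Data.Vec.Properties as Vec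
open import Function.Base using (_∘_)
open import Function.Bundles using (_↔_; _⇔_; Inverse)
import Induction.WellFounded as WellFounded
open import Level using (0ℓ) renaming (suc to lsuc; _⊔_ to _⊔ˡ_)
open import Relation.Binary.PropositionalEquality
  using (_≡_; refl; sym; trans; cong; cong₂; subst)
open import Relation.Nullary.Decidable
  using (Dec; yes; no; does; ¬?; _×-dec_; _→-dec_; toWitness)
open import Relation.Unary using (Pred; Decidable)

------------------------------------------------------------------------
-- Real numbers

-- Cauchy sequences of rationals, with equality up to null sequences.
record ℝ : Set where
  field
    seq    : ℕ → ℚ
    cauchy : ∀ ε → 0ℚ ℚ.< ε →
             ∃[ N ] ∀ m n → N ℕ.≤ m → N ℕ.≤ n → ℚ.∣ seq m ℚ.- seq n ∣ ℚ.< ε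

open ℝ public

infix 4 _≃ᴿ_ _≤ᴿ_
infixl 6 _+ᴿ_
infixl 7 _*ᴿ_

_≃ᴿ_ : ℝ → ℝ → Set
x ≃ᴿ y = ∀ ε → 0ℚ ℚ.< ε → ∃[ N ] ∀ n → N ℕ.≤ n → ℚ.∣ seq x n ℚ.- seq y n ∣ ℚ.< ε

_≤ᴿ_ : ℝ → ℝ → Set
x ≤ᴿ y = ∀ ε → 0ℚ ℚ.< ε → ∃[ N ] ∀ n → N ℕ.≤ n → seq x n ℚ.≤ seq y n ℚ.+ ε

fromℚ : ℚ → ℝ
fromℚ p = record
  { seq    = λ _ → p
  ; cauchy = λ ε ε>0 → 0 , λ _ _ _ _ → subst (ℚ._< ε) (sym (cong ℚ.∣_∣ (ℚ.+-inverseʳ p))) ε>0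
  }

0ᴿ 1ᴿ : ℝ
0ᴿ = fromℚ 0ℚ
1ᴿ = fromℚ 1ℚ

_+ᴿ_ : ℝ → ℝ → ℝ
x +ᴿ y = record
  { seq    = λ n → seq x n ℚ.+ seq y n
  ; cauchy = λ ε ε>0 →
      let ε/2>0   = subst (ℚ._< ½ ℚ.* ε) (ℚ.*-zeroʳ ½) (ℚ.*-monoʳ-<-pos ½ ε>0)
          N₁ , hx = cauchy x (½ ℚ.* ε) ε/2>0
          N₂ , hy = cauchy y (½ ℚ.* ε) ε/2>0
      in N₁ ⊔ N₂ , λ m n m≥ n≥ → begin-strict
        ℚ.∣ (seq x m ℚ.+ seq y m) ℚ.- (seq x n ℚ.+ seq y n) ∣
          ≡⟨ cong ℚ.∣_∣ (regroup (seq x m) (seq y m) (seq x n) (seq y n)) ⟩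
        ℚ.∣ (seq x m ℚ.- seq x n) ℚ.+ (seq y m ℚ.- seq y n) ∣
          ≤⟨ ℚ.∣p+q∣≤∣p∣+∣q∣ (seq x m ℚ.- seq x n) (seq y m ℚ.- seq y n) ⟩
        ℚ.∣ seq x m ℚ.- seq x n ∣ ℚ.+ ℚ.∣ seq y m ℚ.- seq y n ∣
          <⟨ ℚ.+-mono-< (hx m n (ℕ.m⊔n≤o⇒m≤o N₁ N₂ m≥) (ℕ.m⊔n≤o⇒m≤o N₁ N₂ n≥))
                        (hy m n (ℕ.m⊔n≤o⇒n≤o N₁ N₂ m≥) (ℕ.m⊔n≤o⇒n≤o N₁ N₂ n≥)) ⟩
        ½ ℚ.* ε ℚ.+ ½ ℚ.* ε
          ≡⟨ sym (ℚ.*-distribʳ-+ ε ½ ½) ⟩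
        1ℚ ℚ.* ε
          ≡⟨ ℚ.*-identityˡ ε ⟩
        ε ∎
  }
  where
  open ℚ.≤-Reasoning
  open +-*-Solver
  regroup : ∀ a b c d → (a ℚ.+ b) ℚ.- (c ℚ.+ d) ≡ (a ℚ.- c) ℚ.+ (b ℚ.- d)
  regroup = solve 4 (λ a b c d → (a :+ b) :- (c :+ d) := (a :- c) :+ (b :- d)) refl

private
  eventualBound : (x : ℝ) →
    ∃[ K ] 0ℚ ℚ.< K × ∃[ N ] ∀ n → N ℕ.≤ n → ℚ.∣ seq x n ∣ ℚ.≤ K
  eventualBound x = 1ℚ ℚ.+ ℚ.∣ seq x N ∣ , K>0 , N , bound
    where
    open ℚ.≤-Reasoning
    0<1 : 0ℚ ℚ.< 1ℚ
    0<1 = ℚ.positive⁻¹ 1ℚ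
    N : ℕ
    N = proj₁ (cauchy x 1ℚ 0<1)
    K>0 : 0ℚ ℚ.< 1ℚ ℚ.+ ℚ.∣ seq x N ∣
    K>0 = ℚ.+-mono-<-≤ 0<1 (ℚ.0≤∣p∣ (seq x N))
    bound : ∀ n → N ℕ.≤ n → ℚ.∣ seq x n ∣ ℚ.≤ 1ℚ ℚ.+ ℚ.∣ seq x N ∣
    bound n n≥ = begin
      ℚ.∣ seq x n ∣
        ≡⟨ cong ℚ.∣_∣ (+-*-Solver.solve 2 (λ a b → a := (a :- b) :+ b) refl (seq x n) (seq x N)) ⟩
      ℚ.∣ (seq x n ℚ.- seq x N) ℚ.+ seq x N ∣
        ≤⟨ ℚ.∣p+q∣≤∣p∣+∣q∣ (seq x n ℚ.- seq x N) (seq x N) ⟩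
      ℚ.∣ seq x n ℚ.- seq x N ∣ ℚ.+ ℚ.∣ seq x N ∣
        ≤⟨ ℚ.+-monoˡ-≤ ℚ.∣ seq x N ∣ (ℚ.<⇒≤ (proj₂ (cauchy x 1ℚ 0<1) n N n≥ ℕ.≤-refl)) ⟩
      1ℚ ℚ.+ ℚ.∣ seq x N ∣ ∎
      where open +-*-Solver using (_:=_; _:-_; _:+_)

  *-mono-≤-nonNeg : ∀ {p q r s} → 0ℚ ℚ.≤ q → 0ℚ ℚ.≤ r → p ℚ.≤ q → r ℚ.≤ s → p ℚ.* r ℚ.≤ q ℚ.* s
  *-mono-≤-nonNeg {p} {q} {r} {s} 0≤q 0≤r p≤q r≤s = ℚ.≤-trans
    (ℚ.*-monoʳ-≤-nonNeg r {{ℚ.nonNegative 0≤r}} p≤q)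
    (ℚ.*-monoˡ-≤-nonNeg q {{ℚ.nonNegative 0≤q}} r≤s)

  shrink : ∀ B ε → 0ℚ ℚ.< B → 0ℚ ℚ.< ε → ∃[ δ ] 0ℚ ℚ.< δ × δ ℚ.* B ℚ.< ε
  shrink B ε B>0 ε>0 = δ , δ>0 , δB<ε
    where
    open ℚ.≤-Reasoning
    instance
      B-pos : ℚ.Positive B
      B-pos = ℚ.positive B>0
      ε-pos : ℚ.Positive ε
      ε-pos = ℚ.positive ε>0
      B-nonZero : ℚ.NonZero B
      B-nonZero = ℚ.pos⇒nonZero B
    δ : ℚ
    δ = (½ ℚ.* ε) ℚ.* ℚ.1/ B
    δ>0 : 0ℚ ℚ.< δ
    δ>0 = ℚ.positive⁻¹ δ {{ℚ.pos*pos⇒pos (½ ℚ.* ε) {{ℚ.pos*pos⇒pos ½ ε}} (ℚ.1/ B) {{ℚ.1/pos⇒pos B}}}}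
    δB<ε : δ ℚ.* B ℚ.< ε
    δB<ε = begin-strict
      δ ℚ.* B                        ≡⟨ ℚ.*-assoc (½ ℚ.* ε) (ℚ.1/ B) B ⟩
      (½ ℚ.* ε) ℚ.* (ℚ.1/ B ℚ.* B)   ≡⟨ cong ((½ ℚ.* ε) ℚ.*_) (ℚ.*-inverseˡ B) ⟩
      (½ ℚ.* ε) ℚ.* 1ℚ               ≡⟨ ℚ.*-identityʳ (½ ℚ.* ε) ⟩
      ½ ℚ.* ε                        <⟨ ℚ.*-monoˡ-<-pos ε (toWitness {a? = ½ ℚ.<? 1ℚ} _) ⟩
      1ℚ ℚ.* ε                       ≡⟨ ℚ.*-identityˡ ε ⟩
      ε                              ∎

_*ᴿ_ : ℝ → ℝ → ℝ
x *ᴿ y = record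
  { seq    = λ n → seq x n ℚ.* seq y n
  ; cauchy = λ ε ε>0 →
      let K , K>0 , N₁ , bx = eventualBound x
          L , L>0 , N₂ , by = eventualBound y
          δ , δ>0 , δB<ε    = shrink (K ℚ.+ L) ε (ℚ.+-mono-< K>0 L>0) ε>0
          N₃ , hx           = cauchy x δ δ>0
          N₄ , hy           = cauchy y δ δ>0
      in (N₁ ⊔ N₂) ⊔ (N₃ ⊔ N₄) , λ m n m≥ n≥ →
      let m≥₁₂ = ℕ.m⊔n≤o⇒m≤o (N₁ ⊔ N₂) (N₃ ⊔ N₄) m≥
          n≥₁₂ = ℕ.m⊔n≤o⇒m≤o (N₁ ⊔ N₂) (N₃ ⊔ N₄) n≥
          m≥₃₄ = ℕ.m⊔n≤o⇒n≤o (N₁ ⊔ N₂) (N₃ ⊔ N₄) m≥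
          n≥₃₄ = ℕ.m⊔n≤o⇒n≤o (N₁ ⊔ N₂) (N₃ ⊔ N₄) n≥
          xₘ = seq x m ; xₙ = seq x n ; yₘ = seq y m ; yₙ = seq y n
      in begin-strict
        ℚ.∣ xₘ ℚ.* yₘ ℚ.- xₙ ℚ.* yₙ ∣
          ≡⟨ cong ℚ.∣_∣ (regroup xₘ yₘ xₙ yₙ) ⟩
        ℚ.∣ xₘ ℚ.* (yₘ ℚ.- yₙ) ℚ.+ (xₘ ℚ.- xₙ) ℚ.* yₙ ∣
          ≤⟨ ℚ.∣p+q∣≤∣p∣+∣q∣ (xₘ ℚ.* (yₘ ℚ.- yₙ)) ((xₘ ℚ.- xₙ) ℚ.* yₙ) ⟩
        ℚ.∣ xₘ ℚ.* (yₘ ℚ.- yₙ) ∣ ℚ.+ ℚ.∣ (xₘ ℚ.- xₙ) ℚ.* yₙ ∣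
          ≡⟨ cong₂ ℚ._+_ (ℚ.∣p*q∣≡∣p∣*∣q∣ xₘ (yₘ ℚ.- yₙ)) (ℚ.∣p*q∣≡∣p∣*∣q∣ (xₘ ℚ.- xₙ) yₙ) ⟩
        ℚ.∣ xₘ ∣ ℚ.* ℚ.∣ yₘ ℚ.- yₙ ∣ ℚ.+ ℚ.∣ xₘ ℚ.- xₙ ∣ ℚ.* ℚ.∣ yₙ ∣
          ≤⟨ ℚ.+-mono-≤
               (*-mono-≤-nonNeg (ℚ.<⇒≤ K>0) (ℚ.0≤∣p∣ (yₘ ℚ.- yₙ))
                 (bx m (ℕ.m⊔n≤o⇒m≤o N₁ N₂ m≥₁₂))
                 (ℚ.<⇒≤ (hy m n (ℕ.m⊔n≤o⇒n≤o N₃ N₄ m≥₃₄) (ℕ.m⊔n≤o⇒n≤o N₃ N₄ n≥₃₄))))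
               (*-mono-≤-nonNeg (ℚ.<⇒≤ δ>0) (ℚ.0≤∣p∣ yₙ)
                 (ℚ.<⇒≤ (hx m n (ℕ.m⊔n≤o⇒m≤o N₃ N₄ m≥₃₄) (ℕ.m⊔n≤o⇒m≤o N₃ N₄ n≥₃₄)))
                 (by n (ℕ.m⊔n≤o⇒n≤o N₁ N₂ n≥₁₂))) ⟩
        K ℚ.* δ ℚ.+ δ ℚ.* L
          ≡⟨ collect K L δ ⟩
        δ ℚ.* (K ℚ.+ L)
          <⟨ δB<ε ⟩
        ε ∎
  }
  where
  open ℚ.≤-Reasoning
  open +-*-Solver
  regroup : ∀ a b c d → a ℚ.* b ℚ.- c ℚ.* d ≡ a ℚ.* (b ℚ.- d) ℚ.+ (a ℚ.- c) ℚ.* d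
  regroup = solve 4 (λ a b c d → a :* b :- c :* d := a :* (b :- d) :+ (a :- c) :* d) refl
  collect : ∀ k l d → k ℚ.* d ℚ.+ d ℚ.* l ≡ d ℚ.* (k ℚ.+ l)
  collect = solve 3 (λ k l d → k :* d :+ d :* l := d :* (k :+ l)) refl

sumᴿ : ∀ {k} → Vector ℝ k → ℝ
sumᴿ = Vector.foldr _+ᴿ_ 0ᴿ

-- Membership of x in the convex hull of the points v 0, …, v (k - 1) of ℝⁿ.
conv : ∀ {n k} → (Fin k → Vector ℝ n) → Pred (Vector ℝ n) 0ℓ
conv {k = k} v x = Σ (Vector ℝ k) λ c →
    (∀ j → 0ᴿ ≤ᴿ c j)
  × sumᴿ c ≃ᴿ 1ᴿ
  × (∀ i → x i ≃ᴿ sumᴿ (λ j → c j *ᴿ v j i))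

------------------------------------------------------------------------
-- Finite families of subsets

subsets : ∀ n → List (Subset n)
subsets zero    = [] ∷ []
subsets (suc n) = map (outside ∷_) (subsets n) ++ map (inside ∷_) (subsets n)

sumℤ : List ℤ → ℤ
sumℤ = foldr ℤ._+_ 0ℤ

-- Each σ contributes (-1)^dim σ = (-1)^(|σ| - 1), including σ = ∅.
reducedEuler : ∀ {n} → List (Subset n) → ℤ
reducedEuler faces = sumℤ (map (λ σ → ℤ.- (-1ℤ ℤ.^ ∣ σ ∣)) faces)

-- The Möbius function of a finite family of subsets ordered by inclusion, by
-- well-founded recursion on G:
--   μ(F,G) = [F = G] - Σ { μ(F,H) : H in the family, F ⊆ H ⊂ G }.
-- If F ⊈ G, no such H exists and the value is 0.
möbius : ∀ {n} → List (Subset n) → Subset n → Subset n → ℤ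
möbius family F = wfRec _ λ G μ[F,_] →
  (if does (Vec.≡-dec Bool._≟_ F G) then 1ℤ else 0ℤ) ℤ.-
  sumℤ (map (λ H → term μ[F,_] (F ⊆? H) (H ⊂? G)) family)
  where
  open WellFounded.All ⊂-wellFounded 0ℓ using (wfRec)
  term : ∀ {G H} → (∀ {K} → K ⊂ G → ℤ) → Dec (F ⊆ H) → Dec (H ⊂ G) → ℤ
  term μ[F,_] (yes _) (yes H⊂G) = μ[F,_] H⊂G
  term μ[F,_] _       _         = 0ℤ

------------------------------------------------------------------------
-- Matroids

-- A finite set of positive integers, listed in increasing order.
record GroundSet : Set where
  field
    elements   : List ℕ
    positive   : All (0 ℕ.<_) elements
    increasing : AllPairs ℕ._<_ elements

  size : ℕ
  size = length elements

open GroundSet public using (size)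

-- A subset of E is a Subset (size E): position i stands for the i-th smallest
-- element of E.
record Matroid (E : GroundSet) : Set₁ where
  field
    IsBasis  : Pred (Subset (size E)) 0ℓ
    isBasis? : Decidable IsBasis
    nonempty : ∃[ B ] IsBasis B
    exchange : ∀ {A B} → IsBasis A → IsBasis B →
               ∀ {x} → x ∈ A → x ∉ B →
               ∃[ y ] y ∈ B × y ∉ A × IsBasis ((A - x) ∪ ⁅ y ⁆)

  bases : List (Subset (size E))
  bases = filter isBasis? (subsets (size E))

  IsIndependent : Pred (Subset (size E)) 0ℓ
  IsIndependent I = ∃[ B ] IsBasis B × I ⊆ B

  isIndependent? : Decidable IsIndependent
  isIndependent? I = anySubset? λ B → isBasis? B ×-dec I ⊆? B

  rk : Subset (size E) → ℕ
  rk A = max 0 (map (λ B → ∣ A ∩ B ∣) bases)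

  IsFlat : Pred (Subset (size E)) 0ℓ
  IsFlat F = ∀ e → e ∉ F → rk F ℕ.< rk (F ∪ ⁅ e ⁆)

  isFlat? : Decidable IsFlat
  isFlat? F = Fin.all? λ e → ¬? (e ∈? F) →-dec (rk F ℕ.<? rk (F ∪ ⁅ e ⁆))

  flats : List (Subset (size E))
  flats = filter isFlat? (subsets (size E))

  -- The independence complex of the restriction to A.
  independentIn : Subset (size E) → List (Subset (size E))
  independentIn A = filter (λ I → isIndependent? I ×-dec I ⊆? A) (subsets (size E))

open Matroid public

vertex : ∀ {n} → Subset n → Vector ℝ n
vertex B i = if lookup B i then 1ᴿ else 0ᴿ

basePolytope : ∀ {E} → Matroid E → Pred (Vector ℝ (size E)) 0ℓ
basePolytope M = conv (λ j → vertex (List.lookup (bases M) j))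

infix 4 _≅_

-- A bijection of ground sets under which bases of M and N correspond; the
-- tabulated subset is the image of B.
_≅_ : ∀ {E E′} → Matroid E → Matroid E′ → Set
_≅_ {E} {E′} M N = Σ (Fin (size E) ↔ Fin (size E′)) λ σ →
  ∀ B → IsBasis M B ⇔ IsBasis N (tabulate (lookup B ∘ Inverse.from σ))

------------------------------------------------------------------------
-- The polynomial group ℤ[t,q]

-- A polynomial is a formal sum of monomials c tⁱ qʲ, written (c , i , j);
-- equality is equality of all coefficients.
Poly : Set
Poly = List (ℤ × ℕ × ℕ)

coefficient : Poly → ℕ → ℕ → ℤ
coefficient []                i j = 0ℤ
coefficient ((c , a , b) ∷ p) i j =
  (if does (a ℕ.≟ i ×-dec b ℕ.≟ j) then c else 0ℤ) ℤ.+ coefficient p i j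

infix 4 _≈ᴾ_

_≈ᴾ_ : Poly → Poly → Set
p ≈ᴾ r = ∀ i j → coefficient p i j ≡ coefficient r i j

negᴾ : Poly → Poly
negᴾ = map λ (c , i , j) → ℤ.- c , i , j

coefficient-++ : ∀ p r i j →
  coefficient (p ++ r) i j ≡ coefficient p i j ℤ.+ coefficient r i j
coefficient-++ []                r i j = sym (ℤ.+-identityˡ _)
coefficient-++ ((c , a , b) ∷ p) r i j =
  trans (cong (λ u → m ℤ.+ u) (coefficient-++ p r i j))
        (sym (ℤ.+-assoc m (coefficient p i j) (coefficient r i j)))
  where m = if does (a ℕ.≟ i ×-dec b ℕ.≟ j) then c else 0ℤ

coefficient-neg : ∀ p i j → coefficient (negᴾ p) i j ≡ ℤ.- coefficient p i j
coefficient-neg []                i j = refl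
coefficient-neg ((c , a , b) ∷ p) i j =
  trans (cong₂ ℤ._+_ (if-neg (does (a ℕ.≟ i ×-dec b ℕ.≟ j))) (coefficient-neg p i j))
        (sym (ℤ.neg-distrib-+ (if does (a ℕ.≟ i ×-dec b ℕ.≟ j) then c else 0ℤ) (coefficient p i j)))
  where
  if-neg : ∀ b′ → (if b′ then ℤ.- c else 0ℤ) ≡ ℤ.- (if b′ then c else 0ℤ)
  if-neg true  = refl
  if-neg false = refl

ℤ[t,q] : AbelianGroup 0ℓ 0ℓ
ℤ[t,q] = record
  { Carrier        = Poly
  ; _≈_            = _≈ᴾ_
  ; _∙_            = _++_
  ; ε              = []
  ; _⁻¹            = negᴾ
  ; isAbelianGroup = record
    { isGroup = record
      { isMonoid = record
        { isSemigroup = record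
          { isMagma = record
            { isEquivalence = record
              { refl  = λ _ _ → refl
              ; sym   = λ p≈r i j → sym (p≈r i j)
              ; trans = λ p≈r r≈s i j → trans (p≈r i j) (r≈s i j)
              }
            ; ∙-cong = λ {p} {p′} {r} {r′} p≈p′ r≈r′ i j →
                trans (coefficient-++ p r i j)
                  (trans (cong₂ ℤ._+_ (p≈p′ i j) (r≈r′ i j))
                         (sym (coefficient-++ p′ r′ i j)))
            }
          ; assoc = λ p r s i j → cong (λ u → coefficient u i j) (++-assoc p r s)
          }
        ; identity = (λ _ _ _ → refl)
                   , (λ p i j → cong (λ u → coefficient u i j) (++-identityʳ p))
        }
      ; inverse = (λ p i j → trans (coefficient-++ (negᴾ p) p i j)
                    (trans (cong (ℤ._+ coefficient p i j) (coefficient-neg p i j))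
                           (ℤ.+-inverseˡ (coefficient p i j))))
                , (λ p i j → trans (coefficient-++ p (negᴾ p) i j)
                    (trans (cong (λ u → coefficient p i j ℤ.+ u) (coefficient-neg p i j))
                           (ℤ.+-inverseʳ (coefficient p i j))))
      ; ⁻¹-cong = λ {p} {r} p≈r i j →
          trans (coefficient-neg p i j)
            (trans (cong ℤ.-_ (p≈r i j)) (sym (coefficient-neg r i j)))
      }
    ; comm = λ p r i j → trans (coefficient-++ p r i j)
        (trans (ℤ.+-comm (coefficient p i j) (coefficient r i j))
               (sym (coefficient-++ r p i j)))
    }
  }

-- One monomial for each pair of flats F₁ ⊆ F₂.
Spec : ∀ {E} → Matroid E → Poly
Spec M = map
  (λ (F₁ , F₂) →
    + ℤ.∣ reducedEuler (independentIn M F₁) ∣ ℤ.* + ℤ.∣ möbius (flats M) F₁ F₂ ∣ ,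
    rk M F₂ ,
    ∣ F₁ ∣)
  (filter (λ (F₁ , F₂) → F₁ ⊆? F₂) (cartesianProduct (flats M) (flats M)))

------------------------------------------------------------------------
-- Valuative invariants

indicator : ∀ {P : Set} → Dec P → ℤ
indicator P? = if does P? then 1ℤ else 0ℤ

module _ {c ℓ} (G : AbelianGroup c ℓ) where
  open AbelianGroup G

  open RawMonoidDefinitions rawMonoid using (sum) renaming (_×_ to _×ᴳ_)

  infixr 8 _·_

  _·_ : ℤ → Carrier → Carrier
  (+ n)    · g = n ×ᴳ g
  -[1+ n ] · g = (suc n ×ᴳ g) ⁻¹

  -- Membership in a polytope over ℝ is not constructively decidable, so
  -- Σᵢ aᵢ 1_{P(Mᵢ)} = 0 is required at each x for any decisions of whether
  -- x ∈ P(Mᵢ). With excluded middle these always exist, and this is the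
  -- usual identity of functions ℝᴱ → ℤ.
  IsValuation : (∀ {E} → Matroid E → Carrier) → Set (lsuc 0ℓ ⊔ˡ ℓ)
  IsValuation f = ∀ E s (M : Fin s → Matroid E) (a : Fin s → ℤ) →
    (∀ (x : Vector ℝ (size E)) (x∈P? : ∀ i → Dec (basePolytope (M i) x)) →
      Vector.foldr ℤ._+_ 0ℤ (λ i → a i ℤ.* indicator (x∈P? i)) ≡ 0ℤ) →
    sum (λ i → a i · f (M i)) ≈ ε

  IsInvariant : (∀ {E} → Matroid E → Carrier) → Set (lsuc 0ℓ ⊔ˡ ℓ)
  IsInvariant f = ∀ {E E′} (M : Matroid E) (N : Matroid E′) → M ≅ N → f M ≈ f N

  IsValuativeInvariant : (∀ {E} → Matroid E → Carrier) → Set (lsuc 0ℓ ⊔ˡ ℓ)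
  IsValuativeInvariant f = IsValuation f × IsInvariant f

{-# OPTIONS --safe #-}
module Submission where

-- The coefficient of tⁱqʲ in Spec M equals
--   (-1)ⁱ Σ (-1)^(|I| + |F| + |A|)  over I ⊆ F ⊆ A with |F| = j, I independent and rk A = i:
-- the Euler characteristic |χ̃(M|F)| is an alternating sum over independent sets, |μ(F, G)| is
-- one over the sets A with closure G, deletion–contraction determines their signs, and terms
-- with F not flat cancel. So it is enough that M ↦ [I independent and rk A = i] is a valuation
-- for I ⊆ A. This is a difference of two indicators of the form [some basis has weight ≥ b],
-- that is, [P(M) ∩ {w ≥ b} ≠ ∅], and the Euler characteristic argument of Hadwiger and Groemer
-- shows that nonemptiness of polyhedra is a valuation: eliminate one coordinate at a time, and
-- in dimension one count the endpoints minus the midpoints between neighbouring endpoints.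

open import Defs

open import Algebra.Bundles using (AbelianGroup; CommutativeRing)
import Algebra.Definitions.RawMonoid as RawMonoidDefinitions
import Algebra.Properties.CommutativeMonoid.Sum as CommutativeMonoidSum
import Algebra.Properties.CommutativeSemigroup as CommutativeSemigroupProperties
import Algebra.Properties.Semiring.Sum as SemiringSum
open import Data.Bool.Base using (if_then_else_; _∧_)
import Data.Bool.Properties as Bool
open import Data.Fin.Base using (Fin; zero; suc; _↑ˡ_; _↑ʳ_)
import Data.Fin.Properties as Fin
open import Data.Fin.Subset
  using (Subset; Side; inside; outside; _∈_; _∉_; _⊆_; _⊂_; _∪_; _∩_; _─_; _-_; ⁅_⁆; ∁; ∣_∣; ⊥; ⊤)
open import Data.Fin.Subset.Induction using (⊂-wellFounded)
open import Data.Fin.Subset.Properties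
open import Data.Integer.Base as ℤ using (ℤ; +_; 0ℤ; 1ℤ; -1ℤ)
import Data.Integer.Properties as ℤ
import Data.Integer.Solver as ℤ-Solver
open import Data.List.Base as List
  using (List; []; _∷_; _++_; map; filter; cartesianProduct; cartesianProductWith; concatMap; allFin)
import Data.List.Extrema as Extrema
import Data.List.Extrema.Nat as ℕ-Extrema
open import Data.List.Membership.Propositional using (find) renaming (_∈_ to _∈ₗ_)
open import Data.List.Membership.Propositional.Properties
  using ( ∈-map⁺; ∈-map⁻; ∈-++⁺ˡ; ∈-++⁺ʳ; ∈-cartesianProductWith⁺; ∈-cartesianProductWith⁻
        ; ∈-concatMap⁺; ∈-allFin; ∈-filter⁺; ∈-filter⁻; ∈-lookup)
open import Data.List.Relation.Binary.Permutation.Propositional using (↭-sym)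
open import Data.List.Relation.Binary.Permutation.Propositional.Properties using (∈-resp-↭)
open import Data.List.Relation.Unary.All as All using (All; []; _∷_)
import Data.List.Relation.Unary.All.Properties as All
open import Data.List.Relation.Unary.AllPairs using (AllPairs; []; _∷_)
open import Data.List.Relation.Unary.Any as Any using (Any; here; there)
import Data.List.Relation.Unary.Any.Properties as Any
import Data.List.Relation.Unary.Sorted.TotalOrder.Properties as Sorted
import Data.List.Sort as Sort
open import Data.Nat.Base as ℕ using (ℕ; zero; suc; _+_; _≤_; _<_; z≤n; s≤s)
import Data.Nat.Properties as ℕ
open import Data.Product.Base using (_×_; _,_; proj₁; proj₂; ∃-syntax)
open import Data.Rational.Base as ℚ using (ℚ; 0ℚ; 1ℚ; ½)
import Data.Rational.Properties as ℚ
import Data.Rational.Solver as ℚ-Solver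
open import Data.Sum.Base using (_⊎_; inj₁; inj₂; [_,_]′)
open import Data.Vec.Base as Vec using (Vec; []; _∷_; lookup; here; there)
import Data.Vec.Properties as Vec
open import Function.Base using (_∘_; id)
open import Function.Bundles using (_↔_; Inverse; Equivalence)
import Induction.WellFounded as WellFounded
open import Level using (0ℓ)
open import Relation.Binary.Bundles using (DecTotalOrder)
open import Relation.Binary.Definitions using (Tri; tri<; tri≈; tri>)
open import Relation.Binary.PropositionalEquality
  using (_≡_; refl; sym; trans; cong; cong₂; subst; subst₂; module ≡-Reasoning)
open import Relation.Nullary.Decidable using (Dec; yes; no; does; _×-dec_; _→-dec_; ¬?; map′)
open import Relation.Nullary.Negation using (¬_; contradiction)
open import Relation.Unary using (Pred; Decidable)
open WellFounded using (Acc; acc)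

open SemiringSum ℤ.+-*-semiring using (sum; sum-cong-≗; *-distribˡ-sum)
  renaming (∑-distrib-+ to sum-distrib-+)
open SemiringSum (CommutativeRing.semiring ℚ.+-*-commutativeRing) using ()
  renaming ( sum to sumℚ; sum-cong-≗ to sumℚ-cong; *-distribˡ-sum to *-distribˡ-sumℚ
           ; *-distribʳ-sum to *-distribʳ-sumℚ; ∑-distrib-+ to sumℚ-distrib-+)
open CommutativeMonoidSum ℕ.+-0-commutativeMonoid using ()
  renaming (sum to sumℕ; sum-permute to sumℕ-permute; sum-cong-≗ to sumℕ-cong)

-- Indicators and finite sums

-- The obstacle is that absolute values are not linear. Once the sign of each alternating sum is
-- known from ranks and cardinalities alone, its absolute value is the sum times an explicit sign.
-- In the product the two factors (-1)^(rk F) cancel, and (-1)^(rk G) is the constant (-1)^i in the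
-- coefficient of t^i, so that no sign depends on the matroid any more. Independence of I and the
-- rank of A can be tested together because, for I ⊆ A, one basis can both contain I and meet A in
-- rk A elements; a lexicographic integer weight asks for both at once. The base polytope lives over
-- Cauchy reals, where order is not decidable. The hypothesis is therefore evaluated at rational
-- points only. A real witness of membership yields rational coefficients merely up to each error ε
-- > 0. So ε is made a variable of the linear system, the coefficients are eliminated, and the
-- remaining inequalities, affine in ε, pass to ε = 0. This makes membership of rational points
-- decidable.

_≟ₛ_ : ∀ {n} (A B : Subset n) → Dec (A ≡ B)
_≟ₛ_ = Vec.≡-dec Bool._≟_

indicator-cong : {P Q : Set} (P? : Dec P) (Q? : Dec Q) → (P → Q) → (Q → P) →
                 indicator P? ≡ indicator Q?
indicator-cong (yes p) (yes q) f g = refl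
indicator-cong (yes p) (no ¬q) f g = contradiction (f p) ¬q
indicator-cong (no ¬p) (yes q) f g = contradiction (g q) ¬p
indicator-cong (no ¬p) (no ¬q) f g = refl

indicator-yes : {P : Set} (P? : Dec P) → P → indicator P? ≡ 1ℤ
indicator-yes (yes _) p = refl
indicator-yes (no ¬p) p = contradiction p ¬p

indicator-no : {P : Set} (P? : Dec P) → ¬ P → indicator P? ≡ 0ℤ
indicator-no (yes p) ¬p = contradiction p ¬p
indicator-no (no _)  ¬p = refl

indicator-× : {P Q : Set} (P? : Dec P) (Q? : Dec Q) →
              indicator (P? ×-dec Q?) ≡ indicator P? ℤ.* indicator Q?
indicator-× (yes _) (yes _) = refl
indicator-× (yes _) (no _)  = refl
indicator-× (no _)  _       = refl

indicator-*-cong : {P : Set} (P? : Dec P) {a b : ℤ} → (P → a ≡ b) →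
                   indicator P? ℤ.* a ≡ indicator P? ℤ.* b
indicator-*-cong (yes p) eq = cong (1ℤ ℤ.*_) (eq p)
indicator-*-cong (no _)  {a} {b} eq = trans (ℤ.*-zeroˡ a) (sym (ℤ.*-zeroˡ b))

+-cong-right : ∀ a {b c} → b ≡ c → a ℤ.+ b ≡ a ℤ.+ c
+-cong-right a = cong (λ u → a ℤ.+ u)

∑ : {X : Set} → List X → (X → ℤ) → ℤ
∑ xs f = sumℤ (map f xs)

infixr 5 ∑
syntax ∑ xs (λ x → e) = ∑[ x ← xs ] e

module _ {X : Set} where

  ∑-cong : ∀ (xs : List X) {f g : X → ℤ} → (∀ x → f x ≡ g x) → ∑ xs f ≡ ∑ xs g
  ∑-cong []       f≡g = refl
  ∑-cong (x ∷ xs) f≡g = cong₂ ℤ._+_ (f≡g x) (∑-cong xs f≡g)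

  ∑-0 : ∀ (xs : List X) {f : X → ℤ} → (∀ x → f x ≡ 0ℤ) → ∑ xs f ≡ 0ℤ
  ∑-0 []       f≡0 = refl
  ∑-0 (x ∷ xs) f≡0 = cong₂ ℤ._+_ (f≡0 x) (∑-0 xs f≡0)

  ∑-distrib-+ : ∀ (xs : List X) (f g : X → ℤ) →
                ∑ xs (λ x → f x ℤ.+ g x) ≡ ∑ xs f ℤ.+ ∑ xs g
  ∑-distrib-+ []       f g = refl
  ∑-distrib-+ (x ∷ xs) f g = trans (+-cong-right (f x ℤ.+ g x) (∑-distrib-+ xs f g))
    (solve 4 (λ a b c d → (a :+ b) :+ (c :+ d) := (a :+ c) :+ (b :+ d)) refl
      (f x) (g x) (∑ xs f) (∑ xs g))
    where open ℤ-Solver.+-*-Solver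

  ∑-*ˡ : ∀ (xs : List X) c (f : X → ℤ) → ∑ xs (λ x → c ℤ.* f x) ≡ c ℤ.* ∑ xs f
  ∑-*ˡ []       c f = sym (ℤ.*-zeroʳ c)
  ∑-*ˡ (x ∷ xs) c f = trans (+-cong-right (c ℤ.* f x) (∑-*ˡ xs c f))
                            (sym (ℤ.*-distribˡ-+ c (f x) (∑ xs f)))

  ∑-++ : ∀ (xs ys : List X) (f : X → ℤ) → ∑ (xs ++ ys) f ≡ ∑ xs f ℤ.+ ∑ ys f
  ∑-++ []       ys f = sym (ℤ.+-identityˡ _)
  ∑-++ (x ∷ xs) ys f = trans (+-cong-right (f x) (∑-++ xs ys f)) (sym (ℤ.+-assoc (f x) _ _))

  ∑-filter : ∀ {P : Pred X 0ℓ} (P? : Decidable P) (xs : List X) (f : X → ℤ) →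
             ∑ (filter P? xs) f ≡ ∑[ x ← xs ] indicator (P? x) ℤ.* f x
  ∑-filter P? []       f = refl
  ∑-filter P? (x ∷ xs) f with P? x
  ... | yes _ = cong₂ ℤ._+_ (sym (ℤ.*-identityˡ (f x))) (∑-filter P? xs f)
  ... | no  _ = trans (∑-filter P? xs f)
                  (trans (sym (ℤ.+-identityˡ _)) (cong (ℤ._+ (∑[ y ← xs ] indicator (P? y) ℤ.* f y)) (sym (ℤ.*-zeroˡ (f x)))))

∑-map : ∀ {X Y : Set} (h : X → Y) xs (f : Y → ℤ) → ∑ (map h xs) f ≡ ∑ xs (f ∘ h)
∑-map h []       f = refl
∑-map h (x ∷ xs) f = +-cong-right (f (h x)) (∑-map h xs f)

module _ {X Y : Set} where

  ∑-swap : ∀ (xs : List X) (ys : List Y) (f : X → Y → ℤ) →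
           ∑[ x ← xs ] ∑[ y ← ys ] f x y ≡ ∑[ y ← ys ] ∑[ x ← xs ] f x y
  ∑-swap []       ys f = sym (∑-0 ys (λ _ → refl))
  ∑-swap (x ∷ xs) ys f = trans (+-cong-right (∑ ys (f x)) (∑-swap xs ys f))
                               (sym (∑-distrib-+ ys (f x) (λ y → ∑[ x ← xs ] f x y)))

  ∑-cartesianProduct : ∀ (xs : List X) (ys : List Y) (f : X × Y → ℤ) →
    ∑ (cartesianProduct xs ys) f ≡ ∑[ x ← xs ] ∑[ y ← ys ] f (x , y)
  ∑-cartesianProduct []       ys f = refl
  ∑-cartesianProduct (x ∷ xs) ys f =
    trans (∑-++ (map (x ,_) ys) (cartesianProduct xs ys) f)
          (cong₂ ℤ._+_ (∑-map (x ,_) ys f) (∑-cartesianProduct xs ys f))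

∑-subsets : ∀ {n} (f : Subset (suc n) → ℤ) →
  ∑ (subsets (suc n)) f ≡
  ∑ (subsets n) (f ∘ (outside ∷_)) ℤ.+ ∑ (subsets n) (f ∘ (inside ∷_))
∑-subsets {n} f =
  trans (∑-++ (map (outside ∷_) (subsets n)) _ f)
        (cong₂ ℤ._+_ (∑-map (outside ∷_) (subsets n) f) (∑-map (inside ∷_) (subsets n) f))

∑-δ : ∀ {n} (B : Subset n) (f : Subset n → ℤ) →
      ∑[ A ← subsets n ] indicator (A ≟ₛ B) ℤ.* f A ≡ f B
∑-δ []            f = trans (ℤ.+-identityʳ _) (ℤ.*-identityˡ (f []))
∑-δ {suc n} (outside ∷ B) f = begin
  ∑ (subsets (suc n)) (λ A → indicator (A ≟ₛ (outside ∷ B)) ℤ.* f A)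
    ≡⟨ ∑-subsets {n} (λ A → indicator (A ≟ₛ (outside ∷ B)) ℤ.* f A) ⟩
  _ ≡⟨ cong₂ ℤ._+_
         (trans (∑-cong (subsets n) (λ A → cong (ℤ._* f (outside ∷ A))
                   (indicator-cong ((outside ∷ A) ≟ₛ (outside ∷ B)) (A ≟ₛ B) Vec.∷-injectiveʳ (cong (outside ∷_)))))
                (∑-δ B (f ∘ (outside ∷_))))
         (∑-0 (subsets n) (λ A → ℤ.*-zeroˡ (f (inside ∷ A)))) ⟩
  f (outside ∷ B) ℤ.+ 0ℤ
    ≡⟨ ℤ.+-identityʳ _ ⟩
  f (outside ∷ B) ∎
  where open ≡-Reasoning
∑-δ {suc n} (inside ∷ B) f = begin
  ∑ (subsets (suc n)) (λ A → indicator (A ≟ₛ (inside ∷ B)) ℤ.* f A)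
    ≡⟨ ∑-subsets {n} (λ A → indicator (A ≟ₛ (inside ∷ B)) ℤ.* f A) ⟩
  _ ≡⟨ cong₂ ℤ._+_
         (∑-0 (subsets n) (λ A → ℤ.*-zeroˡ (f (outside ∷ A))))
         (trans (∑-cong (subsets n) (λ A → cong (ℤ._* f (inside ∷ A))
                   (indicator-cong ((inside ∷ A) ≟ₛ (inside ∷ B)) (A ≟ₛ B) Vec.∷-injectiveʳ (cong (inside ∷_)))))
                (∑-δ B (f ∘ (inside ∷_)))) ⟩
  0ℤ ℤ.+ f (inside ∷ B)
    ≡⟨ ℤ.+-identityˡ _ ⟩
  f (inside ∷ B) ∎
  where open ≡-Reasoning

-- Both sides are the sum of g over all pairs (A, B) with B = σ A.
∑-reindex : ∀ {m n} (σ : Subset n → Subset m) (τ : Subset m → Subset n) →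
  (∀ A → τ (σ A) ≡ A) → (∀ B → σ (τ B) ≡ B) → (g : Subset m → ℤ) →
  ∑ (subsets m) g ≡ ∑ (subsets n) (g ∘ σ)
∑-reindex {m} {n} σ τ τσ στ g = begin
  ∑[ B ← subsets m ] g B
    ≡⟨ ∑-cong (subsets m) (λ B → sym (∑-δ (τ B) (λ _ → g B))) ⟩
  ∑[ B ← subsets m ] ∑[ A ← subsets n ] indicator (A ≟ₛ τ B) ℤ.* g B
    ≡⟨ ∑-swap (subsets m) (subsets n) _ ⟩
  ∑[ A ← subsets n ] ∑[ B ← subsets m ] indicator (A ≟ₛ τ B) ℤ.* g B
    ≡⟨ ∑-cong (subsets n) (λ A → trans
         (∑-cong (subsets m) (λ B → cong (ℤ._* g B)
            (indicator-cong (A ≟ₛ τ B) (B ≟ₛ σ A)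
              (λ { refl → sym (στ B) }) (λ { refl → sym (τσ A) }))))
         (∑-δ (σ A) g)) ⟩
  ∑[ A ← subsets n ] g (σ A) ∎
  where open ≡-Reasoning

-- Polyhedra over ℚ and Fourier–Motzkin elimination

p≤q⇒0≤q-p : ∀ {p q} → p ℚ.≤ q → 0ℚ ℚ.≤ q ℚ.- p
p≤q⇒0≤q-p {p} {q} p≤q = subst (ℚ._≤ q ℚ.- p) (ℚ.+-inverseʳ p) (ℚ.+-monoˡ-≤ (ℚ.- p) p≤q)

0≤q-p⇒p≤q : ∀ {p q} → 0ℚ ℚ.≤ q ℚ.- p → p ℚ.≤ q
0≤q-p⇒p≤q {p} {q} h = subst₂ ℚ._≤_ (ℚ.+-identityˡ p) (cancel q p) (ℚ.+-monoˡ-≤ p h)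
  where
  open ℚ-Solver.+-*-Solver
  cancel : ∀ q p → q ℚ.- p ℚ.+ p ≡ q
  cancel = solve 2 (λ q p → q :- p :+ p := q) refl

0≤*⁺ : ∀ {c q} → 0ℚ ℚ.< c → 0ℚ ℚ.≤ q → 0ℚ ℚ.≤ c ℚ.* q
0≤*⁺ {c} {q} c>0 q≥0 = subst (ℚ._≤ c ℚ.* q) (ℚ.*-zeroʳ c)
  (ℚ.*-monoˡ-≤-nonNeg c {{ℚ.pos⇒nonNeg c {{ℚ.positive c>0}}}} q≥0)

0≤*⁻ : ∀ {c q} → 0ℚ ℚ.< c → 0ℚ ℚ.≤ c ℚ.* q → 0ℚ ℚ.≤ q
0≤*⁻ {c} {q} c>0 cq≥0 = ℚ.*-cancelˡ-≤-pos c {{ℚ.positive c>0}}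
  (subst (ℚ._≤ c ℚ.* q) (sym (ℚ.*-zeroʳ c)) cq≥0)

-- a ∷ … ∷ c ∷ [] stands for the function x ↦ a x₀ + … + c.
Affine : ℕ → Set
Affine n = Vec ℚ (suc n)

eval : ∀ {n} → Affine n → Vec ℚ n → ℚ
eval ℓ       []      = Vec.head ℓ
eval (a ∷ ℓ) (y ∷ x) = a ℚ.* y ℚ.+ eval ℓ x

infixl 6 _⊕_
infixl 7 _⊛_

_⊕_ : ∀ {n} → Affine n → Affine n → Affine n
_⊕_ = Vec.zipWith ℚ._+_

_⊛_ : ∀ {n} → ℚ → Affine n → Affine n
c ⊛ ℓ = Vec.map (c ℚ.*_) ℓ

eval-⊕ : ∀ {n} (ℓ m : Affine n) x → eval (ℓ ⊕ m) x ≡ eval ℓ x ℚ.+ eval m x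
eval-⊕ (c ∷ []) (d ∷ []) [] = refl
eval-⊕ (a ∷ ℓ) (b ∷ m) (y ∷ x) =
  trans (cong ((a ℚ.+ b) ℚ.* y ℚ.+_) (eval-⊕ ℓ m x))
    (solve 5 (λ a b y l m → (a :+ b) :* y :+ (l :+ m) := (a :* y :+ l) :+ (b :* y :+ m)) refl
      a b y (eval ℓ x) (eval m x))
  where open ℚ-Solver.+-*-Solver

eval-⊛ : ∀ {n} c (ℓ : Affine n) x → eval (c ⊛ ℓ) x ≡ c ℚ.* eval ℓ x
eval-⊛ c (d ∷ []) [] = refl
eval-⊛ c (a ∷ ℓ) (y ∷ x) =
  trans (cong ((c ℚ.* a) ℚ.* y ℚ.+_) (eval-⊛ c ℓ x))
    (solve 4 (λ c a y l → (c :* a) :* y :+ c :* l := c :* (a :* y :+ l)) refl c a y (eval ℓ x))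
  where open ℚ-Solver.+-*-Solver

Polyhedron : ℕ → Set
Polyhedron n = List (Affine n)

_∋_ : ∀ {n} → Polyhedron n → Vec ℚ n → Set
K ∋ x = All (λ ℓ → 0ℚ ℚ.≤ eval ℓ x) K

_∋?_ : ∀ {n} (K : Polyhedron n) x → Dec (K ∋ x)
K ∋? x = All.all? (λ ℓ → 0ℚ ℚ.≤? eval ℓ x) K

-- The inequalities of a polyhedron solved for the first coordinate y:
-- α(x) ≤ y, y ≤ β(x) and 0 ≤ γ(x).
record Bounds (n : ℕ) : Set where
  constructor bounds
  field
    lowers uppers : List (Affine n)
    rest          : Polyhedron n

open Bounds

Between : List ℚ → List ℚ → Pred ℚ 0ℓ
Between ls us y = All (ℚ._≤ y) ls × All (y ℚ.≤_) us

lowerValues upperValues : ∀ {n} → Bounds n → Vec ℚ n → List ℚ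
lowerValues b x = map (λ α → eval α x) (lowers b)
upperValues b x = map (λ β → eval β x) (uppers b)

Within : ∀ {n} → Bounds n → Vec ℚ n → ℚ → Set
Within b x y = Between (lowerValues b x) (upperValues b x) y × rest b ∋ x

-- For a > 0 the inequality 0 ≤ a y + l is the lower bound -l/a ≤ y; for a < 0 it is the upper bound
-- y ≤ -l/a.
-1/⁺ : ∀ a → 0ℚ ℚ.< a → ℚ
-1/⁺ a a>0 = ℚ.- (ℚ.1/ a) {{ℚ.pos⇒nonZero a {{ℚ.positive a>0}}}}

-1/⁻ : ∀ a → a ℚ.< 0ℚ → ℚ
-1/⁻ a a<0 = ℚ.- (ℚ.1/ a) {{ℚ.neg⇒nonZero a {{ℚ.negative a<0}}}}

solveFirst : ∀ {n} a → Affine n → Tri (a ℚ.< 0ℚ) (a ≡ 0ℚ) (0ℚ ℚ.< a) → Bounds n → Bounds n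
solveFirst a ℓ (tri< a<0 _ _) (bounds ls us K) =
  bounds ls (-1/⁻ a a<0 ⊛ ℓ ∷ us) K
solveFirst a ℓ (tri≈ _ _ _)   (bounds ls us K) = bounds ls us (ℓ ∷ K)
solveFirst a ℓ (tri> _ _ a>0) (bounds ls us K) =
  bounds (-1/⁺ a a>0 ⊛ ℓ ∷ ls) us K

split : ∀ {n} → Polyhedron (suc n) → Bounds n
split []            = bounds [] [] []
split ((a ∷ ℓ) ∷ K) = solveFirst a ℓ (ℚ.<-cmp a 0ℚ) (split K)

module _ {n} (a : ℚ) (ℓ : Affine n) (y : ℚ) (x : Vec ℚ n) where

  private
    l = eval ℓ x

    lower-identity : .{{_ : ℚ.NonZero a}} → ℚ.1/ a ℚ.* (a ℚ.* y ℚ.+ l) ≡ y ℚ.- (ℚ.- (ℚ.1/ a) ℚ.* l)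
    lower-identity = trans
      (solve 4 (λ i a y l → i :* (a :* y :+ l) := (i :* a) :* y :- (:- i :* l)) refl (ℚ.1/ a) a y l)
      (cong (ℚ._- (ℚ.- (ℚ.1/ a) ℚ.* l)) (trans (cong (ℚ._* y) (ℚ.*-inverseˡ a)) (ℚ.*-identityˡ y)))
      where open ℚ-Solver.+-*-Solver

    upper-identity : .{{_ : ℚ.NonZero a}} → ℚ.- (ℚ.1/ a) ℚ.* (a ℚ.* y ℚ.+ l) ≡ (ℚ.- (ℚ.1/ a) ℚ.* l) ℚ.- y
    upper-identity = trans
      (solve 4 (λ i a y l → :- i :* (a :* y :+ l) := (:- i :* l) :- ((i :* a) :* y)) refl (ℚ.1/ a) a y l)
      (cong (λ u → (ℚ.- (ℚ.1/ a) ℚ.* l) ℚ.- u) (trans (cong (ℚ._* y) (ℚ.*-inverseˡ a)) (ℚ.*-identityˡ y)))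
      where open ℚ-Solver.+-*-Solver

    zero-identity : a ≡ 0ℚ → a ℚ.* y ℚ.+ l ≡ l
    zero-identity refl = trans (cong (ℚ._+ l) (ℚ.*-zeroˡ y)) (ℚ.+-identityˡ l)

    1/a>0 : (a>0 : 0ℚ ℚ.< a) → 0ℚ ℚ.< (ℚ.1/ a) {{ℚ.pos⇒nonZero a {{ℚ.positive a>0}}}}
    1/a>0 a>0 = ℚ.positive⁻¹ _ {{ℚ.1/pos⇒pos a {{ℚ.positive a>0}}}}

    -1/a>0 : (a<0 : a ℚ.< 0ℚ) → 0ℚ ℚ.< ℚ.- (ℚ.1/ a) {{ℚ.neg⇒nonZero a {{ℚ.negative a<0}}}}
    -1/a>0 a<0 = ℚ.neg-antimono-< (ℚ.negative⁻¹ _ {{ℚ.1/neg⇒neg a {{ℚ.negative a<0}}}})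

  solveFirst⁺ : ∀ t b → 0ℚ ℚ.≤ a ℚ.* y ℚ.+ l → Within b x y → Within (solveFirst a ℓ t b) x y
  solveFirst⁺ (tri< a<0 _ _) b h ((ls , us) , r) =
    (ls , subst (y ℚ.≤_) (sym (eval-⊛ (-1/⁻ a a<0) ℓ x))
            (0≤q-p⇒p≤q (subst (0ℚ ℚ.≤_) (upper-identity {{ℚ.neg⇒nonZero a {{ℚ.negative a<0}}}})
              (0≤*⁺ (-1/a>0 a<0) h))) ∷ us) , r
  solveFirst⁺ (tri≈ _ a≡0 _) b h (bs , r) = bs , subst (0ℚ ℚ.≤_) (zero-identity a≡0) h ∷ r
  solveFirst⁺ (tri> _ _ a>0) b h ((ls , us) , r) =
    (subst (ℚ._≤ y) (sym (eval-⊛ (-1/⁺ a a>0) ℓ x))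
      (0≤q-p⇒p≤q (subst (0ℚ ℚ.≤_) (lower-identity {{ℚ.pos⇒nonZero a {{ℚ.positive a>0}}}})
        (0≤*⁺ (1/a>0 a>0) h))) ∷ ls , us) , r

  solveFirst⁻ : ∀ t b → Within (solveFirst a ℓ t b) x y → 0ℚ ℚ.≤ a ℚ.* y ℚ.+ l × Within b x y
  solveFirst⁻ (tri< a<0 _ _) b ((ls , u ∷ us) , r) =
    0≤*⁻ (-1/a>0 a<0) (subst (0ℚ ℚ.≤_) (sym (upper-identity {{ℚ.neg⇒nonZero a {{ℚ.negative a<0}}}}))
      (p≤q⇒0≤q-p (subst (y ℚ.≤_) (eval-⊛ (-1/⁻ a a<0) ℓ x) u))) , (ls , us) , r
  solveFirst⁻ (tri≈ _ a≡0 _) b (bs , h ∷ r) = subst (0ℚ ℚ.≤_) (sym (zero-identity a≡0)) h , bs , r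
  solveFirst⁻ (tri> _ _ a>0) b ((l ∷ ls , us) , r) =
    0≤*⁻ (1/a>0 a>0) (subst (0ℚ ℚ.≤_) (sym (lower-identity {{ℚ.pos⇒nonZero a {{ℚ.positive a>0}}}}))
      (p≤q⇒0≤q-p (subst (ℚ._≤ y) (eval-⊛ (-1/⁺ a a>0) ℓ x) l))) , (ls , us) , r

split⁺ : ∀ {n} (K : Polyhedron (suc n)) y x → K ∋ (y ∷ x) → Within (split K) x y
split⁺ []                    y x []      = ([] , []) , []
split⁺ ((a ∷ ℓ) ∷ K) y x (h ∷ hs) =
  solveFirst⁺ a ℓ y x (ℚ.<-cmp a 0ℚ) (split K) h (split⁺ K y x hs)

split⁻ : ∀ {n} (K : Polyhedron (suc n)) y x → Within (split K) x y → K ∋ (y ∷ x)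
split⁻ []                    y x _ = []
split⁻ ((a ∷ ℓ) ∷ K) y x w =
  let h , w′ = solveFirst⁻ a ℓ y x (ℚ.<-cmp a 0ℚ) (split K) w in h ∷ split⁻ K y x w′

-- Some y fits between the bounds exactly when every lower bound α is at most every upper bound β,
-- that is, 0 ≤ β - α.
eliminate : ∀ {n} → Polyhedron (suc n) → Polyhedron n
eliminate K = rest b ++ cartesianProductWith (λ α β → β ⊕ (ℚ.- 1ℚ) ⊛ α) (lowers b) (uppers b)
  where b = split K

eval-β-α : ∀ {n} (α β : Affine n) x → eval (β ⊕ (ℚ.- 1ℚ) ⊛ α) x ≡ eval β x ℚ.- eval α x
eval-β-α α β x = trans (eval-⊕ β _ x) (cong (eval β x ℚ.+_)
  (trans (eval-⊛ (ℚ.- 1ℚ) α x) (trans (sym (ℚ.neg-distribˡ-* 1ℚ (eval α x))) (cong ℚ.-_ (ℚ.*-identityˡ _)))))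

-- The points 0, max ls and min us are enough to meet any nonempty interval.
between-nonempty : ∀ ls us → (∀ {l u} → l ∈ₗ ls → u ∈ₗ us → l ℚ.≤ u) →
                   Any (Between ls us) (0ℚ ∷ ls ++ us)
between-nonempty [] [] h = here ([] , [])
between-nonempty [] (u ∷ us) h =
  there (Any.map (λ { refl → [] , min≤⊤ u us ∷ min≤xs u us }) min∈)
  where
  open Extrema (DecTotalOrder.totalOrder ℚ.≤-decTotalOrder)
  min∈ : min u us ∈ₗ u ∷ us
  min∈ with argmin-sel id u us
  ... | inj₁ eq = here eq
  ... | inj₂ m∈ = there m∈
between-nonempty (l ∷ ls) us h =
  there (Any.map (λ { refl → ⊥≤max l ls ∷ xs≤max l ls , All.tabulate (h max∈) }) (∈-++⁺ˡ max∈))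
  where
  open Extrema (DecTotalOrder.totalOrder ℚ.≤-decTotalOrder)
  max∈ : max l ls ∈ₗ l ∷ ls
  max∈ with argmax-sel id l ls
  ... | inj₁ eq = here eq
  ... | inj₂ m∈ = there m∈

endpoints : ∀ {n} → Polyhedron (suc n) → Vec ℚ n → List ℚ
endpoints K x = lowerValues (split K) x ++ upperValues (split K) x

-- The witness comes from an explicit finite list, so that finitely many sample points decide
-- whether a fibre is empty.
eliminate⁻ : ∀ {n} (K : Polyhedron (suc n)) x → eliminate K ∋ x →
             Any (λ y → K ∋ (y ∷ x)) (0ℚ ∷ endpoints K x)
eliminate⁻ K x h = Any.map (λ w → split⁻ K _ x (w , All.++⁻ˡ (rest b) h))
  (between-nonempty (lowerValues b x) (upperValues b x) lower≤upper)
  where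
  b = split K
  lower≤upper : ∀ {l u} → l ∈ₗ lowerValues b x → u ∈ₗ upperValues b x → l ℚ.≤ u
  lower≤upper l∈ u∈ with ∈-map⁻ _ l∈ | ∈-map⁻ _ u∈
  ... | α , α∈ , refl | β , β∈ , refl = 0≤q-p⇒p≤q (subst (0ℚ ℚ.≤_) (eval-β-α α β x)
    (All.lookup (All.++⁻ʳ (rest b) h) (∈-cartesianProductWith⁺ _ α∈ β∈)))

eliminate⁺ : ∀ {n} (K : Polyhedron (suc n)) y x → K ∋ (y ∷ x) → eliminate K ∋ x
eliminate⁺ K y x h with split⁺ K y x h
... | (ls , us) , r = All.++⁺ r (All.tabulate combined)
  where
  b = split K
  combined : ∀ {ℓ} → ℓ ∈ₗ cartesianProductWith (λ α β → β ⊕ (ℚ.- 1ℚ) ⊛ α) (lowers b) (uppers b) →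
             0ℚ ℚ.≤ eval ℓ x
  combined ℓ∈ with ∈-cartesianProductWith⁻ _ (lowers b) (uppers b) ℓ∈
  ... | α , β , α∈ , β∈ , refl = subst (0ℚ ℚ.≤_) (sym (eval-β-α α β x)) (p≤q⇒0≤q-p
    (ℚ.≤-trans (All.lookup (All.map⁻ ls) α∈) (All.lookup (All.map⁻ us) β∈)))

eliminateAll : ∀ k {n} → Polyhedron (k ℕ.+ n) → Polyhedron n
eliminateAll zero    K = K
eliminateAll (suc k) K = eliminateAll k (eliminate K)

eliminateAll⁺ : ∀ k {n} (K : Polyhedron (k ℕ.+ n)) (c : Vec ℚ k) x →
                K ∋ (c Vec.++ x) → eliminateAll k K ∋ x
eliminateAll⁺ zero    K []      x h = h
eliminateAll⁺ (suc k) K (y ∷ c) x h =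
  eliminateAll⁺ k (eliminate K) c x (eliminate⁺ K y (c Vec.++ x) h)

eliminateAll⁻ : ∀ k {n} (K : Polyhedron (k ℕ.+ n)) x →
                eliminateAll k K ∋ x → ∃[ c ] K ∋ (c Vec.++ x)
eliminateAll⁻ zero    K x h = [] , h
eliminateAll⁻ (suc k) K x h =
  let c , h′ = eliminateAll⁻ k (eliminate K) x h
      y , h″ = Any.satisfied (eliminate⁻ K (c Vec.++ x) h′)
  in y ∷ c , h″

feasible? : ∀ {n} (K : Polyhedron n) → Dec (∃[ x ] K ∋ x)
feasible? {zero}  K = map′ ([] ,_) (λ { ([] , h) → h }) (K ∋? [])
feasible? {suc n} K = map′
  (λ (x , h) → let y , h′ = Any.satisfied (eliminate⁻ K x h) in y ∷ x , h′)
  (λ { (y ∷ x , h) → x , eliminate⁺ K y x h })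
  (feasible? (eliminate K))

-- The Euler characteristic of polyhedra

midpoint : ℚ → ℚ → ℚ
midpoint p q = ½ ℚ.* (p ℚ.+ q)

½+½ : ∀ p → ½ ℚ.* (p ℚ.+ p) ≡ p
½+½ p = trans (solve 1 (λ p → con ½ :* (p :+ p) := p) refl p) refl
  where open ℚ-Solver.+-*-Solver

≤midpoint : ∀ {p q} → p ℚ.≤ q → p ℚ.≤ midpoint p q
≤midpoint {p} {q} p≤q = subst (ℚ._≤ midpoint p q) (½+½ p)
  (ℚ.*-monoˡ-≤-nonNeg ½ (ℚ.+-monoʳ-≤ p p≤q))

midpoint≤ : ∀ {p q} → p ℚ.≤ q → midpoint p q ℚ.≤ q
midpoint≤ {p} {q} p≤q = subst (midpoint p q ℚ.≤_) (½+½ q)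
  (ℚ.*-monoˡ-≤-nonNeg ½ (ℚ.+-monoˡ-≤ q p≤q))

-- Vertices minus edges of the subdivided segment from the first to the last point, each weighted by
-- χ and each edge sampled at its midpoint: an Euler characteristic that is linear in χ.
alternatingSum : List ℚ → (ℚ → ℤ) → ℤ
alternatingSum []          χ = 0ℤ
alternatingSum (p ∷ [])    χ = χ p
alternatingSum (p ∷ q ∷ D) χ = (χ p ℤ.- χ (midpoint p q)) ℤ.+ alternatingSum (q ∷ D) χ

between-convex : ∀ {ls us x y z} → x ℚ.≤ y → y ℚ.≤ z → Between ls us x → Between ls us z →
                 Between ls us y
between-convex x≤y y≤z (ls , _) (_ , us) =
  All.map (λ l≤x → ℚ.≤-trans l≤x x≤y) ls , All.map (ℚ.≤-trans y≤z) us

-- `P` is empty or the whole interval: in a fibre of a polyhedron the inequalities free of the first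
-- coordinate hold throughout or exclude the fibre altogether.
module _ (ls us : List ℚ) {P : Pred ℚ 0ℓ} (P? : Decidable P)
         (P⇒between : ∀ {y z} → P z → P y → Between ls us y)
         (between⇒P : ∀ {y z} → P z → Between ls us y → P y) where

  -- A nonempty interval contains one more of the sorted points than of the
  -- midpoints between neighbours, provided no endpoint of the interval lies
  -- strictly between neighbours.
  alternatingSum-interval : ∀ p D → AllPairs ℚ._≤_ (p ∷ D) →
    (∀ {e} → e ∈ₗ ls ++ us → e ℚ.≤ p ⊎ e ∈ₗ D) →
    alternatingSum (p ∷ D) (λ y → indicator (P? y)) ≡ indicator (Any.any? P? (p ∷ D))
  alternatingSum-interval p [] sorted covered =
    indicator-cong (P? p) (Any.any? P? (p ∷ [])) here (λ { (here Pp) → Pp })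
  alternatingSum-interval p (q ∷ D) ((p≤q ∷ p≤D) ∷ q≤D ∷ sorted) covered
    with alternatingSum-interval q D (q≤D ∷ sorted) covered′
    where
    covered′ : ∀ {e} → e ∈ₗ ls ++ us → e ℚ.≤ q ⊎ e ∈ₗ D
    covered′ e∈ with covered e∈
    ... | inj₁ e≤p         = inj₁ (ℚ.≤-trans e≤p p≤q)
    ... | inj₂ (here refl) = inj₁ ℚ.≤-refl
    ... | inj₂ (there e∈D) = inj₂ e∈D
  ... | IH = step (P? p) (P? q) (P? m)
    where
    m = midpoint p q
    S = alternatingSum (q ∷ D) (λ y → indicator (P? y))

    separated : ∀ {e} → e ∈ₗ ls ++ us → e ℚ.≤ p ⊎ q ℚ.≤ e
    separated e∈ with covered e∈
    ... | inj₁ e≤p         = inj₁ e≤p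
    ... | inj₂ (here refl) = inj₂ ℚ.≤-refl
    ... | inj₂ (there e∈D) = inj₂ (All.lookup q≤D e∈D)

    -- The sorted list may repeat points: if m is not strictly below q, then p, m and q coincide.
    q≤m⇒m≤p : q ℚ.≤ m → m ℚ.≤ p
    q≤m⇒m≤p q≤m = ℚ.≤-trans
      (ℚ.*-monoˡ-≤-nonNeg ½ (ℚ.+-monoʳ-≤ p q≤p)) (ℚ.≤-reflexive (½+½ p))
      where
      q≤p : q ℚ.≤ p
      q≤p = 0≤q-p⇒p≤q (subst (0ℚ ℚ.≤_) (double p q)
        (0≤*⁺ {ℚ.1ℚ ℚ.+ ℚ.1ℚ} (ℚ.positive⁻¹ (ℚ.1ℚ ℚ.+ ℚ.1ℚ)) (p≤q⇒0≤q-p q≤m)))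
        where
        open ℚ-Solver.+-*-Solver
        double : ∀ p q → (1ℚ ℚ.+ 1ℚ) ℚ.* (½ ℚ.* (p ℚ.+ q) ℚ.- q) ≡ p ℚ.- q
        double = solve 2 (λ p q → (con 1ℚ :+ con 1ℚ) :* (con ½ :* (p :+ q) :- q) := p :- q) refl

    m≤p⇒q≤m : m ℚ.≤ p → q ℚ.≤ m
    m≤p⇒q≤m m≤p = ℚ.≤-trans (ℚ.≤-reflexive (sym (½+½ q)))
      (ℚ.*-monoˡ-≤-nonNeg ½ (ℚ.+-monoˡ-≤ q q≤p))
      where
      q≤p : q ℚ.≤ p
      q≤p = 0≤q-p⇒p≤q (subst (0ℚ ℚ.≤_) (double p q)
        (0≤*⁺ {ℚ.1ℚ ℚ.+ ℚ.1ℚ} (ℚ.positive⁻¹ (ℚ.1ℚ ℚ.+ ℚ.1ℚ)) (p≤q⇒0≤q-p m≤p)))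
        where
        open ℚ-Solver.+-*-Solver
        double : ∀ p q → (1ℚ ℚ.+ 1ℚ) ℚ.* (p ℚ.- ½ ℚ.* (p ℚ.+ q)) ≡ p ℚ.- q
        double = solve 2 (λ p q → (con 1ℚ :+ con 1ℚ) :* (p :- con ½ :* (p :+ q)) := p :- q) refl

    -- A lower endpoint that is at most m does not lie strictly between p and q, so it is at most p;
    -- in the degenerate case p = q this holds because m ≤ p.
    m∈⇒p∈ : P m → P p
    m∈⇒p∈ Pm with P⇒between Pm Pm
    ... | l≤m , m≤u = between⇒P Pm
      ( All.tabulate (λ l∈ → below (separated (∈-++⁺ˡ l∈)) (All.lookup l≤m l∈))
      , All.map (ℚ.≤-trans (≤midpoint p≤q)) m≤u)
      where
      below : ∀ {l} → l ℚ.≤ p ⊎ q ℚ.≤ l → l ℚ.≤ m → l ℚ.≤ p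
      below (inj₁ l≤p) l≤m = l≤p
      below (inj₂ q≤l) l≤m = ℚ.≤-trans l≤m (q≤m⇒m≤p (ℚ.≤-trans q≤l l≤m))

    m∈⇒q∈ : P m → P q
    m∈⇒q∈ Pm with P⇒between Pm Pm
    ... | l≤m , m≤u = between⇒P Pm
      ( All.map (λ l≤m → ℚ.≤-trans l≤m (midpoint≤ p≤q)) l≤m
      , All.tabulate (λ u∈ → above (separated (∈-++⁺ʳ ls u∈)) (All.lookup m≤u u∈)))
      where
      above : ∀ {u} → u ℚ.≤ p ⊎ q ℚ.≤ u → m ℚ.≤ u → q ℚ.≤ u
      above (inj₁ u≤p) m≤u = ℚ.≤-trans (m≤p⇒q≤m (ℚ.≤-trans m≤u u≤p)) m≤u
      above (inj₂ q≤u) m≤u = q≤u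

    convex : ∀ {x y z} → x ℚ.≤ y → y ℚ.≤ z → P x → P z → P y
    convex x≤y y≤z Px Pz = between⇒P Px (between-convex x≤y y≤z (P⇒between Px Px) (P⇒between Px Pz))

    ¬later : P p → ¬ P q → ¬ Any P (q ∷ D)
    ¬later Pp ¬Pq (here Pq) = ¬Pq Pq
    ¬later Pp ¬Pq (there any) = ¬Pq (All.lookupWith (λ q≤z Pz → convex p≤q q≤z Pp Pz) q≤D any)

    -- A point of `P` is cancelled by the midpoint after it unless no later point of the list lies
    -- in `P`, so exactly the last one is counted.
    step : (p? : Dec (P p)) (q? : Dec (P q)) (m? : Dec (P m)) →
           (indicator p? ℤ.- indicator m?) ℤ.+ S ≡ indicator (Any.any? P? (p ∷ q ∷ D))
    step (no ¬Pp) q? (yes Pm) = contradiction (m∈⇒p∈ Pm) ¬Pp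
    step (no ¬Pp) q? (no ¬Pm) = trans (ℤ.+-identityˡ S) (trans IH
      (indicator-cong (Any.any? P? (q ∷ D)) (Any.any? P? (p ∷ q ∷ D)) there
        (λ { (here Pp) → contradiction Pp ¬Pp ; (there any) → any })))
    step (yes Pp) (yes Pq) (no ¬Pm) = contradiction (convex (≤midpoint p≤q) (midpoint≤ p≤q) Pp Pq) ¬Pm
    step (yes Pp) (no ¬Pq) (yes Pm) = contradiction (m∈⇒q∈ Pm) ¬Pq
    step (yes Pp) (yes Pq) (yes Pm) = trans (ℤ.+-identityˡ S) (trans IH (trans
      (indicator-yes (Any.any? P? (q ∷ D)) (here Pq))
      (sym (indicator-yes (Any.any? P? (p ∷ q ∷ D)) (here Pp)))))
    step (yes Pp) (no ¬Pq) (no ¬Pm) = trans (cong (λ u → 1ℤ ℤ.+ u) (trans IH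
      (indicator-no (Any.any? P? (q ∷ D)) (¬later Pp ¬Pq))))
      (sym (indicator-yes (Any.any? P? (p ∷ q ∷ D)) (here Pp)))

module _ {s} (a : Fin s → ℤ) where

  -- The valuation condition for fixed coefficients `a`. Being linear in f, it is preserved by all
  -- linear operations whose constants do not depend on the index i.
  Cancels : (Fin s → ℤ) → Set
  Cancels f = sum (λ i → a i ℤ.* f i) ≡ 0ℤ

  cancels-cong : ∀ {f g} → (∀ i → f i ≡ g i) → Cancels f → Cancels g
  cancels-cong f≡g h = trans (sum-cong-≗ (λ i → cong (λ u → a i ℤ.* u) (sym (f≡g i)))) h

  cancels-+ : ∀ {f g} → Cancels f → Cancels g → Cancels (λ i → f i ℤ.+ g i)
  cancels-+ {f} {g} hf hg = trans
    (sum-cong-≗ (λ i → ℤ.*-distribˡ-+ (a i) (f i) (g i)))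
    (trans (sum-distrib-+ (λ i → a i ℤ.* f i) (λ i → a i ℤ.* g i)) (cong₂ ℤ._+_ hf hg))

  cancels-* : ∀ c {f} → Cancels f → Cancels (λ i → c ℤ.* f i)
  cancels-* c {f} hf = trans
    (sum-cong-≗ (λ i → solve 3 (λ a c f → a :* (c :* f) := c :* (a :* f)) refl (a i) c (f i)))
    (trans (sym (*-distribˡ-sum c (λ i → a i ℤ.* f i))) (trans (cong (λ u → c ℤ.* u) hf) (ℤ.*-zeroʳ c)))
    where open ℤ-Solver.+-*-Solver

  cancels-0 : Cancels (λ _ → 0ℤ)
  cancels-0 = trans (sum-cong-≗ (λ i → ℤ.*-comm (a i) 0ℤ))
                    (sym (*-distribˡ-sum 0ℤ a))

  cancels-minus : ∀ {f g} → Cancels f → Cancels g → Cancels (λ i → f i ℤ.- g i)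
  cancels-minus {f} {g} hf hg = cancels-cong
    (λ i → cong (λ u → f i ℤ.+ u) (ℤ.-1*i≡-i (g i)))
    (cancels-+ hf (cancels-* -1ℤ hg))

  cancels-∑ : ∀ {X : Set} (xs : List X) {f : X → Fin s → ℤ} →
              (∀ x → Cancels (f x)) → Cancels (λ i → ∑[ x ← xs ] f x i)
  cancels-∑ []       h = cancels-0
  cancels-∑ (x ∷ xs) h = cancels-+ (h x) (cancels-∑ xs h)

  cancels-alternatingSum : ∀ D {χ : Fin s → ℚ → ℤ} → (∀ y → Cancels (λ i → χ i y)) →
                           Cancels (λ i → alternatingSum D (χ i))
  cancels-alternatingSum []          h = cancels-0
  cancels-alternatingSum (p ∷ [])    h = h p
  cancels-alternatingSum (p ∷ q ∷ D) h =
    cancels-+ (cancels-minus (h p) (h (midpoint p q))) (cancels-alternatingSum (q ∷ D) h)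

  private
    module S = Sort ℚ.≤-decTotalOrder
    ℚ-order = DecTotalOrder.totalOrder ℚ.≤-decTotalOrder

  -- One list `D` with the endpoints of all fibres over x serves every `K i`. The alternating sum
  -- over `D` is then one linear functional that takes the value 1 on nonempty fibres, bounded or
  -- not, and 0 on empty ones.
  cancels-eliminate : ∀ {n} (K : Fin s → Polyhedron (suc n)) x →
    (∀ y → Cancels (λ i → indicator (K i ∋? (y ∷ x)))) →
    Cancels (λ i → indicator (eliminate (K i) ∋? x))
  cancels-eliminate {n} K x h = cancels-cong value (cancels-alternatingSum D h)
    where
    points D : List ℚ
    -- The point 0 serves fibres without endpoints, which are empty or the whole line.
    points = 0ℚ ∷ concatMap (λ i → endpoints (K i) x) (allFin s)
    D = S.sort points

    endpoint∈D : ∀ i {e} → e ∈ₗ endpoints (K i) x → e ∈ₗ D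
    endpoint∈D i e∈ = ∈-resp-↭ (↭-sym (S.sort-↭ points))
      (there (∈-concatMap⁺ (λ i → endpoints (K i) x) {allFin s}
        (Any.map (λ { refl → e∈ }) (∈-allFin i))))

    0∈D : 0ℚ ∈ₗ D
    0∈D = ∈-resp-↭ (↭-sym (S.sort-↭ points)) (here refl)

    meets : ∀ i → eliminate (K i) ∋ x → Any (λ y → K i ∋ (y ∷ x)) D
    meets i hx with eliminate⁻ (K i) x hx
    ... | here Py   = Any.map (λ { refl → Py }) 0∈D
    ... | there any = let y , y∈ , Py = find any in Any.map (λ { refl → Py }) (endpoint∈D i y∈)

    sum-on : ∀ i E → AllPairs ℚ._≤_ E → (∀ {e} → e ∈ₗ endpoints (K i) x → e ∈ₗ E) →
      alternatingSum E (λ y → indicator (K i ∋? (y ∷ x))) ≡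
      indicator (Any.any? (λ y → K i ∋? (y ∷ x)) E)
    sum-on i []      _      _    = refl
    sum-on i (p ∷ E) sorted ends = alternatingSum-interval
      (lowerValues (split (K i)) x) (upperValues (split (K i)) x) (λ y → K i ∋? (y ∷ x))
      (λ _ Py → proj₁ (split⁺ (K i) _ x Py))
      (λ Pz b → split⁻ (K i) _ x (b , proj₂ (split⁺ (K i) _ x Pz)))
      p E sorted λ e∈ → place (ends e∈)
      where
      place : ∀ {e} → e ∈ₗ p ∷ E → e ℚ.≤ p ⊎ e ∈ₗ E
      place (here refl) = inj₁ ℚ.≤-refl
      place (there e∈)  = inj₂ e∈

    value : ∀ i → alternatingSum D (λ y → indicator (K i ∋? (y ∷ x))) ≡
                  indicator (eliminate (K i) ∋? x)
    value i = trans
      (sum-on i D (Sorted.Sorted⇒AllPairs ℚ-order (S.sort-↗ points)) (endpoint∈D i))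
      (indicator-cong (Any.any? (λ y → K i ∋? (y ∷ x)) D) (eliminate (K i) ∋? x)
        (λ any → let y , Py = Any.satisfied any in eliminate⁺ (K i) y x Py)
        (meets i))

  -- A polyhedron is empty exactly when its projection is, and the relation passes to the
  -- projections point by point. In dimension zero the only point decides.
  cancels-nonempty : ∀ {n} (K : Fin s → Polyhedron n) →
    (∀ x → Cancels (λ i → indicator (K i ∋? x))) →
    Cancels (λ i → indicator (feasible? (K i)))
  cancels-nonempty {zero}  K h = cancels-cong
    (λ i → indicator-cong (K i ∋? []) (feasible? (K i)) ([] ,_) (λ { ([] , e) → e })) (h [])
  cancels-nonempty {suc n} K h = cancels-cong
    (λ i → indicator-cong (feasible? (eliminate (K i))) (feasible? (K i))
      (λ (x , e) → let y , e′ = Any.satisfied (eliminate⁻ (K i) x e) in y ∷ x , e′)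
      (λ { (y ∷ x , e) → x , eliminate⁺ (K i) y x e }))
    (cancels-nonempty (eliminate ∘ K) (λ x → cancels-eliminate K x (λ y → h (y ∷ x))))

-- Convex hulls of vertices as polyhedra over ℚ

sumℚ-mono : ∀ {k} {f g : Fin k → ℚ} → (∀ j → f j ℚ.≤ g j) → sumℚ f ℚ.≤ sumℚ g
sumℚ-mono {zero}  f≤g = ℚ.≤-refl
sumℚ-mono {suc k} f≤g = ℚ.+-mono-≤ (f≤g zero) (sumℚ-mono (f≤g ∘ suc))

sumℚ-0 : ∀ {k} (f : Fin k → ℚ) → (∀ j → f j ≡ 0ℚ) → sumℚ f ≡ 0ℚ
sumℚ-0 {zero}  f f≡0 = refl
sumℚ-0 {suc k} f f≡0 = cong₂ ℚ._+_ (f≡0 zero) (sumℚ-0 (f ∘ suc) (f≡0 ∘ suc))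

const : ∀ {n} → ℚ → Affine n
const {zero}  q = q ∷ []
const {suc n} q = 0ℚ ∷ const q

eval-const : ∀ {n} q (z : Vec ℚ n) → eval (const q) z ≡ q
eval-const q []      = refl
eval-const q (y ∷ z) = trans (cong (ℚ._+ _) (ℚ.*-zeroˡ y)) (trans (ℚ.+-identityˡ _) (eval-const q z))

coord : ∀ {n} → Fin n → Affine n
coord zero    = 1ℚ ∷ const 0ℚ
coord (suc i) = 0ℚ ∷ coord i

eval-coord : ∀ {n} i (z : Vec ℚ n) → eval (coord i) z ≡ Vec.lookup z i
eval-coord zero    (y ∷ z) = trans (cong₂ ℚ._+_ (ℚ.*-identityˡ y) (eval-const 0ℚ z)) (ℚ.+-identityʳ y)
eval-coord (suc i) (y ∷ z) = trans (cong (ℚ._+ _) (ℚ.*-zeroˡ y)) (trans (ℚ.+-identityˡ _) (eval-coord i z))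

⨁ : ∀ {k n} → (Fin k → Affine n) → Affine n
⨁ {zero}  f = const 0ℚ
⨁ {suc k} f = f zero ⊕ ⨁ (f ∘ suc)

eval-⨁ : ∀ {k n} (f : Fin k → Affine n) z → eval (⨁ f) z ≡ sumℚ (λ j → eval (f j) z)
eval-⨁ {zero}  f z = eval-const 0ℚ z
eval-⨁ {suc k} f z = trans (eval-⊕ (f zero) _ z) (cong (eval (f zero) z ℚ.+_) (eval-⨁ (f ∘ suc) z))

bit : Side → ℚ
bit inside  = 1ℚ
bit outside = 0ℚ

point : ∀ {n} → Subset n → Vec ℚ n
point = Vec.map bit

-- ∣t∣ ≤ ε, written as two inequalities that are affine in ε and t together.
Small : ℚ → ℚ → Set
Small ε t = 0ℚ ℚ.≤ ε ℚ.+ t × 0ℚ ℚ.≤ ε ℚ.- t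

rational : ∀ {n} → Vec ℚ n → Fin n → ℝ
rational x i = fromℚ (Vec.lookup x i)

eventually : ∀ {m} {Q : Fin m → ℕ → Set} → (∀ j → ∃[ N ] ∀ r → N ℕ.≤ r → Q j r) →
             ∃[ N ] ∀ r → N ℕ.≤ r → ∀ j → Q j r
eventually {zero}  h = 0 , λ _ _ ()
eventually {suc m} h =
  let N₁ , h₁ = h zero
      N₂ , h₂ = eventually (h ∘ suc)
  in N₁ ℕ.⊔ N₂ , λ r r≥ → λ
    { zero    → h₁ r (ℕ.m⊔n≤o⇒m≤o N₁ N₂ r≥)
    ; (suc j) → h₂ r (ℕ.m⊔n≤o⇒n≤o N₁ N₂ r≥) j }

-- The conditions of `conv` up to ε at the r-th terms of the Cauchy sequences. These terms are
-- rational, but change with ε.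
TruncatedHull : ∀ {k n} (w : Fin k → Fin n → ℝ) (y : Fin n → ℝ) → (Fin k → ℝ) → ℚ → ℕ → Set
TruncatedHull w y c ε r =
    (∀ j → seq 0ᴿ r ℚ.≤ seq (c j) r ℚ.+ ε)
  × ℚ.∣ seq (sumᴿ c) r ℚ.- seq 1ᴿ r ∣ ℚ.< ε
  × (∀ i → ℚ.∣ seq (y i) r ℚ.- seq (sumᴿ (λ j → c j *ᴿ w j i)) r ∣ ℚ.< ε)

conv-truncated : ∀ {k n} (w : Fin k → Fin n → ℝ) y ((c , _) : conv w y) → ∀ ε → 0ℚ ℚ.< ε →
                 ∃[ r ] TruncatedHull w y c ε r
conv-truncated w y (c , c≥0 , total≃1 , y≃) ε ε>0 = combine
  (eventually {Q = λ j r → seq 0ᴿ r ℚ.≤ seq (c j) r ℚ.+ ε} (λ j → c≥0 j ε ε>0))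
  (total≃1 ε ε>0)
  (eventually {Q = λ i r → ℚ.∣ seq (y i) r ℚ.- seq (sumᴿ (λ j → c j *ᴿ w j i)) r ∣ ℚ.< ε}
    (λ i → y≃ i ε ε>0))
  where
  combine :
    ∃[ N ] (∀ r → N ℕ.≤ r → ∀ j → seq 0ᴿ r ℚ.≤ seq (c j) r ℚ.+ ε) →
    ∃[ N ] (∀ r → N ℕ.≤ r → ℚ.∣ seq (sumᴿ c) r ℚ.- seq 1ᴿ r ∣ ℚ.< ε) →
    ∃[ N ] (∀ r → N ℕ.≤ r → ∀ i →
      ℚ.∣ seq (y i) r ℚ.- seq (sumᴿ (λ j → c j *ᴿ w j i)) r ∣ ℚ.< ε) →
    ∃[ r ] TruncatedHull w y c ε r
  combine (N₁ , h₁) (N₂ , h₂) (N₃ , h₃) =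
    r , h₁ r (ℕ.m≤m⊔n N₁ (N₂ ℕ.⊔ N₃))
      , h₂ r (ℕ.≤-trans (ℕ.m≤m⊔n N₂ N₃) (ℕ.m≤n⊔m N₁ (N₂ ℕ.⊔ N₃)))
      , h₃ r (ℕ.≤-trans (ℕ.m≤n⊔m N₂ N₃) (ℕ.m≤n⊔m N₁ (N₂ ℕ.⊔ N₃)))
    where r = N₁ ℕ.⊔ (N₂ ℕ.⊔ N₃)

module Hull {k n} (v : Fin k → Subset n) where

  vert : Fin k → Fin n → ℚ
  vert j i = bit (Vec.lookup (v j) i)

  Approximates : (Fin k → ℚ) → ℚ → Vec ℚ n → Set
  Approximates c ε x =
      (∀ j → 0ℚ ℚ.≤ c j ℚ.+ ε)
    × Small ε (sumℚ c ℚ.- 1ℚ)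
    × (∀ i → Small ε (Vec.lookup x i ℚ.- sumℚ (λ j → c j ℚ.* vert j i)))

  private
    m = k ℕ.+ suc n

    cᵃ : Fin k → Affine m
    cᵃ j = coord (j ↑ˡ suc n)

    εᵃ : Affine m
    εᵃ = coord (k ↑ʳ zero)

    xᵃ : Fin n → Affine m
    xᵃ i = coord (k ↑ʳ suc i)

    total : Affine m
    total = ⨁ cᵃ ⊕ const (ℚ.- 1ℚ)

    gap : Fin n → Affine m
    gap i = xᵃ i ⊕ (ℚ.- 1ℚ) ⊛ ⨁ (λ j → vert j i ⊛ cᵃ j)

    _⊖_ : Affine m → Affine m → Affine m
    ℓ ⊖ t = ℓ ⊕ (ℚ.- 1ℚ) ⊛ t

    eval-⊖ : ∀ ℓ t z → eval (ℓ ⊖ t) z ≡ eval ℓ z ℚ.- eval t z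
    eval-⊖ ℓ t z = eval-β-α t ℓ z

  -- The variables are c, ε, x in this order. The coefficients c come first because elimination
  -- removes leading coordinates; ε is a variable so that it survives in the eliminated
  -- inequalities.
  system : Polyhedron m
  system = List.tabulate (λ j → cᵃ j ⊕ εᵃ)
        ++ (εᵃ ⊕ total ∷ εᵃ ⊖ total ∷ [])
        ++ List.tabulate (λ i → εᵃ ⊕ gap i)
        ++ List.tabulate (λ i → εᵃ ⊖ gap i)

  module _ (c : Vec ℚ k) (ε : ℚ) (x : Vec ℚ n) where

    private
      z = c Vec.++ (ε ∷ x)

      eval-c : ∀ j → eval (cᵃ j) z ≡ Vec.lookup c j
      eval-c j = trans (eval-coord (j ↑ˡ suc n) z) (Vec.lookup-++ˡ c (ε ∷ x) j)

      eval-ε : eval εᵃ z ≡ ε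
      eval-ε = trans (eval-coord (k ↑ʳ zero) z) (Vec.lookup-++ʳ c (ε ∷ x) zero)

      eval-x : ∀ i → eval (xᵃ i) z ≡ Vec.lookup x i
      eval-x i = trans (eval-coord (k ↑ʳ suc i) z) (Vec.lookup-++ʳ c (ε ∷ x) (suc i))

      eval-total : eval total z ≡ sumℚ (Vec.lookup c) ℚ.- 1ℚ
      eval-total = trans (eval-⊕ (⨁ cᵃ) (const (ℚ.- 1ℚ)) z)
        (cong₂ ℚ._+_ (trans (eval-⨁ cᵃ z) (sumℚ-cong eval-c)) (eval-const (ℚ.- 1ℚ) z))

      eval-gap : ∀ i → eval (gap i) z ≡ Vec.lookup x i ℚ.- sumℚ (λ j → Vec.lookup c j ℚ.* vert j i)
      eval-gap i = trans (eval-⊖ (xᵃ i) (⨁ (λ j → vert j i ⊛ cᵃ j)) z)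
        (cong₂ ℚ._-_ (eval-x i) (trans (eval-⨁ (λ j → vert j i ⊛ cᵃ j) z)
          (sumℚ-cong (λ j → trans (eval-⊛ (vert j i) (cᵃ j) z)
            (trans (cong (vert j i ℚ.*_) (eval-c j)) (ℚ.*-comm (vert j i) (Vec.lookup c j)))))))

      eval-c+ε : ∀ j → eval (cᵃ j ⊕ εᵃ) z ≡ Vec.lookup c j ℚ.+ ε
      eval-c+ε j = trans (eval-⊕ (cᵃ j) εᵃ z) (cong₂ ℚ._+_ (eval-c j) eval-ε)

      eval-ε+ : ∀ t {q} → eval t z ≡ q → eval (εᵃ ⊕ t) z ≡ ε ℚ.+ q
      eval-ε+ t eq = trans (eval-⊕ εᵃ t z) (cong₂ ℚ._+_ eval-ε eq)

      eval-ε- : ∀ t {q} → eval t z ≡ q → eval (εᵃ ⊖ t) z ≡ ε ℚ.- q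
      eval-ε- t eq = trans (eval-⊖ εᵃ t z) (cong₂ ℚ._-_ eval-ε eq)

      to : ∀ {p q} → p ≡ q → 0ℚ ℚ.≤ p → 0ℚ ℚ.≤ q
      to = subst (0ℚ ℚ.≤_)

    system⁺ : Approximates (Vec.lookup c) ε x → system ∋ z
    system⁺ (c≥0 , (t₁ , t₂) , gaps) =
      All.++⁺ (All.tabulate⁺ (λ j → to (sym (eval-c+ε j)) (c≥0 j)))
     (All.++⁺ (to (sym (eval-ε+ total eval-total)) t₁ ∷ to (sym (eval-ε- total eval-total)) t₂ ∷ [])
     (All.++⁺ (All.tabulate⁺ (λ i → to (sym (eval-ε+ (gap i) (eval-gap i))) (proj₁ (gaps i))))
              (All.tabulate⁺ (λ i → to (sym (eval-ε- (gap i) (eval-gap i))) (proj₂ (gaps i))))))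

    system⁻ : system ∋ z → Approximates (Vec.lookup c) ε x
    system⁻ h with All.++⁻ (List.tabulate (λ j → cᵃ j ⊕ εᵃ)) h
    ... | c≥0 , t₁ ∷ t₂ ∷ h′ with All.++⁻ (List.tabulate (λ i → εᵃ ⊕ gap i)) h′
    ... | g₁ , g₂ =
      (λ j → to (eval-c+ε j) (All.tabulate⁻ c≥0 j)) ,
      (to (eval-ε+ total eval-total) t₁ , to (eval-ε- total eval-total) t₂) ,
      (λ i → to (eval-ε+ (gap i) (eval-gap i)) (All.tabulate⁻ g₁ i)
           , to (eval-ε- (gap i) (eval-gap i)) (All.tabulate⁻ g₂ i))

  -- Dropping the leading coefficient, that of ε, sets ε = 0.
  hull : Polyhedron n
  hull = map Vec.tail (eliminateAll k system)

  private
    tail-0 : ∀ (ℓ : Affine (suc n)) x → eval ℓ (0ℚ ∷ x) ≡ eval (Vec.tail ℓ) x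
    tail-0 (a ∷ ℓ) x = trans (cong (ℚ._+ eval ℓ x) (ℚ.*-zeroʳ a)) (ℚ.+-identityˡ _)

    -- Otherwise a ε + l < 0 for ε = 1 or ε = -l / 2a.
    limit : ∀ a l → (∀ ε → 0ℚ ℚ.< ε → 0ℚ ℚ.≤ a ℚ.* ε ℚ.+ l) → 0ℚ ℚ.≤ l
    limit a l h with 0ℚ ℚ.≤? l
    ... | yes l≥0 = l≥0
    ... | no  l≱0 with 0ℚ ℚ.<? a
    ...   | no a≯0 = contradiction
      (ℚ.≤-trans (h 1ℚ (ℚ.positive⁻¹ 1ℚ))
        (ℚ.≤-trans (ℚ.+-monoˡ-≤ l (ℚ.≤-trans (ℚ.≤-reflexive (ℚ.*-identityʳ a)) (ℚ.≮⇒≥ a≯0)))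
                   (ℚ.≤-reflexive (ℚ.+-identityˡ l))))
      l≱0
    ...   | yes a>0 = contradiction (0≤*⁻ {½} (ℚ.positive⁻¹ ½) (subst (0ℚ ℚ.≤_) value (h ε ε>0))) l≱0
      where
      instance
        a-pos : ℚ.Positive a
        a-pos = ℚ.positive a>0
        a-nonZero : ℚ.NonZero a
        a-nonZero = ℚ.pos⇒nonZero a
        -l-pos : ℚ.Positive (ℚ.- l)
        -l-pos = ℚ.positive (ℚ.neg-antimono-< (ℚ.≰⇒> l≱0))
      ε = (½ ℚ.* ℚ.- l) ℚ.* ℚ.1/ a
      ε>0 : 0ℚ ℚ.< ε
      ε>0 = ℚ.positive⁻¹ ε {{ℚ.pos*pos⇒pos (½ ℚ.* ℚ.- l) {{ℚ.pos*pos⇒pos ½ (ℚ.- l)}} (ℚ.1/ a) {{ℚ.1/pos⇒pos a}}}}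
      value : a ℚ.* ε ℚ.+ l ≡ ½ ℚ.* l
      value = trans
        (solve 3 (λ a l i → a :* ((con ½ :* (:- l)) :* i) :+ l := (con ½ :* (:- l)) :* (i :* a) :+ l) refl a l (ℚ.1/ a))
        (trans (cong (λ u → (½ ℚ.* ℚ.- l) ℚ.* u ℚ.+ l) (ℚ.*-inverseˡ a))
          (solve 1 (λ l → (con ½ :* (:- l)) :* con 1ℚ :+ l := con ½ :* l) refl l))
        where open ℚ-Solver.+-*-Solver

  exact⇒hull : ∀ c x → Approximates (Vec.lookup c) 0ℚ x → hull ∋ x
  exact⇒hull c x h = All.map⁺ (All.map (λ {ℓ} → subst (0ℚ ℚ.≤_) (tail-0 ℓ x))
    (eliminateAll⁺ k system c (0ℚ ∷ x) (system⁺ c 0ℚ x h)))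

  hull⇒exact : ∀ x → hull ∋ x → ∃[ c ] Approximates (Vec.lookup c) 0ℚ x
  hull⇒exact x h =
    let c , h′ = eliminateAll⁻ k system (0ℚ ∷ x)
                   (All.map (λ {ℓ} → subst (0ℚ ℚ.≤_) (sym (tail-0 ℓ x))) (All.map⁻ h))
    in c , system⁻ c 0ℚ x h′

  -- Finitely many inequalities 0 ≤ a ε + ℓ(x) remain after c is eliminated. Each holds for all ε >
  -- 0 and hence at ε = 0. This takes the place of a compactness argument for the coefficients.
  approximate⇒hull : ∀ x → (∀ ε → 0ℚ ℚ.< ε → ∃[ c ] Approximates (Vec.lookup c) ε x) → hull ∋ x
  approximate⇒hull x h = All.map⁺ (All.tabulate row)
    where
    row : ∀ {ℓ} → ℓ ∈ₗ eliminateAll k system → 0ℚ ℚ.≤ eval (Vec.tail ℓ) x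
    row {a ∷ ℓ} ℓ∈ = limit a (eval ℓ x) λ ε ε>0 →
      let c , h′ = h ε ε>0
      in All.lookup (eliminateAll⁺ k system c (ε ∷ x) (system⁺ c ε x h′)) ℓ∈

  private
    seq-sum : ∀ {m} (c : Fin m → ℝ) r → seq (sumᴿ c) r ≡ sumℚ (λ j → seq (c j) r)
    seq-sum {zero}  c r = refl
    seq-sum {suc m} c r = cong (seq (c zero) r ℚ.+_) (seq-sum (c ∘ suc) r)

    seq-vertex : ∀ j i r → seq (vertex (v j) i) r ≡ vert j i
    seq-vertex j i r with Vec.lookup (v j) i
    ... | inside  = refl
    ... | outside = refl

    p≤∣p∣ : ∀ p → p ℚ.≤ ℚ.∣ p ∣
    p≤∣p∣ p with ℚ.≤-total 0ℚ p
    ... | inj₁ 0≤p = ℚ.≤-reflexive (sym (ℚ.0≤p⇒∣p∣≡p 0≤p))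
    ... | inj₂ p≤0 = ℚ.≤-trans p≤0 (ℚ.0≤∣p∣ p)

    abs<⇒small : ∀ ε t → ℚ.∣ t ∣ ℚ.< ε → Small ε t
    abs<⇒small ε t lt =
      subst (0ℚ ℚ.≤_) (cong (ε ℚ.+_) (neg-involutive t))
        (p≤q⇒0≤q-p (ℚ.≤-trans (p≤∣p∣ (ℚ.- t)) (ℚ.≤-trans (ℚ.≤-reflexive (ℚ.∣-p∣≡∣p∣ t)) (ℚ.<⇒≤ lt)))) ,
      p≤q⇒0≤q-p (ℚ.≤-trans (p≤∣p∣ t) (ℚ.<⇒≤ lt))
      where
      neg-involutive : ∀ t → ℚ.- (ℚ.- t) ≡ t
      neg-involutive = solve 1 (λ t → :- (:- t) := t) refl
        where open ℚ-Solver.+-*-Solver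

    small-0⇒≡ : ∀ {p q} → Small 0ℚ (p ℚ.- q) → p ≡ q
    small-0⇒≡ {p} {q} (h₁ , h₂) = ℚ.≤-antisym
      (0≤q-p⇒p≤q (subst (0ℚ ℚ.≤_) (solve 2 (λ p q → con 0ℚ :- (p :- q) := q :- p) refl p q) h₂))
      (0≤q-p⇒p≤q (subst (0ℚ ℚ.≤_) (ℚ.+-identityˡ _) h₁))
      where open ℚ-Solver.+-*-Solver

    ≡⇒≃ᴿ : ∀ {x y} → (∀ r → seq x r ≡ seq y r) → x ≃ᴿ y
    ≡⇒≃ᴿ {x} {y} eq ε ε>0 = 0 , λ r _ → subst (ℚ._< ε)
      (sym (cong ℚ.∣_∣ (trans (cong (ℚ._- seq y r) (eq r)) (ℚ.+-inverseʳ (seq y r))))) ε>0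

    seq-dot : ∀ {m} (c w : Fin m → ℝ) r →
      seq (sumᴿ (λ j → c j *ᴿ w j)) r ≡ sumℚ (λ j → seq (c j) r ℚ.* seq (w j) r)
    seq-dot {zero}  c w r = refl
    seq-dot {suc m} c w r =
      cong (seq (c zero) r ℚ.* seq (w zero) r ℚ.+_) (seq-dot (c ∘ suc) (w ∘ suc) r)

    *-cong-right : ∀ {m} (c d e : Fin m → ℚ) → (∀ j → d j ≡ e j) →
                   sumℚ (λ j → c j ℚ.* d j) ≡ sumℚ (λ j → c j ℚ.* e j)
    *-cong-right c d e d≡e = sumℚ-cong (λ j → cong (c j ℚ.*_) (d≡e j))

  exact : ∀ {c : Fin k → ℚ} {x} → Approximates c 0ℚ x →
    (∀ j → 0ℚ ℚ.≤ c j) × sumℚ c ≡ 1ℚ × (∀ i → Vec.lookup x i ≡ sumℚ (λ j → c j ℚ.* vert j i))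
  exact {c} (c≥0 , t , g) =
    (λ j → subst (0ℚ ℚ.≤_) (ℚ.+-identityʳ (c j)) (c≥0 j)) , small-0⇒≡ t , (λ i → small-0⇒≡ (g i))

  -- w stands for the vertices; at their definition, comparing products would unfold
  -- the moduli of _*ᴿ_.
  module _ (w : Fin k → Fin n → ℝ) (seq-w : ∀ j i r → seq (w j i) r ≡ vert j i) where

    seq-combination : ∀ (c : Fin k → ℝ) r i →
      seq (sumᴿ (λ j → c j *ᴿ w j i)) r ≡ sumℚ (λ j → seq (c j) r ℚ.* vert j i)
    seq-combination c r i = trans
      (seq-dot c (λ j → w j i) r)
      (*-cong-right (λ j → seq (c j) r) (λ j → seq (w j i) r) (λ j → vert j i) (λ j → seq-w j i r))

    truncate : ∀ x (c : Fin k → ℝ) r ε → TruncatedHull w (rational x) c ε r →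
               Approximates (λ j → seq (c j) r) ε x
    truncate x c r ε (c≥0 , total≃1 , x≃) =
      c≥0 ,
      abs<⇒small ε (sumℚ (λ j → seq (c j) r) ℚ.- 1ℚ)
        (subst₂ (λ u w → ℚ.∣ u ℚ.- w ∣ ℚ.< ε) (seq-sum c r) (seq-fromℚ 1ℚ r) total≃1) ,
      (λ i → abs<⇒small ε (Vec.lookup x i ℚ.- sumℚ (λ j → seq (c j) r ℚ.* vert j i))
        (subst₂ (λ u w → ℚ.∣ u ℚ.- w ∣ ℚ.< ε)
          (seq-fromℚ (Vec.lookup x i) r) (seq-combination c r i) (x≃ i)))
      where
      seq-fromℚ : ∀ q r → seq (fromℚ q) r ≡ q
      seq-fromℚ q r = refl

    exact⇒conv : ∀ x c → Approximates (Vec.lookup c) 0ℚ x → conv w (rational x)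
    exact⇒conv x c approx = c′ ,
       (λ j ε ε>0 → 0 , λ _ _ → ℚ.≤-trans (c≥0 j) (ℚ.≤-trans (ℚ.≤-reflexive (sym (ℚ.+-identityʳ _)))
         (ℚ.+-monoʳ-≤ (Vec.lookup c j) (ℚ.<⇒≤ ε>0)))) ,
       ≡⇒≃ᴿ {sumᴿ c′} {1ᴿ} (λ r → trans (seq-sum c′ r) total≡1) ,
       (λ i → ≡⇒≃ᴿ {rational x i} {sumᴿ (λ j → c′ j *ᴿ w j i)}
         (λ r → trans (x≡ i) (sym (seq-combination c′ r i))))
      where
      c≥0 = proj₁ (exact {Vec.lookup c} {x} approx)
      total≡1 = proj₁ (proj₂ (exact {Vec.lookup c} {x} approx))
      x≡ = proj₂ (proj₂ (exact {Vec.lookup c} {x} approx))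
      c′ : Fin k → ℝ
      c′ j = fromℚ (Vec.lookup c j)

  approximates-cong : ∀ {c d ε x} → (∀ j → c j ≡ d j) → Approximates c ε x → Approximates d ε x
  approximates-cong {c} {d} {ε} {x} c≡d (c≥0 , t , g) =
    (λ j → subst (λ u → 0ℚ ℚ.≤ u ℚ.+ ε) (c≡d j) (c≥0 j)) ,
    subst (λ u → Small ε (u ℚ.- 1ℚ)) (sumℚ-cong c≡d) t ,
    (λ i → subst (λ u → Small ε (Vec.lookup x i ℚ.- u))
      (sumℚ-cong (λ j → cong (ℚ._* vert j i) (c≡d j))) (g i))

  conv⇒hull : ∀ x → conv (λ j → vertex (v j)) (rational x) → hull ∋ x
  conv⇒hull x h = approximate⇒hull x approximation
    where
    approximation : ∀ ε → 0ℚ ℚ.< ε → ∃[ c ] Approximates (Vec.lookup c) ε x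
    approximation ε ε>0 =
      Vec.tabulate c , approximates-cong {c} {Vec.lookup (Vec.tabulate c)} {ε} {x}
        (λ j → sym (Vec.lookup∘tabulate c j))
        (truncate (λ j → vertex (v j)) seq-vertex x (proj₁ h) r ε (proj₂ truncated))
      where
      truncated : ∃[ r ] TruncatedHull (λ j → vertex (v j)) (rational x) (proj₁ h) ε r
      truncated = conv-truncated (λ j → vertex (v j)) (rational x) h ε ε>0
      r = proj₁ truncated
      c : Fin k → ℚ
      c j = seq (proj₁ h j) r

  hull⇒conv : ∀ x → hull ∋ x → conv (λ j → vertex (v j)) (rational x)
  hull⇒conv x h = let c , approx = hull⇒exact x h in exact⇒conv (λ j → vertex (v j)) seq-vertex x c approx

  vertex∈hull : ∀ j → hull ∋ point (v j)
  vertex∈hull j = exact⇒hull (Vec.tabulate (δ j)) (point (v j))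
    ( (λ l → subst (0ℚ ℚ.≤_) (sym (trans (ℚ.+-identityʳ _) (look l))) (δ≥0 j l))
    , small-refl (trans (sumℚ-cong (λ l → trans (look l) (sym (ℚ.*-identityʳ (δ j l))))) (sum-δ j (λ _ → 1ℚ)))
    , (λ i → small-refl (trans (Vec.lookup-map i bit (v j)) (sym
        (trans (sumℚ-cong (λ l → cong (ℚ._* vert l i) (look l))) (sum-δ j (λ l → vert l i)))))))
    where
    δ : ∀ {m} → Fin m → Fin m → ℚ
    δ zero    zero    = 1ℚ
    δ zero    (suc l) = 0ℚ
    δ (suc j) zero    = 0ℚ
    δ (suc j) (suc l) = δ j l

    look : ∀ l → Vec.lookup (Vec.tabulate (δ j)) l ≡ δ j l
    look = Vec.lookup∘tabulate (δ j)

    δ≥0 : ∀ {m} (j l : Fin m) → 0ℚ ℚ.≤ δ j l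
    δ≥0 zero    zero    = ℚ.nonNegative⁻¹ 1ℚ
    δ≥0 zero    (suc l) = ℚ.≤-refl
    δ≥0 (suc j) zero    = ℚ.≤-refl
    δ≥0 (suc j) (suc l) = δ≥0 j l

    sum-δ : ∀ {m} (j : Fin m) (f : Fin m → ℚ) → sumℚ (λ l → δ j l ℚ.* f l) ≡ f j
    sum-δ zero    f = trans (cong₂ ℚ._+_ (ℚ.*-identityˡ (f zero))
                        (sumℚ-0 (λ l → 0ℚ ℚ.* f (suc l)) (λ l → ℚ.*-zeroˡ (f (suc l))))) (ℚ.+-identityʳ _)
    sum-δ (suc j) f = trans (cong₂ ℚ._+_ (ℚ.*-zeroˡ (f zero)) (sum-δ j (f ∘ suc))) (ℚ.+-identityˡ _)

    small-refl : ∀ {p q} → p ≡ q → Small 0ℚ (p ℚ.- q)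
    small-refl {p} refl = subst (λ u → Small 0ℚ u) (sym (ℚ.+-inverseʳ p)) (ℚ.≤-refl , ℚ.≤-refl)

-- Maximal weights of bases

eval-∷ : ∀ {n} a (ℓ : Affine n) z → eval (a ∷ ℓ) z ≡ a ℚ.* Vec.head z ℚ.+ eval ℓ (Vec.tail z)
eval-∷ a ℓ (y ∷ z) = refl

eval-combination : ∀ {n k} (ℓ : Affine n) (c : Fin k → ℚ) (x : Vec ℚ n) (p : Fin k → Vec ℚ n) →
  sumℚ c ≡ 1ℚ → (∀ i → Vec.lookup x i ≡ sumℚ (λ j → c j ℚ.* Vec.lookup (p j) i)) →
  eval ℓ x ≡ sumℚ (λ j → c j ℚ.* eval ℓ (p j))
eval-combination (a ∷ []) c [] p total x≡ = sym (trans
  (sumℚ-cong (λ j → cong (c j ℚ.*_) (constant (p j))))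
  (trans (sym (*-distribʳ-sumℚ a c)) (trans (cong (ℚ._* a) total) (ℚ.*-identityˡ a))))
  where
  constant : ∀ z → eval (a ∷ []) z ≡ a
  constant [] = refl
eval-combination {suc n} (a ∷ ℓ) c (y ∷ x) p total x≡ = sym (begin
  sumℚ (λ j → c j ℚ.* eval (a ∷ ℓ) (p j))
    ≡⟨ sumℚ-cong term ⟩
  sumℚ (λ j → a ℚ.* (c j ℚ.* Vec.head (p j)) ℚ.+ c j ℚ.* eval ℓ (Vec.tail (p j)))
    ≡⟨ sumℚ-distrib-+ (λ j → a ℚ.* (c j ℚ.* Vec.head (p j))) (λ j → c j ℚ.* eval ℓ (Vec.tail (p j))) ⟩
  sumℚ (λ j → a ℚ.* (c j ℚ.* Vec.head (p j))) ℚ.+ sumℚ (λ j → c j ℚ.* eval ℓ (Vec.tail (p j)))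
    ≡⟨ cong₂ ℚ._+_ heads (sym (eval-combination ℓ c x (Vec.tail ∘ p) total tails)) ⟩
  a ℚ.* y ℚ.+ eval ℓ x ∎)
  where
  open ≡-Reasoning
  lookup-zero : ∀ (z : Vec ℚ (suc n)) → Vec.lookup z zero ≡ Vec.head z
  lookup-zero (_ ∷ _) = refl
  lookup-suc : ∀ (z : Vec ℚ (suc n)) i → Vec.lookup z (suc i) ≡ Vec.lookup (Vec.tail z) i
  lookup-suc (_ ∷ _) i = refl
  heads : sumℚ (λ j → a ℚ.* (c j ℚ.* Vec.head (p j))) ≡ a ℚ.* y
  heads = trans (sym (*-distribˡ-sumℚ a (λ j → c j ℚ.* Vec.head (p j))))
    (cong (a ℚ.*_) (sym (trans (x≡ zero) (sumℚ-cong (λ j → cong (c j ℚ.*_) (lookup-zero (p j)))))))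
  tails : ∀ i → Vec.lookup x i ≡ sumℚ (λ j → c j ℚ.* Vec.lookup (Vec.tail (p j)) i)
  tails i = trans (x≡ (suc i)) (sumℚ-cong (λ j → cong (c j ℚ.*_) (lookup-suc (p j) i)))
  term : ∀ j → c j ℚ.* eval (a ∷ ℓ) (p j) ≡
               a ℚ.* (c j ℚ.* Vec.head (p j)) ℚ.+ c j ℚ.* eval ℓ (Vec.tail (p j))
  term j = trans (cong (c j ℚ.*_) (eval-∷ a ℓ (p j)))
    (solve 4 (λ c a h e → c :* (a :* h :+ e) := a :* (c :* h) :+ c :* e) refl
      (c j) a (Vec.head (p j)) (eval ℓ (Vec.tail (p j))))
    where open ℚ-Solver.+-*-Solver

ι : ℕ → ℚ
ι zero    = 0ℚ
ι (suc m) = 1ℚ ℚ.+ ι m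

ι-+ : ∀ m n → ι (m ℕ.+ n) ≡ ι m ℚ.+ ι n
ι-+ zero    n = sym (ℚ.+-identityˡ (ι n))
ι-+ (suc m) n = trans (cong (1ℚ ℚ.+_) (ι-+ m n)) (sym (ℚ.+-assoc 1ℚ (ι m) (ι n)))

ι-mono : ∀ {m n} → m ℕ.≤ n → ι m ℚ.≤ ι n
ι-mono {n = zero}  ℕ.z≤n = ℚ.≤-refl
ι-mono {n = suc n} ℕ.z≤n = ℚ.+-mono-≤ (ℚ.nonNegative⁻¹ 1ℚ) (ι-mono {n = n} ℕ.z≤n)
ι-mono (ℕ.s≤s m≤n) = ℚ.+-monoʳ-≤ 1ℚ (ι-mono m≤n)

weight : ∀ {n} → Vec ℕ n → Subset n → ℕ
weight []       []            = 0
weight (w ∷ ws) (inside  ∷ B) = w ℕ.+ weight ws B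
weight (w ∷ ws) (outside ∷ B) = weight ws B

-- x ↦ w · x - b
excess : ∀ {n} → Vec ℕ n → ℕ → Affine n
excess []       b = ℚ.- ι b ∷ []
excess (w ∷ ws) b = ι w ∷ excess ws b

excess-point : ∀ {n} (w : Vec ℕ n) b B → eval (excess w b) (point B) ≡ ι (weight w B) ℚ.- ι b
excess-point []       b []            = sym (ℚ.+-identityˡ (ℚ.- ι b))
excess-point (w ∷ ws) b (inside  ∷ B) = trans
  (cong₂ ℚ._+_ (ℚ.*-identityʳ (ι w)) (excess-point ws b B))
  (trans (sym (ℚ.+-assoc (ι w) _ _)) (cong (ℚ._- ι b) (sym (ι-+ w (weight ws B)))))
excess-point (w ∷ ws) b (outside ∷ B) = trans
  (cong₂ ℚ._+_ (ℚ.*-zeroʳ (ι w)) (excess-point ws b B)) (ℚ.+-identityˡ _)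

module _ {k n} (v : Fin k → Subset n) (w : Vec ℕ n) (b : ℕ) where
  open Hull v

  heavyPart : Polyhedron n
  heavyPart = excess w b ∷ hull

  heavy-vertex⇒nonempty : ∀ j → b ℕ.≤ weight w (v j) → ∃[ x ] heavyPart ∋ x
  heavy-vertex⇒nonempty j b≤w = point (v j) ,
    subst (0ℚ ℚ.≤_) (sym (excess-point w b (v j))) (p≤q⇒0≤q-p (ι-mono b≤w)) ∷ vertex∈hull j

  -- Weights are integers: if every vertex weighed less than b, the excess would be at most -1 at
  -- each vertex, hence at every convex combination.
  nonempty⇒heavy-vertex : ∃[ x ] heavyPart ∋ x → ∃[ j ] b ℕ.≤ weight w (v j)
  nonempty⇒heavy-vertex (x , e≥0 ∷ x∈hull) with Fin.any? (λ j → b ℕ.≤? weight w (v j))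
  ... | yes found = found
  ... | no  light = contradiction (ℚ.≤-trans e≥0 (ℚ.≤-trans (ℚ.≤-reflexive combination) (ℚ.≤-trans
          (sumℚ-mono bound) (ℚ.≤-reflexive total)))) (λ 0≤-1 → ℚ.<-irrefl refl (ℚ.<-≤-trans (ℚ.negative⁻¹ (ℚ.- 1ℚ)) 0≤-1))
    where
    c : Fin k → ℚ
    c = Vec.lookup (proj₁ (hull⇒exact x x∈hull))
    facts = exact {c} {x} (proj₂ (hull⇒exact x x∈hull))
    combination : eval (excess w b) x ≡ sumℚ (λ j → c j ℚ.* eval (excess w b) (point (v j)))
    combination = eval-combination (excess w b) c x (point ∘ v) (proj₁ (proj₂ facts))
      (λ i → trans (proj₂ (proj₂ facts) i)
        (sumℚ-cong (λ j → cong (c j ℚ.*_) (sym (Vec.lookup-map i bit (v j))))))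
    deficit : ∀ j → eval (excess w b) (point (v j)) ℚ.≤ ℚ.- 1ℚ
    deficit j = ℚ.≤-trans (ℚ.≤-reflexive (excess-point w b (v j)))
      (0≤q-p⇒p≤q (subst (0ℚ ℚ.≤_)
        (solve 2 (λ b u → b :- (con 1ℚ :+ u) := (:- con 1ℚ) :- (u :- b)) refl (ι b) (ι (weight w (v j))))
        (p≤q⇒0≤q-p (ι-mono (ℕ.≰⇒> (λ b≤w → light (j , b≤w)))))))
      where open ℚ-Solver.+-*-Solver
    bound : ∀ j → c j ℚ.* eval (excess w b) (point (v j)) ℚ.≤ c j ℚ.* ℚ.- 1ℚ
    bound j = ℚ.*-monoˡ-≤-nonNeg (c j) {{ℚ.nonNegative (proj₁ facts j)}} (deficit j)
    total : sumℚ (λ j → c j ℚ.* ℚ.- 1ℚ) ≡ ℚ.- 1ℚ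
    total = trans (sym (*-distribʳ-sumℚ (ℚ.- 1ℚ) c))
      (trans (cong (ℚ._* ℚ.- 1ℚ) (proj₁ (proj₂ facts))) (ℚ.*-identityˡ (ℚ.- 1ℚ)))

∈-subsets : ∀ {n} (A : Subset n) → A ∈ₗ subsets n
∈-subsets []                  = here refl
∈-subsets (outside ∷ A)       = ∈-++⁺ˡ (∈-map⁺ (outside ∷_) (∈-subsets A))
∈-subsets {suc n} (inside ∷ A) = ∈-++⁺ʳ (map (outside ∷_) (subsets n)) (∈-map⁺ (inside ∷_) (∈-subsets A))

module _ {E} (M : Matroid E) where

  ∈-bases⁺ : ∀ {B} → IsBasis M B → B ∈ₗ bases M
  ∈-bases⁺ {B} = ∈-filter⁺ (isBasis? M) (∈-subsets B)

  ∈-bases⁻ : ∀ {B} → B ∈ₗ bases M → IsBasis M B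
  ∈-bases⁻ B∈ = proj₂ (∈-filter⁻ (isBasis? M) {xs = subsets (size E)} B∈)

  HasBasisOfWeight≥ : Vec ℕ (size E) → ℕ → Set
  HasBasisOfWeight≥ w b = ∃[ B ] IsBasis M B × b ℕ.≤ weight w B

  hasBasisOfWeight≥? : ∀ w b → Dec (HasBasisOfWeight≥ w b)
  hasBasisOfWeight≥? w b = anySubset? (λ B → isBasis? M B ×-dec b ℕ.≤? weight w B)

  -- These are the decisions fed to the hypothesis on indicator functions, which is invoked at
  -- rational points only.
  inPolytope? : ∀ x → Dec (basePolytope M (rational x))
  inPolytope? x = map′ (Hull.hull⇒conv (List.lookup (bases M)) x)
                       (Hull.conv⇒hull (List.lookup (bases M)) x)
                       (Hull.hull (List.lookup (bases M)) ∋? x)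

  nonempty-heavyPart : ∀ w b → indicator (feasible? (heavyPart (List.lookup (bases M)) w b)) ≡
                               indicator (hasBasisOfWeight≥? w b)
  nonempty-heavyPart w b = indicator-cong (feasible? (heavyPart v w b)) (hasBasisOfWeight≥? w b)
    (λ ne → let j , b≤w = nonempty⇒heavy-vertex v w b ne
            in v j , ∈-bases⁻ (∈-lookup j) , b≤w)
    (λ (B , isB , b≤w) → heavy-vertex⇒nonempty v w b (Any.index (∈-bases⁺ isB))
      (subst (λ C → b ℕ.≤ weight w C) (Any.lookup-index (∈-bases⁺ isB)) b≤w))
    where v = List.lookup (bases M)

module _ {E s} (M : Fin s → Matroid E) (a : Fin s → ℤ)
  (relation : ∀ x (x∈P? : ∀ i → Dec (basePolytope (M i) x)) →
              Cancels a (λ i → indicator (x∈P? i))) where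

  -- The half-space w · x ≥ b is the same for all i, so multiplying the relation by its indicator
  -- gives the relation for the sliced polytopes, and then for their nonemptiness.
  cancels-maxWeight : ∀ w b → Cancels a (λ i → indicator (hasBasisOfWeight≥? (M i) w b))
  cancels-maxWeight w b = cancels-cong a (λ i → nonempty-heavyPart (M i) w b)
    (cancels-nonempty a (λ i → heavyPart (List.lookup (bases (M i))) w b) λ x → cancels-cong a
      (λ i → sym (indicator-heavyPart i x))
      (cancels-* a (indicator (0ℚ ℚ.≤? eval (excess w b) x))
        (relation (rational x) (λ i → inPolytope? (M i) x))))
    where
    indicator-heavyPart : ∀ i x → indicator (heavyPart (List.lookup (bases (M i))) w b ∋? x) ≡
      indicator (0ℚ ℚ.≤? eval (excess w b) x) ℤ.* indicator (inPolytope? (M i) x)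
    indicator-heavyPart i x = trans
      (indicator-cong (heavyPart v w b ∋? x) (e≥0? ×-dec inPolytope? (M i) x)
        (λ { (e≥0 ∷ x∈hull) → e≥0 , Hull.hull⇒conv (List.lookup (bases (M i))) x x∈hull })
        (λ (e≥0 , x∈P) → e≥0 ∷ Hull.conv⇒hull (List.lookup (bases (M i))) x x∈P))
      (indicator-× e≥0? (inPolytope? (M i) x))
      where
      v = List.lookup (bases (M i))
      e≥0? = 0ℚ ℚ.≤? eval (excess w b) x

-- Cardinalities of subsets

⊆-or-∉ : ∀ {n} (A B : Subset n) → A ⊆ B ⊎ ∃[ x ] x ∈ A × x ∉ B
⊆-or-∉ []      []      = inj₁ id
⊆-or-∉ (a ∷ A) (b ∷ B) with ⊆-or-∉ A B
... | inj₂ (x , x∈A , x∉B) = inj₂ (suc x , there x∈A , x∉B ∘ drop-there)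
⊆-or-∉ (outside ∷ A) (b ∷ B)       | inj₁ A⊆B = inj₁ (out⊆ A⊆B)
⊆-or-∉ (inside ∷ A)  (inside ∷ B)  | inj₁ A⊆B = inj₁ (in⊆in A⊆B)
⊆-or-∉ (inside ∷ A)  (outside ∷ B) | inj₁ A⊆B = inj₂ (zero , here , λ ())

mem : ∀ {n} → Fin n → Subset n → ℕ
mem x C = if lookup C x then 1 else 0

mem-∈ : ∀ {n} {x : Fin n} {C} → x ∈ C → mem x C ≡ 1
mem-∈ {x = x} {C} x∈C = cong (if_then 1 else 0) (Vec.[]=⇒lookup x∈C)

mem-∉ : ∀ {n} {x : Fin n} {C} → x ∉ C → mem x C ≡ 0
mem-∉ {x = x} {C} x∉C with lookup C x in eq
... | inside  = contradiction (Vec.lookup⇒[]= x C eq) x∉C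
... | outside = refl

∣∷∣ : ∀ {n} s (A : Subset n) → ∣ s ∷ A ∣ ≡ (if s then 1 else 0) + ∣ A ∣
∣∷∣ inside  A = refl
∣∷∣ outside A = refl

∣A∪⁅y⁆∩C∣ : ∀ {n} (A C : Subset n) {y} → y ∉ A → ∣ (A ∪ ⁅ y ⁆) ∩ C ∣ ≡ mem y C + ∣ A ∩ C ∣
∣A∪⁅y⁆∩C∣ (inside ∷ A)  (c ∷ C) {zero}  y∉A = contradiction here y∉A
∣A∪⁅y⁆∩C∣ (outside ∷ A) (c ∷ C) {zero}  y∉A =
  trans (cong (λ D → ∣ c ∷ (D ∩ C) ∣) (∪-identityʳ A)) (∣∷∣ c (A ∩ C))
∣A∪⁅y⁆∩C∣ (outside ∷ A) (c ∷ C)       {suc y} y∉A = ∣A∪⁅y⁆∩C∣ A C (y∉A ∘ there)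
∣A∪⁅y⁆∩C∣ (inside ∷ A)  (outside ∷ C) {suc y} y∉A = ∣A∪⁅y⁆∩C∣ A C (y∉A ∘ there)
∣A∪⁅y⁆∩C∣ (inside ∷ A)  (inside ∷ C)  {suc y} y∉A =
  trans (cong suc (∣A∪⁅y⁆∩C∣ A C (y∉A ∘ there))) (sym (ℕ.+-suc (mem y C) ∣ A ∩ C ∣))

∣A-x∩C∣ : ∀ {n} (A C : Subset n) {x} → x ∈ A → mem x C + ∣ (A - x) ∩ C ∣ ≡ ∣ A ∩ C ∣
∣A-x∩C∣ (inside ∷ A) (c ∷ C) {zero} here =
  trans (cong (λ D → (if c then 1 else 0) + ∣ D ∩ C ∣) (p─⊥≡p A)) (sym (∣∷∣ c (A ∩ C)))
∣A-x∩C∣ (outside ∷ A) (c ∷ C)       {suc x} (there x∈A) = ∣A-x∩C∣ A C x∈A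
∣A-x∩C∣ (inside ∷ A)  (outside ∷ C) {suc x} (there x∈A) = ∣A-x∩C∣ A C x∈A
∣A-x∩C∣ (inside ∷ A)  (inside ∷ C)  {suc x} (there x∈A) =
  trans (ℕ.+-suc (mem x C) _) (cong suc (∣A-x∩C∣ A C x∈A))

-- Different choices of C measure different effects of an exchange: C = ⊤ the size, C = ∁ B the
-- distance to a basis B, any other C the overlap with it. Both sides are additive to avoid
-- truncated subtraction.
∣exchange∩C∣ : ∀ {n} (A C : Subset n) {x y} → x ∈ A → y ∉ A →
               mem x C + ∣ ((A - x) ∪ ⁅ y ⁆) ∩ C ∣ ≡ mem y C + ∣ A ∩ C ∣
∣exchange∩C∣ A C {x} {y} x∈A y∉A = begin
  mem x C + ∣ ((A - x) ∪ ⁅ y ⁆) ∩ C ∣   ≡⟨ cong (λ u → mem x C + u) (∣A∪⁅y⁆∩C∣ (A - x) C (y∉A ∘ p─q⊆p A ⁅ x ⁆)) ⟩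
  mem x C + (mem y C + ∣ (A - x) ∩ C ∣) ≡⟨ x∙yz≈y∙xz (mem x C) (mem y C) _ ⟩
  mem y C + (mem x C + ∣ (A - x) ∩ C ∣) ≡⟨ cong (λ u → mem y C + u) (∣A-x∩C∣ A C x∈A) ⟩
  mem y C + ∣ A ∩ C ∣                   ∎
  where
  open ≡-Reasoning
  open CommutativeSemigroupProperties ℕ.+-commutativeSemigroup using (x∙yz≈y∙xz)

∣exchange∣ : ∀ {n} (A : Subset n) {x y} → x ∈ A → y ∉ A → ∣ (A - x) ∪ ⁅ y ⁆ ∣ ≡ ∣ A ∣
∣exchange∣ {n} A {x} {y} x∈A y∉A = ℕ.suc-injective (begin
  suc ∣ (A - x) ∪ ⁅ y ⁆ ∣                ≡⟨ cong₂ _+_ (mem-∈ {x = x} ∈⊤) (cong ∣_∣ (∩-identityʳ ((A - x) ∪ ⁅ y ⁆))) ⟨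
  mem x ⊤ + ∣ ((A - x) ∪ ⁅ y ⁆) ∩ ⊤ ∣    ≡⟨ ∣exchange∩C∣ A ⊤ x∈A y∉A ⟩
  mem y ⊤ + ∣ A ∩ ⊤ ∣                    ≡⟨ cong₂ _+_ (mem-∈ {x = y} ∈⊤) (cong ∣_∣ (∩-identityʳ A)) ⟩
  suc ∣ A ∣                              ∎)
  where open ≡-Reasoning

∣∩∣+∣∩∁∣ : ∀ {n} (A C : Subset n) → ∣ A ∩ C ∣ + ∣ A ∩ ∁ C ∣ ≡ ∣ A ∣
∣∩∣+∣∩∁∣ []            []            = refl
∣∩∣+∣∩∁∣ (outside ∷ A) (c ∷ C)       = ∣∩∣+∣∩∁∣ A C
∣∩∣+∣∩∁∣ (inside ∷ A)  (inside ∷ C)  = cong suc (∣∩∣+∣∩∁∣ A C)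
∣∩∣+∣∩∁∣ (inside ∷ A)  (outside ∷ C) = trans (ℕ.+-suc ∣ A ∩ C ∣ _) (cong suc (∣∩∣+∣∩∁∣ A C))

∣∪∩∣+∣∩∩∣ : ∀ {n} (A B D : Subset n) →
            ∣ (A ∪ B) ∩ D ∣ + ∣ (A ∩ B) ∩ D ∣ ≡ ∣ A ∩ D ∣ + ∣ B ∩ D ∣
∣∪∩∣+∣∩∩∣ []            []            []            = refl
∣∪∩∣+∣∩∩∣ (outside ∷ A) (outside ∷ B) (d ∷ D)       = ∣∪∩∣+∣∩∩∣ A B D
∣∪∩∣+∣∩∩∣ (inside ∷ A)  (outside ∷ B) (outside ∷ D) = ∣∪∩∣+∣∩∩∣ A B D
∣∪∩∣+∣∩∩∣ (outside ∷ A) (inside ∷ B)  (outside ∷ D) = ∣∪∩∣+∣∩∩∣ A B D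
∣∪∩∣+∣∩∩∣ (inside ∷ A)  (inside ∷ B)  (outside ∷ D) = ∣∪∩∣+∣∩∩∣ A B D
∣∪∩∣+∣∩∩∣ (inside ∷ A)  (outside ∷ B) (inside ∷ D)  = cong suc (∣∪∩∣+∣∩∩∣ A B D)
∣∪∩∣+∣∩∩∣ (outside ∷ A) (inside ∷ B)  (inside ∷ D)  =
  trans (cong suc (∣∪∩∣+∣∩∩∣ A B D)) (sym (ℕ.+-suc ∣ A ∩ D ∣ _))
∣∪∩∣+∣∩∩∣ (inside ∷ A)  (inside ∷ B)  (inside ∷ D)  = cong suc
  (trans (ℕ.+-suc ∣ (A ∪ B) ∩ D ∣ _) (trans (cong suc (∣∪∩∣+∣∩∩∣ A B D)) (sym (ℕ.+-suc ∣ A ∩ D ∣ _))))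

∣∩∣-lipschitz : ∀ {n} (A B D : Subset n) → ∣ B ∩ D ∣ ≤ ∣ A ∩ D ∣ + ∣ B ─ A ∣
∣∩∣-lipschitz []            []            []            = z≤n
∣∩∣-lipschitz (outside ∷ A) (outside ∷ B) (d ∷ D)       = ∣∩∣-lipschitz A B D
∣∩∣-lipschitz (inside ∷ A)  (outside ∷ B) (outside ∷ D) = ∣∩∣-lipschitz A B D
∣∩∣-lipschitz (inside ∷ A)  (outside ∷ B) (inside ∷ D)  = ℕ.m≤n⇒m≤1+n (∣∩∣-lipschitz A B D)
∣∩∣-lipschitz (outside ∷ A) (inside ∷ B)  (outside ∷ D) =
  ℕ.≤-trans (∣∩∣-lipschitz A B D) (ℕ.+-monoʳ-≤ ∣ A ∩ D ∣ (ℕ.n≤1+n _))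
∣∩∣-lipschitz (outside ∷ A) (inside ∷ B)  (inside ∷ D)  =
  ℕ.≤-trans (s≤s (∣∩∣-lipschitz A B D)) (ℕ.≤-reflexive (sym (ℕ.+-suc ∣ A ∩ D ∣ _)))
∣∩∣-lipschitz (inside ∷ A)  (inside ∷ B)  (outside ∷ D) = ∣∩∣-lipschitz A B D
∣∩∣-lipschitz (inside ∷ A)  (inside ∷ B)  (inside ∷ D)  = s≤s (∣∩∣-lipschitz A B D)

⊆⇒∣─∣≡0 : ∀ {n} {A B : Subset n} → A ⊆ B → ∣ A ─ B ∣ ≡ 0
⊆⇒∣─∣≡0 {A = []}          {[]}          A⊆B = refl
⊆⇒∣─∣≡0 {A = outside ∷ A} {outside ∷ B} A⊆B = ⊆⇒∣─∣≡0 {A = A} (drop-∷-⊆ A⊆B)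
⊆⇒∣─∣≡0 {A = outside ∷ A} {inside ∷ B}  A⊆B = ⊆⇒∣─∣≡0 {A = A} (drop-∷-⊆ A⊆B)
⊆⇒∣─∣≡0 {A = inside ∷ A}  {inside ∷ B}  A⊆B = ⊆⇒∣─∣≡0 {A = A} (drop-∷-⊆ A⊆B)
⊆⇒∣─∣≡0 {A = inside ∷ A}  {outside ∷ B} A⊆B with () ← A⊆B here

-- Rank functions of matroids

-- The value at ⊥ is free, so that fixing an element inside gives another such function without
-- subtracting its rank. For B ⊆ A the first condition is monotonicity.
record IsRank {n} (r : Subset n → ℕ) : Set where
  field
    lipschitz  : ∀ A B → r B ≤ r A + ∣ B ─ A ∣
    submodular : ∀ A B → r (A ∪ B) + r (A ∩ B) ≤ r A + r B

  mono : ∀ {A B} → A ⊆ B → r A ≤ r B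
  mono {A} {B} A⊆B = ℕ.≤-trans (lipschitz B A)
    (ℕ.≤-reflexive (trans (cong (λ u → r B + u) (⊆⇒∣─∣≡0 A⊆B)) (ℕ.+-identityʳ (r B))))

module _ {E} (M : Matroid E) where

  private
    n = size E

  -- Exchanging an element of A outside B for one of B keeps the size of A and lowers ∣ A ∩ ∁ B ∣,
  -- which k bounds.
  ∣basis∣-≤ : ∀ k {A B} → IsBasis M A → IsBasis M B → ∣ A ∩ ∁ B ∣ ≤ k → ∣ A ∣ ≡ ∣ B ∣
  ∣basis∣-≤ k {A} {B} hA hB le with ⊆-or-∉ A B
  ... | inj₁ A⊆B with ⊆-or-∉ B A
  ...   | inj₁ B⊆A = cong ∣_∣ (⊆-antisym A⊆B B⊆A)
  ...   | inj₂ (x , x∈B , x∉A) =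
    let y , y∈A , y∉B , _ = exchange M hB hA x∈B x∉A in contradiction (A⊆B y∈A) y∉B
  ∣basis∣-≤ k {A} {B} hA hB le | inj₂ (x , x∈A , x∉B) with exchange M hA hB x∈A x∉B
  ... | y , y∈B , y∉A , hA′ = step k le
    where
    A′ = (A - x) ∪ ⁅ y ⁆
    closer : suc ∣ A′ ∩ ∁ B ∣ ≡ ∣ A ∩ ∁ B ∣
    closer = begin
      suc ∣ A′ ∩ ∁ B ∣          ≡⟨ cong (_+ ∣ A′ ∩ ∁ B ∣) (mem-∈ (x∉p⇒x∈∁p x∉B)) ⟨
      mem x (∁ B) + ∣ A′ ∩ ∁ B ∣ ≡⟨ ∣exchange∩C∣ A (∁ B) x∈A y∉A ⟩
      mem y (∁ B) + ∣ A ∩ ∁ B ∣  ≡⟨ cong (_+ ∣ A ∩ ∁ B ∣) (mem-∉ (x∈p⇒x∉∁p y∈B)) ⟩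
      ∣ A ∩ ∁ B ∣               ∎
      where open ≡-Reasoning
    step : ∀ k → ∣ A ∩ ∁ B ∣ ≤ k → ∣ A ∣ ≡ ∣ B ∣
    step zero    le = contradiction (subst (_≤ 0) (sym closer) le) (λ ())
    step (suc k) le = trans (sym (∣exchange∣ A x∈A y∉A))
      (∣basis∣-≤ k hA′ hB (ℕ.s≤s⁻¹ (subst (_≤ suc k) (sym closer) le)))

  ∣basis∣ : ∀ {A B} → IsBasis M A → IsBasis M B → ∣ A ∣ ≡ ∣ B ∣
  ∣basis∣ hA hB = ∣basis∣-≤ _ hA hB ℕ.≤-refl

  -- While D has an element outside B ∪ A, exchanging it for one of B brings D closer to B without
  -- shrinking D ∩ A. Once D ⊆ B ∪ A, some z in B lies outside D ∪ A, and exchanging z for an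
  -- element of D brings in an element of A. Since z is outside A, the set I stays in B.
  enlarge-≤ : ∀ k {I A B D} → I ⊆ A → I ⊆ B → IsBasis M B → IsBasis M D →
            ∣ B ∩ A ∣ < ∣ D ∩ A ∣ → ∣ D ∩ ∁ B ∣ ≤ k →
            ∃[ B′ ] IsBasis M B′ × I ⊆ B′ × ∣ B′ ∩ A ∣ ≡ suc ∣ B ∩ A ∣
  enlarge-≤ k {I} {A} {B} {D} I⊆A I⊆B hB hD lt le with ⊆-or-∉ D (B ∪ A)
  ... | inj₂ (x , x∈D , x∉B∪A) = step k le
    where
    x∉B = x∉B∪A ∘ p⊆p∪q A
    x∉A = x∉B∪A ∘ q⊆p∪q B A
    swap = exchange M hD hB x∈D x∉B
    y = proj₁ swap
    y∈B = proj₁ (proj₂ swap)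
    y∉D = proj₁ (proj₂ (proj₂ swap))
    D′ = (D - x) ∪ ⁅ y ⁆
    closer : suc ∣ D′ ∩ ∁ B ∣ ≡ ∣ D ∩ ∁ B ∣
    closer = begin
      suc ∣ D′ ∩ ∁ B ∣          ≡⟨ cong (_+ ∣ D′ ∩ ∁ B ∣) (mem-∈ (x∉p⇒x∈∁p x∉B)) ⟨
      mem x (∁ B) + ∣ D′ ∩ ∁ B ∣ ≡⟨ ∣exchange∩C∣ D (∁ B) x∈D y∉D ⟩
      mem y (∁ B) + ∣ D ∩ ∁ B ∣  ≡⟨ cong (_+ ∣ D ∩ ∁ B ∣) (mem-∉ (x∈p⇒x∉∁p y∈B)) ⟩
      ∣ D ∩ ∁ B ∣               ∎
      where open ≡-Reasoning
    still : ∣ D ∩ A ∣ ≤ ∣ D′ ∩ A ∣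
    still = begin
      ∣ D ∩ A ∣             ≤⟨ ℕ.m≤n+m _ (mem y A) ⟩
      mem y A + ∣ D ∩ A ∣   ≡⟨ ∣exchange∩C∣ D A x∈D y∉D ⟨
      mem x A + ∣ D′ ∩ A ∣  ≡⟨ cong (_+ ∣ D′ ∩ A ∣) (mem-∉ x∉A) ⟩
      ∣ D′ ∩ A ∣            ∎
      where open ℕ.≤-Reasoning
    step : ∀ k → ∣ D ∩ ∁ B ∣ ≤ k → ∃[ B′ ] IsBasis M B′ × I ⊆ B′ × ∣ B′ ∩ A ∣ ≡ suc ∣ B ∩ A ∣
    step zero    le = contradiction (subst (_≤ 0) (sym closer) le) (λ ())
    step (suc k) le = enlarge-≤ k I⊆A I⊆B hB (proj₂ (proj₂ (proj₂ swap))) (ℕ.≤-trans lt still)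
      (ℕ.s≤s⁻¹ (subst (_≤ suc k) (sym closer) le))
  ... | inj₁ D⊆B∪A with ⊆-or-∉ B (D ∪ A)
  -- Here B has at most as many elements outside A as D; as both have equal size, B has at least as
  -- many inside A.
  ...   | inj₁ B⊆D∪A = contradiction lt (ℕ.≤⇒≯ (ℕ.+-cancelʳ-≤ ∣ D ∩ ∁ A ∣ _ _ (begin
      ∣ D ∩ A ∣ + ∣ D ∩ ∁ A ∣ ≡⟨ ∣∩∣+∣∩∁∣ D A ⟩
      ∣ D ∣                   ≡⟨ ∣basis∣ hD hB ⟩
      ∣ B ∣                   ≡⟨ ∣∩∣+∣∩∁∣ B A ⟨
      ∣ B ∩ A ∣ + ∣ B ∩ ∁ A ∣ ≤⟨ ℕ.+-monoʳ-≤ ∣ B ∩ A ∣ (p⊆q⇒∣p∣≤∣q∣ outsideA) ⟩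
      ∣ B ∩ A ∣ + ∣ D ∩ ∁ A ∣ ∎)))
    where
    open ℕ.≤-Reasoning
    outsideA : B ∩ ∁ A ⊆ D ∩ ∁ A
    outsideA e∈ with x∈p∩q⁻ B (∁ A) e∈
    ... | e∈B , e∈∁A with x∈p∪q⁻ D A (B⊆D∪A e∈B)
    ...   | inj₁ e∈D = x∈p∩q⁺ (e∈D , e∈∁A)
    ...   | inj₂ e∈A = contradiction e∈A (x∈∁p⇒x∉p e∈∁A)
  ...   | inj₂ (z , z∈B , z∉D∪A) with exchange M hB hD z∈B (z∉D∪A ∘ p⊆p∪q A)
  ...     | y , y∈D , y∉B , hB′ = B′ , hB′ , I⊆B′ , grown
    where
    B′ = (B - z) ∪ ⁅ y ⁆
    z∉A = z∉D∪A ∘ q⊆p∪q D A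
    y∈A : y ∈ A
    y∈A = [ (λ y∈B → contradiction y∈B y∉B) , id ]′ (x∈p∪q⁻ B A (D⊆B∪A y∈D))
    I⊆B′ : I ⊆ B′
    I⊆B′ i∈I = p⊆p∪q ⁅ y ⁆ (x∈p∧x≢y⇒x∈p-y (I⊆B i∈I) λ { refl → z∉A (I⊆A i∈I) })
    grown : ∣ B′ ∩ A ∣ ≡ suc ∣ B ∩ A ∣
    grown = begin
      ∣ B′ ∩ A ∣            ≡⟨ cong (_+ ∣ B′ ∩ A ∣) (mem-∉ z∉A) ⟨
      mem z A + ∣ B′ ∩ A ∣  ≡⟨ ∣exchange∩C∣ B A z∈B y∉B ⟩
      mem y A + ∣ B ∩ A ∣   ≡⟨ cong (_+ ∣ B ∩ A ∣) (mem-∈ y∈A) ⟩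
      suc ∣ B ∩ A ∣         ∎
      where open ≡-Reasoning

  rk-≥ : ∀ A {B} → IsBasis M B → ∣ A ∩ B ∣ ≤ rk M A
  rk-≥ A hB = All.lookup (ℕ-Extrema.xs≤max 0 (map (λ B → ∣ A ∩ B ∣) (bases M)))
                         (∈-map⁺ (λ B → ∣ A ∩ B ∣) (∈-bases⁺ M hB))

  rk-attained : ∀ A → ∃[ B ] IsBasis M B × ∣ A ∩ B ∣ ≡ rk M A
  rk-attained A with ℕ-Extrema.argmax-sel id 0 (map (λ B → ∣ A ∩ B ∣) (bases M))
  ... | inj₂ rk∈ = let B , B∈ , eq = ∈-map⁻ (λ B → ∣ A ∩ B ∣) rk∈ in B , ∈-bases⁻ M B∈ , sym eq
  ... | inj₁ rk≡0 = let B , hB = nonempty M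
                    in B , hB , ℕ.≤-antisym (rk-≥ A hB) (ℕ.≤-trans (ℕ.≤-reflexive rk≡0) z≤n)

  extend : ∀ {I A} → I ⊆ A → IsIndependent M I → ∃[ B ] IsBasis M B × I ⊆ B × ∣ A ∩ B ∣ ≡ rk M A
  extend {I} {A} I⊆A (B₀ , hB₀ , I⊆B₀) with rk-attained A
  ... | D , hD , eq = go (∣ D ∩ A ∣ ℕ.∸ ∣ B₀ ∩ A ∣) hB₀ I⊆B₀ (ℕ.m∸n+n≡m B₀≤D)
    where
    D∩A = trans (cong ∣_∣ (∩-comm D A)) eq
    B₀≤D : ∣ B₀ ∩ A ∣ ≤ ∣ D ∩ A ∣
    B₀≤D = ℕ.≤-trans (ℕ.≤-reflexive (cong ∣_∣ (∩-comm B₀ A)))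
             (ℕ.≤-trans (rk-≥ A hB₀) (ℕ.≤-reflexive (sym D∩A)))
    go : ∀ d {B} → IsBasis M B → I ⊆ B → d + ∣ B ∩ A ∣ ≡ ∣ D ∩ A ∣ →
         ∃[ B ] IsBasis M B × I ⊆ B × ∣ A ∩ B ∣ ≡ rk M A
    go zero    {B} hB I⊆B eq = B , hB , I⊆B , trans (cong ∣_∣ (∩-comm A B)) (trans eq D∩A)
    go (suc d) {B} hB I⊆B eq =
      let B′ , hB′ , I⊆B′ , grown = enlarge-≤ _ I⊆A I⊆B hB hD
            (ℕ.≤-trans (s≤s (ℕ.m≤n+m _ d)) (ℕ.≤-reflexive eq)) ℕ.≤-refl
      in go d hB′ I⊆B′ (trans (cong (λ u → d + u) grown) (trans (ℕ.+-suc d _) eq))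

  rk-isRank : IsRank (rk M)
  rk-isRank = record { lipschitz = lip ; submodular = sub }
    where
    open ℕ.≤-Reasoning
    lip : ∀ A B → rk M B ≤ rk M A + ∣ B ─ A ∣
    lip A B with rk-attained B
    ... | D , hD , eq = begin
      rk M B               ≡⟨ eq ⟨
      ∣ B ∩ D ∣            ≤⟨ ∣∩∣-lipschitz A B D ⟩
      ∣ A ∩ D ∣ + ∣ B ─ A ∣ ≤⟨ ℕ.+-monoˡ-≤ ∣ B ─ A ∣ (rk-≥ A hD) ⟩
      rk M A + ∣ B ─ A ∣    ∎
    sub : ∀ A B → rk M (A ∪ B) + rk M (A ∩ B) ≤ rk M A + rk M B
    -- A maximal independent subset of A ∩ B is extended to a basis C attaining the rank of A ∪ B.
    -- This single C attains both ranks on the left, and counting its elements is modular.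
    sub A B with rk-attained (A ∩ B)
    ... | D , hD , eq with extend {(A ∩ B) ∩ D} {A ∪ B}
                            (p⊆p∪q B ∘ p∩q⊆p A B ∘ p∩q⊆p (A ∩ B) D) (D , hD , p∩q⊆q (A ∩ B) D)
    ...   | C , hC , I⊆C , eq′ = begin
      rk M (A ∪ B) + rk M (A ∩ B)        ≡⟨ cong₂ _+_ eq′ eq ⟨
      ∣ (A ∪ B) ∩ C ∣ + ∣ (A ∩ B) ∩ D ∣  ≤⟨ ℕ.+-monoʳ-≤ ∣ (A ∪ B) ∩ C ∣ (p⊆q⇒∣p∣≤∣q∣ I⊆A∩B∩C) ⟩
      ∣ (A ∪ B) ∩ C ∣ + ∣ (A ∩ B) ∩ C ∣  ≡⟨ ∣∪∩∣+∣∩∩∣ A B C ⟩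
      ∣ A ∩ C ∣ + ∣ B ∩ C ∣              ≤⟨ ℕ.+-mono-≤ (rk-≥ A hC) (rk-≥ B hC) ⟩
      rk M A + rk M B                    ∎
      where
      I⊆A∩B∩C : (A ∩ B) ∩ D ⊆ (A ∩ B) ∩ C
      I⊆A∩B∩C e∈ = x∈p∩q⁺ (p∩q⊆p (A ∩ B) D e∈ , I⊆C e∈)

  independent⇒rk : ∀ {I} → IsIndependent M I → rk M I ≡ ∣ I ∣
  independent⇒rk {I} ind with extend {I} {I} id ind
  ... | B , hB , I⊆B , eq = trans (sym eq) (cong ∣_∣ (⊆-antisym (p∩q⊆p I B) (λ i∈ → x∈p∩q⁺ (i∈ , I⊆B i∈))))

  rk⇒independent : ∀ {I} → rk M I ≡ ∣ I ∣ → IsIndependent M I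
  rk⇒independent {I} eq with rk-attained I
  ... | B , hB , eq′ with ⊆-or-∉ I B
  ...   | inj₁ I⊆B = B , hB , I⊆B
  ...   | inj₂ (x , x∈I , x∉B) = contradiction (trans eq′ eq)
    (ℕ.<⇒≢ (p⊂q⇒∣p∣<∣q∣ (p∩q⊆p I B , x , x∈I , x∉B ∘ p∩q⊆q I B)))

  rk-⊥ : rk M ⊥ ≡ 0
  rk-⊥ = let B , hB , eq = rk-attained ⊥
         in trans (sym eq) (trans (cong ∣_∣ (∩-zeroˡ B)) (∣⊥∣≡0 n))

-- Alternating sums over intervals of the Boolean lattice

sgn : ℕ → ℤ
sgn k = -1ℤ ℤ.^ k

sgn-suc : ∀ k → sgn (suc k) ≡ ℤ.- sgn k
sgn-suc k = ℤ.-1*i≡-i (sgn k)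

sgn-+ : ∀ j k → sgn (j + k) ≡ sgn j ℤ.* sgn k
sgn-+ = ℤ.^-distribˡ-+-* -1ℤ

sgn² : ∀ k → sgn k ℤ.* sgn k ≡ 1ℤ
sgn² zero    = refl
sgn² (suc k) = trans
  (solve 1 (λ s → (con -1ℤ :* s) :* (con -1ℤ :* s) := s :* s) refl (sgn k)) (sgn² k)
  where open ℤ-Solver.+-*-Solver

∣sgn*∣ : ∀ k z → ℤ.∣ sgn k ℤ.* z ∣ ≡ ℤ.∣ z ∣
∣sgn*∣ zero    z = cong ℤ.∣_∣ (ℤ.*-identityˡ z)
∣sgn*∣ (suc k) z = trans (cong ℤ.∣_∣ (trans (cong (ℤ._* z) (sgn-suc k)) (sym (ℤ.neg-distribˡ-* (sgn k) z))))
  (trans (ℤ.∣-i∣≡∣i∣ (sgn k ℤ.* z)) (∣sgn*∣ k z))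

-- Recursive in the coordinates, so that sums over it split by deletion and contraction of the first
-- element. It is empty unless F ⊆ G.
interval : ∀ {n} → Subset n → Subset n → List (Subset n)
interval []            []            = [] ∷ []
interval (outside ∷ F) (outside ∷ G) = map (outside ∷_) (interval F G)
interval (outside ∷ F) (inside ∷ G)  = map (outside ∷_) (interval F G) ++ map (inside ∷_) (interval F G)
interval (inside ∷ F)  (outside ∷ G) = []
interval (inside ∷ F)  (inside ∷ G)  = map (inside ∷_) (interval F G)

alt : ∀ {n} → Subset n → Subset n → (Subset n → ℤ) → ℤ
alt F G f = ∑[ A ← interval F G ] sgn ∣ A ∣ ℤ.* f A

∑-in : ∀ {n} (As : List (Subset n)) (f : Subset (suc n) → ℤ) →
       ∑[ A ← map (inside ∷_) As ] sgn ∣ A ∣ ℤ.* f A ≡ ℤ.- (∑[ A ← As ] sgn ∣ A ∣ ℤ.* f (inside ∷ A))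
∑-in As f = trans (∑-map (inside ∷_) As _) (trans
  (∑-cong As (λ A → solve 2 (λ s x → (con -1ℤ :* s) :* x := con -1ℤ :* (s :* x)) refl (sgn ∣ A ∣) (f (inside ∷ A))))
  (trans (∑-*ˡ As -1ℤ (λ A → sgn ∣ A ∣ ℤ.* f (inside ∷ A))) (ℤ.-1*i≡-i _)))
  where open ℤ-Solver.+-*-Solver

module _ {n} (F G : Subset n) (f : Subset (suc n) → ℤ) where

  alt-out-out : alt (outside ∷ F) (outside ∷ G) f ≡ alt F G (f ∘ (outside ∷_))
  alt-out-out = ∑-map (outside ∷_) (interval F G) (λ A → sgn ∣ A ∣ ℤ.* f A)

  alt-in-in : alt (inside ∷ F) (inside ∷ G) f ≡ ℤ.- alt F G (f ∘ (inside ∷_))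
  alt-in-in = ∑-in (interval F G) f

  alt-out-in : alt (outside ∷ F) (inside ∷ G) f ≡ alt F G (f ∘ (outside ∷_)) ℤ.- alt F G (f ∘ (inside ∷_))
  alt-out-in = trans (∑-++ (map (outside ∷_) (interval F G)) _ (λ A → sgn ∣ A ∣ ℤ.* f A))
    (cong₂ ℤ._+_ alt-out-out alt-in-in)

alt-cong : ∀ {n} (F G : Subset n) {f g} → (∀ A → F ⊆ A → A ⊆ G → f A ≡ g A) → alt F G f ≡ alt F G g
alt-cong [] [] eq = cong (λ u → 1ℤ ℤ.* u ℤ.+ 0ℤ) (eq [] id id)
alt-cong (outside ∷ F) (outside ∷ G) {f} {g} eq = trans (alt-out-out F G f) (trans
  (alt-cong F G (λ A F⊆A A⊆G → eq (outside ∷ A) (s⊆s F⊆A) (s⊆s A⊆G))) (sym (alt-out-out F G g)))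
alt-cong (inside ∷ F) (outside ∷ G) eq = refl
alt-cong (inside ∷ F) (inside ∷ G) {f} {g} eq = trans (alt-in-in F G f) (trans
  (cong ℤ.-_ (alt-cong F G (λ A F⊆A A⊆G → eq (inside ∷ A) (s⊆s F⊆A) (s⊆s A⊆G)))) (sym (alt-in-in F G g)))
alt-cong (outside ∷ F) (inside ∷ G) {f} {g} eq = trans (alt-out-in F G f) (trans
  (cong₂ ℤ._-_ (alt-cong F G (λ A F⊆A A⊆G → eq (outside ∷ A) (s⊆s F⊆A) (out⊆ A⊆G)))
               (alt-cong F G (λ A F⊆A A⊆G → eq (inside ∷ A) (out⊆ F⊆A) (s⊆s A⊆G))))
  (sym (alt-out-in F G g)))

alt-0 : ∀ {n} (F G : Subset n) {f} → (∀ A → F ⊆ A → A ⊆ G → f A ≡ 0ℤ) → alt F G f ≡ 0ℤ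
alt-0 F G f≡0 = trans (alt-cong F G f≡0) (∑-0 (interval F G) (λ A → ℤ.*-zeroʳ (sgn ∣ A ∣)))

-- The terms of A and A ∪ {e} cancel.
alt-toggle : ∀ {n} (F G : Subset n) e {f} → e ∉ F → e ∈ G →
  (∀ A → F ⊆ A → A ⊆ G → f (A ∪ ⁅ e ⁆) ≡ f A) → alt F G f ≡ 0ℤ
alt-toggle (inside ∷ F) (inside ∷ G) zero e∉F e∈G eq = contradiction here e∉F
alt-toggle (outside ∷ F) (inside ∷ G) zero {f} e∉F e∈G eq = trans (alt-out-in F G f) (trans
  (cong (λ u → alt F G (f ∘ (outside ∷_)) ℤ.- u) (alt-cong F G (λ A F⊆A A⊆G →
    trans (cong (f ∘ (inside ∷_)) (sym (∪-identityʳ A))) (eq (outside ∷ A) (s⊆s F⊆A) (out⊆ A⊆G)))))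
  (ℤ.+-inverseʳ (alt F G (f ∘ (outside ∷_)))))
alt-toggle (outside ∷ F) (outside ∷ G) (suc e) {f} e∉F (there e∈G) eq = trans (alt-out-out F G f)
  (alt-toggle F G e (e∉F ∘ there) e∈G (λ A F⊆A A⊆G → eq (outside ∷ A) (s⊆s F⊆A) (s⊆s A⊆G)))
alt-toggle (inside ∷ F) (outside ∷ G) (suc e) e∉F (there e∈G) eq = refl
alt-toggle (inside ∷ F) (inside ∷ G) (suc e) {f} e∉F (there e∈G) eq = trans (alt-in-in F G f)
  (cong ℤ.-_ (alt-toggle F G e (e∉F ∘ there) e∈G (λ A F⊆A A⊆G → eq (inside ∷ A) (s⊆s F⊆A) (s⊆s A⊆G))))
alt-toggle (outside ∷ F) (inside ∷ G) (suc e) {f} e∉F (there e∈G) eq = trans (alt-out-in F G f)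
  (cong₂ ℤ._-_
    (alt-toggle F G e (e∉F ∘ there) e∈G (λ A F⊆A A⊆G → eq (outside ∷ A) (s⊆s F⊆A) (out⊆ A⊆G)))
    (alt-toggle F G e (e∉F ∘ there) e∈G (λ A F⊆A A⊆G → eq (inside ∷ A) (out⊆ F⊆A) (s⊆s A⊆G))))

alt-1 : ∀ {n} (F G : Subset n) → alt F G (λ _ → 1ℤ) ≡ sgn ∣ F ∣ ℤ.* indicator (F ≟ₛ G)
alt-1 []            []            = refl
alt-1 (outside ∷ F) (outside ∷ G) = trans (alt-out-out F G _) (trans (alt-1 F G)
  (cong (λ u → sgn ∣ F ∣ ℤ.* u) (indicator-cong (F ≟ₛ G) ((outside ∷ F) ≟ₛ (outside ∷ G)) (cong (outside ∷_)) Vec.∷-injectiveʳ)))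
alt-1 (inside ∷ F) (outside ∷ G) = sym (ℤ.*-zeroʳ (sgn (suc ∣ F ∣)))
alt-1 (outside ∷ F) (inside ∷ G) = trans (alt-out-in F G _)
  (trans (ℤ.+-inverseʳ (alt F G (λ _ → 1ℤ))) (sym (ℤ.*-zeroʳ (sgn ∣ F ∣))))
alt-1 (inside ∷ F) (inside ∷ G) = trans (alt-in-in F G _) (trans (cong ℤ.-_ (alt-1 F G)) (trans
  (ℤ.neg-distribˡ-* (sgn ∣ F ∣) (indicator (F ≟ₛ G))) (cong₂ ℤ._*_ (sym (sgn-suc ∣ F ∣))
    (indicator-cong (F ≟ₛ G) ((inside ∷ F) ≟ₛ (inside ∷ G)) (cong (inside ∷_)) Vec.∷-injectiveʳ))))

within : ∀ {n} (F G A : Subset n) → ℤ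
within F G A = indicator (F ⊆? A) ℤ.* indicator (A ⊆? G)

∑-interval : ∀ {n} (F G : Subset n) (f : Subset n → ℤ) →
             ∑ (interval F G) f ≡ ∑[ A ← subsets n ] within F G A ℤ.* f A
∑-interval [] [] f = cong (ℤ._+ 0ℤ) (sym (ℤ.*-identityˡ (f [])))
∑-interval {suc n} (outside ∷ F) (outside ∷ G) f = sym (begin
  ∑ (subsets (suc n)) _ ≡⟨ ∑-subsets {n} (λ A → within (outside ∷ F) (outside ∷ G) A ℤ.* f A) ⟩
  _ ≡⟨ +-cong-right (∑[ A ← subsets n ] within F G A ℤ.* f (outside ∷ A)) (∑-0 (subsets n) (λ A → cong (ℤ._* f (inside ∷ A)) (ℤ.*-zeroʳ (indicator (F ⊆? A))))) ⟩
  _ ≡⟨ ℤ.+-identityʳ _ ⟩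
  ∑[ A ← subsets n ] within F G A ℤ.* f (outside ∷ A) ≡⟨ ∑-interval F G (f ∘ (outside ∷_)) ⟨
  ∑ (interval F G) (f ∘ (outside ∷_)) ≡⟨ ∑-map (outside ∷_) (interval F G) f ⟨
  _ ∎)
  where open ≡-Reasoning
∑-interval {suc n} (inside ∷ F) (inside ∷ G) f = sym (begin
  ∑ (subsets (suc n)) _ ≡⟨ ∑-subsets {n} (λ A → within (inside ∷ F) (inside ∷ G) A ℤ.* f A) ⟩
  _ ≡⟨ cong₂ ℤ._+_ (∑-0 (subsets n) (λ A → cong (ℤ._* f (outside ∷ A)) (ℤ.*-zeroˡ (indicator (A ⊆? G))))) refl ⟩
  _ ≡⟨ ℤ.+-identityˡ _ ⟩
  ∑[ A ← subsets n ] within F G A ℤ.* f (inside ∷ A) ≡⟨ ∑-interval F G (f ∘ (inside ∷_)) ⟨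
  ∑ (interval F G) (f ∘ (inside ∷_)) ≡⟨ ∑-map (inside ∷_) (interval F G) f ⟨
  _ ∎)
  where open ≡-Reasoning
∑-interval {suc n} (inside ∷ F) (outside ∷ G) f = sym (begin
  ∑ (subsets (suc n)) _ ≡⟨ ∑-subsets {n} (λ A → within (inside ∷ F) (outside ∷ G) A ℤ.* f A) ⟩
  _ ≡⟨ cong₂ ℤ._+_ (∑-0 (subsets n) (λ A → cong (ℤ._* f (outside ∷ A)) (ℤ.*-zeroˡ (indicator (A ⊆? G)))))
                  (∑-0 (subsets n) (λ A → cong (ℤ._* f (inside ∷ A)) (ℤ.*-zeroʳ (indicator (F ⊆? A))))) ⟩
  0ℤ ∎)
  where open ≡-Reasoning
∑-interval {suc n} (outside ∷ F) (inside ∷ G) f = sym (begin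
  ∑ (subsets (suc n)) _ ≡⟨ ∑-subsets {n} (λ A → within (outside ∷ F) (inside ∷ G) A ℤ.* f A) ⟩
  _ ≡⟨ cong₂ ℤ._+_ (sym (∑-interval F G (f ∘ (outside ∷_)))) (sym (∑-interval F G (f ∘ (inside ∷_)))) ⟩
  _ ≡⟨ cong₂ ℤ._+_ (∑-map (outside ∷_) (interval F G) f) (∑-map (inside ∷_) (interval F G) f) ⟨
  _ ≡⟨ ∑-++ (map (outside ∷_) (interval F G)) _ f ⟨
  _ ∎)
  where open ≡-Reasoning

-- Signs of alternating sums, by deletion–contraction

-- z is zero or has sign (-1)^k. With such a k known, ∣z∣ is the linear expression (-1)^k z.
record Signed (k : ℕ) (z : ℤ) : Set where
  constructor signed
  field
    magnitude : ℕ
    sgn*      : sgn k ℤ.* z ≡ + magnitude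

signed-cong : ∀ {j k y z} → sgn j ≡ sgn k → y ≡ z → Signed j y → Signed k z
signed-cong sj≡sk y≡z (signed m eq) = signed m (trans (cong₂ ℤ._*_ (sym sj≡sk) (sym y≡z)) eq)

signed-0 : ∀ k → Signed k 0ℤ
signed-0 k = signed 0 (ℤ.*-zeroʳ (sgn k))

signed-+ : ∀ {k y z} → Signed k y → Signed k z → Signed k (y ℤ.+ z)
signed-+ {k} {y} {z} (signed m eq) (signed m′ eq′) =
  signed (m + m′) (trans (ℤ.*-distribˡ-+ (sgn k) y z) (cong₂ ℤ._+_ eq eq′))

signed-neg : ∀ {k z} → Signed k z → Signed (suc k) (ℤ.- z)
signed-neg {k} {z} (signed m eq) =
  signed m (trans (solve 2 (λ s z → (con -1ℤ :* s) :* (:- z) := s :* z) refl (sgn k) z) eq)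
  where open ℤ-Solver.+-*-Solver

signed⇒∣∣ : ∀ {k z} → Signed k z → + ℤ.∣ z ∣ ≡ sgn k ℤ.* z
signed⇒∣∣ {k} {z} (signed m eq) = sym (trans eq (cong +_ (trans (sym (cong ℤ.∣_∣ eq)) (∣sgn*∣ k z))))

sgn-suc² : ∀ k → sgn (suc (suc k)) ≡ sgn k
sgn-suc² k = solve 1 (λ s → con -1ℤ :* (con -1ℤ :* s) := s) refl (sgn k)
  where open ℤ-Solver.+-*-Solver

module _ {n} {r : Subset (suc n) → ℕ} (isRank : IsRank r) where

  -- `outside` is deletion of the first element; `inside` is its contraction, with ranks shifted by
  -- a constant.
  fix-head : ∀ s → IsRank (r ∘ (s ∷_))
  fix-head outside = record
    { lipschitz  = λ A B → IsRank.lipschitz isRank (outside ∷ A) (outside ∷ B)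
    ; submodular = λ A B → IsRank.submodular isRank (outside ∷ A) (outside ∷ B) }
  fix-head inside = record
    { lipschitz  = λ A B → IsRank.lipschitz isRank (inside ∷ A) (inside ∷ B)
    ; submodular = λ A B → IsRank.submodular isRank (inside ∷ A) (inside ∷ B) }

  out≤in : ∀ A → r (outside ∷ A) ≤ r (inside ∷ A)
  out≤in A = IsRank.mono isRank (out⊆ id)

  in≤1+out : ∀ A → r (inside ∷ A) ≤ suc (r (outside ∷ A))
  in≤1+out A = ℕ.≤-trans (IsRank.lipschitz isRank (outside ∷ A) (inside ∷ A))
    (ℕ.≤-reflexive (trans (ℕ.+-suc _ _) (cong suc
      (trans (cong (λ d → r (outside ∷ A) + d) (⊆⇒∣─∣≡0 {A = A} id)) (ℕ.+-identityʳ _)))))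

  in≡out-or-1+out : ∀ A → r (inside ∷ A) ≡ r (outside ∷ A) ⊎ r (inside ∷ A) ≡ suc (r (outside ∷ A))
  in≡out-or-1+out A with ℕ.m≤n⇒m<n∨m≡n (in≤1+out A)
  ... | inj₁ lt = inj₁ (ℕ.≤-antisym (ℕ.s≤s⁻¹ lt) (out≤in A))
  ... | inj₂ eq = inj₂ eq

  -- Diminishing returns: submodularity for `inside ∷ A` and `outside ∷ B` bounds the rank gained
  -- over B by the rank gained over A.
  in≡out-mono : ∀ {A B} → A ⊆ B → r (inside ∷ A) ≡ r (outside ∷ A) → r (inside ∷ B) ≡ r (outside ∷ B)
  in≡out-mono {A} {B} A⊆B eq = ℕ.≤-antisym (ℕ.+-cancelʳ-≤ (r (outside ∷ A)) _ _ (begin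
    r (inside ∷ B) + r (outside ∷ A)             ≡⟨ cong₂ (λ C D → r (inside ∷ C) + r (outside ∷ D)) ∪≡ ∩≡ ⟨
    r (inside ∷ (A ∪ B)) + r (outside ∷ (A ∩ B)) ≤⟨ IsRank.submodular isRank (inside ∷ A) (outside ∷ B) ⟩
    r (inside ∷ A) + r (outside ∷ B)             ≡⟨ cong (_+ r (outside ∷ B)) eq ⟩
    r (outside ∷ A) + r (outside ∷ B)            ≡⟨ ℕ.+-comm (r (outside ∷ A)) _ ⟩
    r (outside ∷ B) + r (outside ∷ A)            ∎)) (out≤in B)
    where
    open ℕ.≤-Reasoning
    ∪≡ : A ∪ B ≡ B
    ∪≡ = ⊆-antisym (λ x∈ → [ A⊆B , id ]′ (x∈p∪q⁻ A B x∈)) (q⊆p∪q A B)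
    ∩≡ : A ∩ B ≡ A
    ∩≡ = ⊆-antisym (p∩q⊆p A B) (λ x∈ → x∈p∩q⁺ (x∈ , A⊆B x∈))

-- For F ⊆ G this sum is, up to sign, T(1,0) of the minor between F and G. If the first element lies
-- in G but not in F, the sum is X - Y with X from deletion and Y from contraction. A loop over F
-- makes X = Y; otherwise X and -Y have the same sign.
spanning-signed : ∀ {n} {r : Subset n → ℕ} → IsRank r → ∀ F G →
  Signed (∣ F ∣ + r F + r G) (alt F G (λ A → indicator (r A ℕ.≟ r G)))
spanning-signed {r = r} isRank [] [] = signed 1 (trans
  (cong₂ ℤ._*_ (trans (sgn-+ (r []) (r [])) (sgn² (r [])))
               (cong (λ u → 1ℤ ℤ.* u ℤ.+ 0ℤ) (indicator-yes (r [] ℕ.≟ r []) refl))) refl)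
spanning-signed isRank (outside ∷ F) (outside ∷ G) =
  signed-cong refl (sym (alt-out-out F G _)) (spanning-signed (fix-head isRank outside) F G)
spanning-signed {r = r} isRank (inside ∷ F) (outside ∷ G) =
  signed-0 (suc ∣ F ∣ + r (inside ∷ F) + r (outside ∷ G))
spanning-signed {r = r} isRank (inside ∷ F) (inside ∷ G) =
  signed-cong refl (sym (alt-in-in F G _))
    (signed-neg {∣ F ∣ + r (inside ∷ F) + r (inside ∷ G)} (spanning-signed (fix-head isRank inside) F G))
spanning-signed {r = r} isRank (outside ∷ F) (inside ∷ G) =
  signed-cong {k} refl (sym (alt-out-in F G f)) cases
  where
  f = λ A → indicator (r A ℕ.≟ r (inside ∷ G))
  k = ∣ F ∣ + r (outside ∷ F) + r (inside ∷ G)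
  X = alt F G (f ∘ (outside ∷_))
  Y = alt F G (f ∘ (inside ∷_))

  -- If deleting the element lowers the rank of G, no set avoiding it spans G and X = 0.
  deletion : Signed k X
  deletion with r (outside ∷ G) ℕ.≟ r (inside ∷ G)
  ... | yes eq = subst (λ ρ → Signed (∣ F ∣ + r (outside ∷ F) + ρ) (alt F G (λ A → indicator (r (outside ∷ A) ℕ.≟ ρ))))
                   eq (spanning-signed (fix-head isRank outside) F G)
  ... | no neq = signed-cong {k} refl (sym (alt-0 F G (λ A _ A⊆G → indicator-no (r (outside ∷ A) ℕ.≟ r (inside ∷ G))
    (λ eq → neq (ℕ.≤-antisym (out≤in isRank G) (subst (_≤ r (outside ∷ G)) eq (IsRank.mono isRank (s⊆s A⊆G)))))))) (signed-0 k)

  cases : Signed k (X ℤ.- Y)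
  cases with in≡out-or-1+out isRank F
  ... | inj₁ loop = signed-cong {k} refl (sym (trans (cong (λ u → X ℤ.- u) Y≡X) (ℤ.+-inverseʳ X))) (signed-0 k)
    where
    Y≡X : Y ≡ X
    Y≡X = alt-cong F G (λ A F⊆A _ → cong (λ ρ → indicator (ρ ℕ.≟ r (inside ∷ G))) (in≡out-mono isRank F⊆A loop))
  ... | inj₂ nonloop = signed-+ {k} deletion (signed-cong same-sign refl
      (signed-neg {∣ F ∣ + r (inside ∷ F) + r (inside ∷ G)} (spanning-signed (fix-head isRank inside) F G)))
    where
    -- Contraction raises the rank of F by one and subtraction flips the sign again.
    same-sign : sgn (suc (∣ F ∣ + r (inside ∷ F) + r (inside ∷ G))) ≡ sgn k
    same-sign = trans (cong (λ ρ → sgn (suc (ρ + r (inside ∷ G))))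
      (trans (cong (λ ρ → ∣ F ∣ + ρ) nonloop) (ℕ.+-suc ∣ F ∣ _))) (sgn-suc² k)

-- Up to sign this is T(0,1) of the restriction to G, with independence measured relative to r ⊥
-- because contraction shifts that value. No independent set contains a loop, so Y = 0 for a loop; a
-- coloop of G makes X = Y; in all other cases X and -Y have the same sign.
independent-signed : ∀ {n} {r : Subset n → ℕ} → IsRank r → ∀ G →
  Signed (r ⊥ + r G) (alt ⊥ G (λ A → indicator (r A ℕ.≟ r ⊥ + ∣ A ∣)))
independent-signed {r = r} isRank [] = signed 1 (trans
  (cong₂ ℤ._*_ (trans (sgn-+ (r []) (r [])) (sgn² (r [])))
               (cong (λ u → 1ℤ ℤ.* u ℤ.+ 0ℤ) (indicator-yes (r [] ℕ.≟ r [] + 0) (sym (ℕ.+-identityʳ _))))) refl)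
independent-signed isRank (outside ∷ G) =
  signed-cong refl (sym (alt-out-out ⊥ G _)) (independent-signed (fix-head isRank outside) G)
independent-signed {suc n} {r} isRank (inside ∷ G) = signed-cong {k} refl (sym (alt-out-in ⊥ G f)) cases
  where
  ∅ : Subset n
  ∅ = ⊥
  f = λ A → indicator (r A ℕ.≟ r (outside ∷ ∅) + ∣ A ∣)
  k = r (outside ∷ ∅) + r (inside ∷ G)
  X = alt ∅ G (f ∘ (outside ∷_))
  Y = alt ∅ G (f ∘ (inside ∷_))

  deletion : r (outside ∷ G) ≡ r (inside ∷ G) → Signed k X
  deletion eq = signed-cong {r (outside ∷ ∅) + r (outside ∷ G)} (cong (λ ρ → sgn (r (outside ∷ ∅) + ρ)) eq) refl
    (independent-signed (fix-head isRank outside) G)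

  cases : Signed k (X ℤ.- Y)
  cases with in≡out-or-1+out isRank ∅
  ... | inj₁ loop = signed-cong {k} refl
      (sym (trans (cong (λ u → X ℤ.- u) Y≡0) (ℤ.+-identityʳ X))) (deletion (sym (in≡out-mono isRank (⊆-min G) loop)))
    where
    Y≡0 : Y ≡ 0ℤ
    Y≡0 = alt-0 ∅ G (λ A _ _ → indicator-no (r (inside ∷ A) ℕ.≟ r (outside ∷ ∅) + suc ∣ A ∣)
      (ℕ.<⇒≢ (ℕ.≤-trans (s≤s (ℕ.≤-trans (IsRank.lipschitz isRank (inside ∷ ∅) (inside ∷ A))
        (ℕ.+-mono-≤ (ℕ.≤-reflexive loop) (∣p─q∣≤∣p∣ A ∅)))) (ℕ.≤-reflexive (sym (ℕ.+-suc _ _))))))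
  ... | inj₂ nonloop with in≡out-or-1+out isRank G
  ...   | inj₁ noncoloop = signed-+ {k} (deletion (sym noncoloop)) (signed-cong same-sign (cong ℤ.-_ Y≡)
      (signed-neg {r (inside ∷ ∅) + r (inside ∷ G)} (independent-signed (fix-head isRank inside) G)))
    where
    same-sign : sgn (suc (r (inside ∷ ∅) + r (inside ∷ G))) ≡ sgn k
    same-sign = trans (cong (λ ρ → sgn (suc (ρ + r (inside ∷ G)))) nonloop) (sgn-suc² k)
    Y≡ : alt ∅ G (λ A → indicator (r (inside ∷ A) ℕ.≟ r (inside ∷ ∅) + ∣ A ∣)) ≡ Y
    Y≡ = alt-cong ∅ G (λ A _ _ → cong (λ ρ → indicator (r (inside ∷ A) ℕ.≟ ρ))
      (trans (cong (_+ ∣ A ∣) nonloop) (sym (ℕ.+-suc _ _))))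
  ...   | inj₂ coloop = signed-cong {k} refl (sym (trans (cong (λ u → X ℤ.- u) Y≡X) (ℤ.+-inverseʳ X))) (signed-0 k)
    where
    in≡1+out : ∀ {A} → A ⊆ G → r (inside ∷ A) ≡ suc (r (outside ∷ A))
    in≡1+out {A} A⊆G with in≡out-or-1+out isRank A
    ... | inj₂ eq = eq
    ... | inj₁ eq = contradiction (trans (sym coloop) (in≡out-mono isRank A⊆G eq)) (ℕ.1+n≢n)
    Y≡X : Y ≡ X
    Y≡X = alt-cong ∅ G (λ A _ A⊆G → indicator-cong
      (r (inside ∷ A) ℕ.≟ r (outside ∷ ∅) + suc ∣ A ∣) (r (outside ∷ A) ℕ.≟ r (outside ∷ ∅) + ∣ A ∣)
      (λ eq → ℕ.suc-injective (trans (sym (in≡1+out A⊆G)) (trans eq (ℕ.+-suc _ _))))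
      (λ eq → trans (in≡1+out A⊆G) (trans (cong suc eq) (sym (ℕ.+-suc _ _)))))

-- The Möbius function of the lattice of flats

minus-∑-cong : ∀ {X : Set} c (xs : List X) {f g : X → ℤ} → (∀ x → f x ≡ g x) →
               c ℤ.- ∑ xs f ≡ c ℤ.- ∑ xs g
minus-∑-cong c xs f≡g = cong (λ u → c ℤ.- u) (∑-cong xs f≡g)

-- Unfolding `möbius` at G evaluates it at H with an accessibility proof extracted from the one for
-- G, whereas `möbius family F H` starts from the proof for H itself. The two values agree because
-- the recursion does not depend on these proofs.
wfRecBuilder-irrelevant : ∀ {n} (family : List (Subset n)) (c : Subset n → ℤ)
  (φ : ∀ K → WellFounded.WfRec _⊂_ (λ _ → ℤ) K → Subset n → ℤ) →
  (∀ K (g h : WellFounded.WfRec _⊂_ (λ _ → ℤ) K) → (∀ {L} (L⊂K : L ⊂ K) → g L⊂K ≡ h L⊂K) →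
    ∀ H → φ K g H ≡ φ K h H) →
  ∀ K (q q′ : WellFounded.Acc _⊂_ K) {L} (L⊂K : L ⊂ K) →
  WellFounded.Some.wfRecBuilder (λ _ → ℤ) (λ K g → c K ℤ.- ∑ family (φ K g)) K q L⊂K ≡
  WellFounded.Some.wfRecBuilder (λ _ → ℤ) (λ K g → c K ℤ.- ∑ family (φ K g)) K q′ L⊂K
wfRecBuilder-irrelevant family c φ φ-cong K (WellFounded.acc rs) (WellFounded.acc rs′) {L} L⊂K =
  WellFounded.FixPoint.some-wfRec-irrelevant ⊂-wellFounded (λ _ → ℤ) (λ K g → c K ℤ.- ∑ family (φ K g))
    (λ K {g} {h} g≡h → minus-∑-cong (c K) family (φ-cong K g h g≡h)) L (rs L⊂K) (rs′ L⊂K)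

-- The underscores stand for terms with the summand of möbius, which is local
-- to its definition and cannot be named here.
möbius-term : ∀ {n} (family : List (Subset n)) (F G H : Subset n) →
  _ ≡ indicator (F ⊆? H ×-dec H ⊂? G) ℤ.* möbius family F H

möbius-inner-term : ∀ {n} (family : List (Subset n)) (F G H : Subset n) (H⊂G : H ⊂ G) (L : Subset n) → _ ≡ _

möbius-term-cong : ∀ {n} (family : List (Subset n)) (F K : Subset n) (f g : WellFounded.WfRec _⊂_ (λ _ → ℤ) K) →
  (∀ {L} (L⊂K : L ⊂ K) → f L⊂K ≡ g L⊂K) → (H : Subset n) → _ ≡ _

möbius-unfold : ∀ {n} (family : List (Subset n)) F G → möbius family F G ≡
  indicator (F ≟ₛ G) ℤ.- (∑[ H ← family ] indicator (F ⊆? H ×-dec H ⊂? G) ℤ.* möbius family F H)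
-- This use determines the underscore in the type of `möbius-term`, whose clauses therefore come
-- later.
möbius-unfold family F G = minus-∑-cong (indicator (F ≟ₛ G)) family (möbius-term family F G)

möbius-term family F G H with F ⊆? H | H ⊂? G
... | yes _ | yes H⊂G = trans
  (minus-∑-cong (indicator (F ≟ₛ H)) family (möbius-inner-term family F G H H⊂G))
  (sym (ℤ.*-identityˡ (möbius family F H)))
... | yes _ | no _    = refl
... | no _  | _       = refl

möbius-inner-term family F G H H⊂G L with F ⊆? L | L ⊂? H
... | yes _ | yes L⊂H = wfRecBuilder-irrelevant family (λ K → indicator (F ≟ₛ K)) _
    (möbius-term-cong family F) H (WellFounded.acc-inverse (⊂-wellFounded G) H⊂G) (⊂-wellFounded H) L⊂H
... | yes _ | no _    = refl
... | no _  | _       = refl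

möbius-term-cong family F K f g f≡g H with F ⊆? H | H ⊂? K
... | yes _ | yes H⊂K = f≡g H⊂K
... | yes _ | no _    = refl
... | no _  | _       = refl

-- Flats and the Möbius function of a matroid

indicator-×³ : {P Q R : Set} (P? : Dec P) (Q? : Dec Q) (R? : Dec R) →
  indicator (P? ×-dec Q? ×-dec R?) ≡ indicator P? ℤ.* (indicator Q? ℤ.* indicator R?)
indicator-×³ P? Q? R? = trans (indicator-× P? (Q? ×-dec R?))
  (cong (λ u → indicator P? ℤ.* u) (indicator-× Q? R?))

module _ {E} (M : Matroid E) where

  open IsRank (rk-isRank M)

  private
    n = size E

  -- An e in H outside G would raise the rank of the flat G, but submodularity for G and H, whose
  -- intersection contains A, gives rk (G ∪ H) ≤ rk G.
  flat-absorbs : ∀ {A G H} → IsFlat M G → A ⊆ G → A ⊆ H → rk M H ≡ rk M A → H ⊆ G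
  flat-absorbs {A} {G} {H} flatG A⊆G A⊆H eq with ⊆-or-∉ H G
  ... | inj₁ H⊆G = H⊆G
  ... | inj₂ (e , e∈H , e∉G) = contradiction (flatG e e∉G)
      (ℕ.≤⇒≯ (ℕ.≤-trans (mono G∪e⊆G∪H) rkG∪H≤rkG))
    where
    G∪e⊆G∪H : G ∪ ⁅ e ⁆ ⊆ G ∪ H
    G∪e⊆G∪H x∈ = [ p⊆p∪q H
                 , (λ x∈e → q⊆p∪q G H (subst (_∈ H) (sym (x∈⁅y⁆⇒x≡y e x∈e)) e∈H))
                 ]′ (x∈p∪q⁻ G ⁅ e ⁆ x∈)
    rkG∪H≤rkG : rk M (G ∪ H) ≤ rk M G
    rkG∪H≤rkG = ℕ.+-cancelʳ-≤ (rk M A) _ _ (begin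
      rk M (G ∪ H) + rk M A       ≤⟨ ℕ.+-monoʳ-≤ (rk M (G ∪ H)) (mono (λ x∈A → x∈p∩q⁺ (A⊆G x∈A , A⊆H x∈A))) ⟩
      rk M (G ∪ H) + rk M (G ∩ H) ≤⟨ submodular G H ⟩
      rk M G + rk M H             ≡⟨ cong (λ ρ → rk M G + ρ) eq ⟩
      rk M G + rk M A             ∎)
      where open ℕ.≤-Reasoning

  not-flat : ∀ A → ¬ IsFlat M A → ∃[ e ] e ∉ A × rk M (A ∪ ⁅ e ⁆) ≡ rk M A
  not-flat A ¬flat with Fin.¬∀⟶∃¬ n _ (λ e → ¬? (e ∈? A) →-dec (rk M A ℕ.<? rk M (A ∪ ⁅ e ⁆))) ¬flat
  ... | e , ¬grows with e ∈? A
  ...   | yes e∈A = contradiction (λ e∉A → contradiction e∈A e∉A) ¬grows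
  ...   | no  e∉A = e , e∉A , ℕ.≤-antisym (ℕ.≮⇒≥ (λ lt → ¬grows (λ _ → lt))) (mono {A} (p⊆p∪q ⁅ e ⁆))

  -- Elements that keep the rank are added until none is left; k bounds the number of elements still
  -- missing.
  closure-≤ : ∀ k A → n ≤ ∣ A ∣ + k → ∃[ H ] IsFlat M H × A ⊆ H × rk M H ≡ rk M A
  closure-≤ k A le with isFlat? M A
  ... | yes flat = A , flat , id , refl
  ... | no ¬flat with not-flat A ¬flat
  ...   | e , e∉A , eq = step k le
    where
    A∪e = A ∪ ⁅ e ⁆
    bigger : suc ∣ A ∣ ≤ ∣ A∪e ∣
    bigger = p⊂q⇒∣p∣<∣q∣ (p⊆p∪q ⁅ e ⁆ , e , q⊆p∪q A ⁅ e ⁆ (x∈⁅x⁆ e) , e∉A)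
    step : ∀ k → n ≤ ∣ A ∣ + k → ∃[ H ] IsFlat M H × A ⊆ H × rk M H ≡ rk M A
    step zero    le = contradiction (ℕ.≤-trans bigger (∣p∣≤n A∪e))
      (ℕ.≤⇒≯ (ℕ.≤-trans le (ℕ.≤-reflexive (ℕ.+-identityʳ _))))
    step (suc k) le =
      let H , flatH , A∪e⊆H , eq′ = closure-≤ k A∪e (ℕ.≤-trans le
            (ℕ.≤-trans (ℕ.≤-reflexive (ℕ.+-suc _ k)) (ℕ.+-monoˡ-≤ k bigger)))
      in H , flatH , A∪e⊆H ∘ p⊆p∪q ⁅ e ⁆ , trans eq′ eq

  closure : ∀ A → ∃[ H ] IsFlat M H × A ⊆ H × rk M H ≡ rk M A
  closure A = closure-≤ n A (ℕ.m≤n+m n ∣ A ∣)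

  cl : Subset n → Subset n
  cl A = proj₁ (closure A)

  A⊆cl : ∀ A → A ⊆ cl A
  A⊆cl A = proj₁ (proj₂ (proj₂ (closure A)))

  rk-cl : ∀ A → rk M (cl A) ≡ rk M A
  rk-cl A = proj₂ (proj₂ (proj₂ (closure A)))

  cl⊆flat : ∀ {A G} → IsFlat M G → A ⊆ G → cl A ⊆ G
  cl⊆flat {A} flatG A⊆G = flat-absorbs flatG A⊆G (A⊆cl A) (rk-cl A)

  -- The closure is the only flat that contains A and has its rank, so the three indicators multiply
  -- to a delta at `cl A`.
  ∑-flats-closure : ∀ A (g : Subset n → ℤ) →
    ∑[ G ← subsets n ] indicator (isFlat? M G) ℤ.* (indicator (A ⊆? G) ℤ.* (indicator (rk M A ℕ.≟ rk M G) ℤ.* g G))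
    ≡ g (cl A)
  ∑-flats-closure A g = trans (∑-cong (subsets n) summand) (∑-δ (cl A) g)
    where
    isClosure : ∀ {G} → IsFlat M G × A ⊆ G × rk M A ≡ rk M G → G ≡ cl A
    isClosure (flatG , A⊆G , eq) = ⊆-antisym
      (flat-absorbs (proj₁ (proj₂ (closure A))) (A⊆cl A) A⊆G (sym eq)) (cl⊆flat flatG A⊆G)
    summand : ∀ G → indicator (isFlat? M G) ℤ.* (indicator (A ⊆? G) ℤ.* (indicator (rk M A ℕ.≟ rk M G) ℤ.* g G))
                    ≡ indicator (G ≟ₛ cl A) ℤ.* g G
    summand G = trans
      (solve 4 (λ a b c d → a :* (b :* (c :* d)) := (a :* (b :* c)) :* d) refl
        (indicator (isFlat? M G)) (indicator (A ⊆? G)) (indicator (rk M A ℕ.≟ rk M G)) (g G))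
      (cong (ℤ._* g G) (trans
        (sym (indicator-×³ (isFlat? M G) (A ⊆? G) (rk M A ℕ.≟ rk M G)))
        (indicator-cong (isFlat? M G ×-dec A ⊆? G ×-dec rk M A ℕ.≟ rk M G) (G ≟ₛ cl A) isClosure
          (λ { refl → proj₁ (proj₂ (closure A)) , A⊆cl A , sym (rk-cl A) }))))
      where open ℤ-Solver.+-*-Solver

  -- For a flat G the sum runs over the sets between F and G whose closure is G; (-1)^∣F∣ times it
  -- turns out to be μ(F,G) if F ⊆ G.
  spanningSum : Subset n → Subset n → ℤ
  spanningSum F G = alt F G (λ A → indicator (rk M A ℕ.≟ rk M G))

  spanningSum-⊈ : ∀ {F G} → ¬ F ⊆ G → spanningSum F G ≡ 0ℤ
  spanningSum-⊈ {F} {G} F⊈G = alt-0 F G (λ A F⊆A A⊆G → contradiction (λ {x} → A⊆G {x} ∘ F⊆A {x}) F⊈G)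

  -- After the sums are swapped, each A ⊇ F is counted at one flat only, its closure. The weight g
  -- is [H ⊆ G] in the Möbius recursion and [rk G = i] in the coefficient of t^i.
  ∑-flats-spanningSum : ∀ F (g : Subset n → ℤ) →
    ∑[ G ← subsets n ] indicator (isFlat? M G) ℤ.* (g G ℤ.* spanningSum F G) ≡
    ∑[ A ← subsets n ] indicator (F ⊆? A) ℤ.* (sgn ∣ A ∣ ℤ.* g (cl A))
  ∑-flats-spanningSum F g = begin
    ∑[ G ← subsets n ] 𝟙flat G ℤ.* (g G ℤ.* spanningSum F G)
      ≡⟨ ∑-cong (subsets n) expand ⟩
    ∑[ G ← subsets n ] ∑[ A ← subsets n ] c A ℤ.* (𝟙flat G ℤ.* (𝟙⊆ A G ℤ.* (𝟙rk A G ℤ.* g G)))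
      ≡⟨ ∑-swap (subsets n) (subsets n) _ ⟩
    ∑[ A ← subsets n ] ∑[ G ← subsets n ] c A ℤ.* (𝟙flat G ℤ.* (𝟙⊆ A G ℤ.* (𝟙rk A G ℤ.* g G)))
      ≡⟨ ∑-cong (subsets n) (λ A → trans (∑-*ˡ (subsets n) (c A) _) (trans
           (cong (λ u → c A ℤ.* u) (∑-flats-closure A g))
           (ℤ.*-assoc (indicator (F ⊆? A)) (sgn ∣ A ∣) (g (cl A))))) ⟩
    ∑[ A ← subsets n ] indicator (F ⊆? A) ℤ.* (sgn ∣ A ∣ ℤ.* g (cl A)) ∎
    where
    open ≡-Reasoning
    𝟙flat : Subset n → ℤ
    𝟙flat G = indicator (isFlat? M G)
    𝟙⊆ 𝟙rk : Subset n → Subset n → ℤ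
    𝟙⊆ A G = indicator (A ⊆? G)
    𝟙rk A G = indicator (rk M A ℕ.≟ rk M G)
    c : Subset n → ℤ
    c A = indicator (F ⊆? A) ℤ.* sgn ∣ A ∣
    expand : ∀ G → 𝟙flat G ℤ.* (g G ℤ.* spanningSum F G) ≡
      ∑[ A ← subsets n ] c A ℤ.* (𝟙flat G ℤ.* (𝟙⊆ A G ℤ.* (𝟙rk A G ℤ.* g G)))
    expand G = trans
      (cong (λ u → 𝟙flat G ℤ.* (g G ℤ.* u)) (∑-interval F G (λ A → sgn ∣ A ∣ ℤ.* 𝟙rk A G)))
      (trans (sym (ℤ.*-assoc (𝟙flat G) (g G) _)) (trans
        (sym (∑-*ˡ (subsets n) (𝟙flat G ℤ.* g G) (λ A → within F G A ℤ.* (sgn ∣ A ∣ ℤ.* 𝟙rk A G))))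
        (∑-cong (subsets n) (λ A → solve 6
          (λ f g w₁ w₂ s r → (f :* g) :* ((w₁ :* w₂) :* (s :* r)) := (w₁ :* s) :* (f :* (w₂ :* (r :* g)))) refl
          (𝟙flat G) (g G) (indicator (F ⊆? A)) (𝟙⊆ A G) (sgn ∣ A ∣) (𝟙rk A G)))))
      where open ℤ-Solver.+-*-Solver

  ∑-flats : ∀ (f : Subset n → ℤ) → ∑ (flats M) f ≡ ∑[ F ← subsets n ] indicator (isFlat? M F) ℤ.* f F
  ∑-flats f = ∑-filter (isFlat? M) (subsets n) f

  -- For a flat G, cl A ⊆ G means A ⊆ G, so the sum collapses to one over the Boolean interval from
  -- F to G.
  ∑-below-flat : ∀ F {G} → IsFlat M G →
    ∑[ H ← subsets n ] indicator (isFlat? M H) ℤ.* (indicator (H ⊆? G) ℤ.* spanningSum F H) ≡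
    sgn ∣ F ∣ ℤ.* indicator (F ≟ₛ G)
  ∑-below-flat F {G} flatG = trans (∑-flats-spanningSum F (λ H → indicator (H ⊆? G))) (trans
    (∑-cong (subsets n) (λ A → trans
      (cong (λ u → indicator (F ⊆? A) ℤ.* (sgn ∣ A ∣ ℤ.* u))
        (indicator-cong (cl A ⊆? G) (A ⊆? G) (λ cl⊆G {x} → cl⊆G {x} ∘ A⊆cl A {x}) (cl⊆flat flatG)))
      (solve 3 (λ f s a → f :* (s :* a) := (f :* a) :* (s :* con 1ℤ)) refl
        (indicator (F ⊆? A)) (sgn ∣ A ∣) (indicator (A ⊆? G)))))
    (trans (sym (∑-interval F G (λ A → sgn ∣ A ∣ ℤ.* 1ℤ))) (alt-1 F G)))
    where open ℤ-Solver.+-*-Solver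

  -- Both sides satisfy one recursion: by `∑-below-flat` the right side, summed over flats H ⊆ G,
  -- gives [F = G]. The sum over H ⊂ G is this total minus the term at H = G.
  möbius-flats : ∀ F G → Acc _⊂_ G → IsFlat M G → F ⊆ G → möbius (flats M) F G ≡ sgn ∣ F ∣ ℤ.* spanningSum F G
  möbius-flats F G (acc rs) flatG F⊆G = begin
    möbius (flats M) F G
      ≡⟨ möbius-unfold (flats M) F G ⟩
    indicator (F ≟ₛ G) ℤ.- (∑[ H ← flats M ] indicator (F ⊆? H ×-dec H ⊂? G) ℤ.* möbius (flats M) F H)
      ≡⟨ cong (λ u → indicator (F ≟ₛ G) ℤ.- u) (trans (∑-flats _) (∑-cong (subsets n) summand)) ⟩
    indicator (F ≟ₛ G) ℤ.- (∑[ H ← subsets n ]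
      s ℤ.* (𝟙flat H ℤ.* (indicator (H ⊆? G) ℤ.* spanningSum F H)) ℤ.+
      (ℤ.- s) ℤ.* (indicator (H ≟ₛ G) ℤ.* (𝟙flat H ℤ.* spanningSum F H)))
      ≡⟨ cong (λ u → indicator (F ≟ₛ G) ℤ.- u) (trans (∑-distrib-+ (subsets n) _ _) (cong₂ ℤ._+_
          (trans (∑-*ˡ (subsets n) s _) (cong (λ u → s ℤ.* u) (∑-below-flat F flatG)))
          (trans (∑-*ˡ (subsets n) (ℤ.- s) _) (cong (λ u → (ℤ.- s) ℤ.* u) (trans
            (∑-δ G (λ H → 𝟙flat H ℤ.* spanningSum F H))
            (trans (cong (ℤ._* spanningSum F G) (indicator-yes (isFlat? M G) flatG)) (ℤ.*-identityˡ _))))))) ⟩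
    indicator (F ≟ₛ G) ℤ.- (s ℤ.* (s ℤ.* indicator (F ≟ₛ G)) ℤ.+ (ℤ.- s) ℤ.* spanningSum F G)
      ≡⟨ solve 3 (λ d s x → d :- (s :* (s :* d) :+ (:- s) :* x) := d :- (s :* s) :* d :+ s :* x) refl
           (indicator (F ≟ₛ G)) s (spanningSum F G) ⟩
    indicator (F ≟ₛ G) ℤ.- (s ℤ.* s) ℤ.* indicator (F ≟ₛ G) ℤ.+ s ℤ.* spanningSum F G
      ≡⟨ cong (λ u → indicator (F ≟ₛ G) ℤ.- u ℤ.* indicator (F ≟ₛ G) ℤ.+ s ℤ.* spanningSum F G) (sgn² ∣ F ∣) ⟩
    indicator (F ≟ₛ G) ℤ.- 1ℤ ℤ.* indicator (F ≟ₛ G) ℤ.+ s ℤ.* spanningSum F G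
      ≡⟨ solve 2 (λ d y → d :- con 1ℤ :* d :+ y := y) refl (indicator (F ≟ₛ G)) (s ℤ.* spanningSum F G) ⟩
    s ℤ.* spanningSum F G ∎
    where
    open ≡-Reasoning
    open ℤ-Solver.+-*-Solver
    s = sgn ∣ F ∣
    𝟙flat : Subset n → ℤ
    𝟙flat H = indicator (isFlat? M H)
    ⊂-split : ∀ H → indicator (H ⊂? G) ≡ indicator (H ⊆? G) ℤ.- indicator (H ≟ₛ G)
    ⊂-split H with H ≟ₛ G
    ... | yes refl = trans (indicator-no (H ⊂? G) (⊂-irref refl))
                       (sym (cong (ℤ._- 1ℤ) (indicator-yes (H ⊆? G) id)))
    ... | no H≢G = trans (indicator-cong (H ⊂? G) (H ⊆? G) p⊂q⇒p⊆q proper) (sym (ℤ.+-identityʳ _))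
      where
      proper : H ⊆ G → H ⊂ G
      proper H⊆G with ⊆-or-∉ G H
      ... | inj₁ G⊆H = contradiction (⊆-antisym H⊆G G⊆H) H≢G
      ... | inj₂ (x , x∈G , x∉H) = H⊆G , x , x∈G , x∉H
    term : ∀ H → IsFlat M H → indicator (F ⊆? H ×-dec H ⊂? G) ℤ.* möbius (flats M) F H ≡
           (indicator (H ⊆? G) ℤ.- indicator (H ≟ₛ G)) ℤ.* (s ℤ.* spanningSum F H)
    term H flatH with F ⊆? H
    ... | no F⊈H = sym (trans (cong (λ u → d ℤ.* (s ℤ.* u)) (spanningSum-⊈ F⊈H))
                         (trans (cong (λ u → d ℤ.* u) (ℤ.*-zeroʳ s)) (ℤ.*-zeroʳ d)))
      where d = indicator (H ⊆? G) ℤ.- indicator (H ≟ₛ G)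
    ... | yes F⊆H = trans
      (indicator-*-cong (H ⊂? G) (λ H⊂G → möbius-flats F H (rs H⊂G) flatH F⊆H))
      (cong (ℤ._* (s ℤ.* spanningSum F H)) (⊂-split H))
    summand : ∀ H → 𝟙flat H ℤ.* (indicator (F ⊆? H ×-dec H ⊂? G) ℤ.* möbius (flats M) F H) ≡
      s ℤ.* (𝟙flat H ℤ.* (indicator (H ⊆? G) ℤ.* spanningSum F H)) ℤ.+
      (ℤ.- s) ℤ.* (indicator (H ≟ₛ G) ℤ.* (𝟙flat H ℤ.* spanningSum F H))
    summand H = trans (indicator-*-cong (isFlat? M H) (term H))
      (solve 5 (λ f a b s x → f :* ((a :- b) :* (s :* x)) :=
          s :* (f :* (a :* x)) :+ (:- s) :* (b :* (f :* x))) refl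
        (𝟙flat H) (indicator (H ⊆? G)) (indicator (H ≟ₛ G)) s (spanningSum F H))

-- The coefficients of the spectrum polynomial

indicator-* : {P : Set} (P? : Dec P) {a b : ℤ} → (P → a ≡ b) → (¬ P → b ≡ 0ℤ) → indicator P? ℤ.* a ≡ b
indicator-* (yes p) {a} a≡b b≡0 = trans (ℤ.*-identityˡ a) (a≡b p)
indicator-* (no ¬p) {a} a≡b b≡0 = trans (ℤ.*-zeroˡ a) (sym (b≡0 ¬p))

coefficient-map : ∀ {X : Set} (c : X → ℤ) (a b : X → ℕ) xs i j →
  coefficient (map (λ x → c x , a x , b x) xs) i j ≡
  ∑[ x ← xs ] (indicator (a x ℕ.≟ i) ℤ.* indicator (b x ℕ.≟ j)) ℤ.* c x
coefficient-map c a b []       i j = refl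
coefficient-map c a b (x ∷ xs) i j = cong₂ ℤ._+_
  (trans (if-indicator (a x ℕ.≟ i ×-dec b x ℕ.≟ j)) (cong (ℤ._* c x) (indicator-× (a x ℕ.≟ i) (b x ℕ.≟ j))))
  (coefficient-map c a b xs i j)
  where
  if-indicator : ∀ {P : Set} (P? : Dec P) → (if does P? then c x else 0ℤ) ≡ indicator P? ℤ.* c x
  if-indicator (yes _) = sym (ℤ.*-identityˡ (c x))
  if-indicator (no _)  = sym (ℤ.*-zeroˡ (c x))

-- The part of a term that does not depend on the matroid: it vanishes unless I ⊆ F ⊆ A and ∣F∣ = j,
-- and is a sign otherwise.
κ : ∀ {n} → ℕ → ℕ → (F A I : Subset n) → ℤ
κ i j F A I =
  (indicator (∣ F ∣ ℕ.≟ j) ℤ.* (sgn i ℤ.* sgn ∣ F ∣)) ℤ.*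
  ((indicator (F ⊆? A) ℤ.* sgn ∣ A ∣) ℤ.* (indicator (I ⊆? F) ℤ.* sgn ∣ I ∣))

module _ {E} (M : Matroid E) where

  private
    n = size E
    rank = rk-isRank M

    𝟙flat 𝟙indep : Subset n → ℤ
    𝟙flat F = indicator (isFlat? M F)
    𝟙indep I = indicator (isIndependent? M I)

  independentSum : Subset n → ℤ
  independentSum F = ∑[ I ← subsets n ] (indicator (I ⊆? F) ℤ.* sgn ∣ I ∣) ℤ.* 𝟙indep I

  independentSum-alt : ∀ F → independentSum F ≡ alt ⊥ F (λ A → indicator (rk M A ℕ.≟ rk M ⊥ + ∣ A ∣))
  independentSum-alt F = sym (trans (∑-interval ⊥ F _) (∑-cong (subsets n) summand))
    where
    summand : ∀ I → within ⊥ F I ℤ.* (sgn ∣ I ∣ ℤ.* indicator (rk M I ℕ.≟ rk M ⊥ + ∣ I ∣)) ≡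
                    (indicator (I ⊆? F) ℤ.* sgn ∣ I ∣) ℤ.* 𝟙indep I
    summand I = trans (cong₂ (λ a b → (a ℤ.* indicator (I ⊆? F)) ℤ.* (sgn ∣ I ∣ ℤ.* b))
        (indicator-yes (⊥ ⊆? I) (⊆-min I))
        (indicator-cong (rk M I ℕ.≟ rk M ⊥ + ∣ I ∣) (isIndependent? M I)
          (λ eq → rk⇒independent M (trans eq (cong (λ ρ → ρ + ∣ I ∣) (rk-⊥ M))))
          (λ ind → trans (independent⇒rk M ind) (cong (λ ρ → ρ + ∣ I ∣) (sym (rk-⊥ M))))))
      (solve 3 (λ w s d → (con 1ℤ :* w) :* (s :* d) := (w :* s) :* d) refl
        (indicator (I ⊆? F)) (sgn ∣ I ∣) (𝟙indep I))
      where open ℤ-Solver.+-*-Solver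

  reducedEuler-independentIn : ∀ F → reducedEuler (independentIn M F) ≡ ℤ.- independentSum F
  reducedEuler-independentIn F = trans
    (∑-filter (λ I → isIndependent? M I ×-dec I ⊆? F) (subsets n) (λ I → ℤ.- sgn ∣ I ∣))
    (trans (∑-cong (subsets n) (λ I → trans
      (cong (ℤ._* (ℤ.- sgn ∣ I ∣)) (indicator-× (isIndependent? M I) (I ⊆? F)))
      (solve 3 (λ d w s → (d :* w) :* (:- s) := con -1ℤ :* ((w :* s) :* d)) refl
        (𝟙indep I) (indicator (I ⊆? F)) (sgn ∣ I ∣))))
    (trans (∑-*ˡ (subsets n) -1ℤ _) (ℤ.-1*i≡-i (independentSum F))))
    where open ℤ-Solver.+-*-Solver

  ∣reducedEuler∣ : ∀ F → + ℤ.∣ reducedEuler (independentIn M F) ∣ ≡ sgn (rk M F) ℤ.* independentSum F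
  ∣reducedEuler∣ F = begin
    + ℤ.∣ reducedEuler (independentIn M F) ∣
      ≡⟨ cong (λ z → + ℤ.∣ z ∣) (reducedEuler-independentIn F) ⟩
    + ℤ.∣ ℤ.- independentSum F ∣
      ≡⟨ cong +_ (ℤ.∣-i∣≡∣i∣ (independentSum F)) ⟩
    + ℤ.∣ independentSum F ∣
      ≡⟨ signed⇒∣∣ {rk M ⊥ + rk M F} (signed-cong refl (sym (independentSum-alt F)) (independent-signed rank F)) ⟩
    sgn (rk M ⊥ + rk M F) ℤ.* independentSum F
      ≡⟨ cong (λ ρ → sgn (ρ + rk M F) ℤ.* independentSum F) (rk-⊥ M) ⟩
    sgn (rk M F) ℤ.* independentSum F ∎
    where open ≡-Reasoning

  ∣möbius∣ : ∀ F G → IsFlat M G → F ⊆ G →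
    + ℤ.∣ möbius (flats M) F G ∣ ≡ sgn (∣ F ∣ + rk M F + rk M G) ℤ.* spanningSum M F G
  ∣möbius∣ F G flatG F⊆G = begin
    + ℤ.∣ möbius (flats M) F G ∣
      ≡⟨ cong (λ z → + ℤ.∣ z ∣) (möbius-flats M F G (⊂-wellFounded G) flatG F⊆G) ⟩
    + ℤ.∣ sgn ∣ F ∣ ℤ.* spanningSum M F G ∣
      ≡⟨ cong +_ (∣sgn*∣ ∣ F ∣ (spanningSum M F G)) ⟩
    + ℤ.∣ spanningSum M F G ∣
      ≡⟨ signed⇒∣∣ (spanning-signed rank F G) ⟩
    sgn (∣ F ∣ + rk M F + rk M G) ℤ.* spanningSum M F G ∎
    where open ≡-Reasoning

  -- Some e outside F keeps the rank of F. It lies in G and in the closure of every A ⊇ F, so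
  -- toggling e preserves the rank of A and the terms cancel in pairs. Hence F may run over all
  -- subsets.
  spanningSum-nonflat : ∀ F G → ¬ IsFlat M F → IsFlat M G → spanningSum M F G ≡ 0ℤ
  spanningSum-nonflat F G ¬flatF flatG with ⊆-or-∉ F G
  ... | inj₂ (x , x∈F , x∉G) = spanningSum-⊈ M (λ F⊆G → x∉G (F⊆G x∈F))
  ... | inj₁ F⊆G with not-flat M F ¬flatF
  ...   | e , e∉F , eq = alt-toggle F G e e∉F
      (flat-absorbs M flatG F⊆G (p⊆p∪q ⁅ e ⁆) eq (q⊆p∪q F ⁅ e ⁆ (x∈⁅x⁆ e)))
      (λ A F⊆A _ → cong (λ ρ → indicator (ρ ℕ.≟ rk M G)) (same-rank A F⊆A))
    where
    same-rank : ∀ A → F ⊆ A → rk M (A ∪ ⁅ e ⁆) ≡ rk M A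
    same-rank A F⊆A = ℕ.≤-antisym (ℕ.≤-trans (mono A∪e⊆cl) (ℕ.≤-reflexive (rk-cl M A)))
                                  (mono {A} (p⊆p∪q ⁅ e ⁆))
      where
      open IsRank rank
      flat-cl : IsFlat M (cl M A)
      flat-cl = proj₁ (proj₂ (closure M A))
      e∈cl : e ∈ cl M A
      e∈cl = flat-absorbs M {F} flat-cl (λ x∈F → A⊆cl M A (F⊆A x∈F)) (p⊆p∪q ⁅ e ⁆) eq (q⊆p∪q F ⁅ e ⁆ (x∈⁅x⁆ e))
      A∪e⊆cl : A ∪ ⁅ e ⁆ ⊆ cl M A
      A∪e⊆cl x∈ = [ A⊆cl M A , (λ x∈e → subst (_∈ cl M A) (sym (x∈⁅y⁆⇒x≡y e x∈e)) e∈cl) ]′ (x∈p∪q⁻ A ⁅ e ⁆ x∈)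

  -- The flats G are summed out, since each A has one closure and it has the rank of A; flatness of
  -- F is absorbed by `spanningSum-nonflat`. Only independence of I and the rank of A still involve
  -- the matroid.
  coefficient-Spec : ∀ i j → coefficient (Spec M) i j ≡
    ∑[ F ← subsets n ] ∑[ A ← subsets n ] ∑[ I ← subsets n ]
      κ i j F A I ℤ.* (𝟙indep I ℤ.* indicator (rk M A ℕ.≟ i))
  coefficient-Spec i j = begin
    coefficient (Spec M) i j
      ≡⟨ coefficient-map c (λ (F , G) → rk M G) (λ (F , G) → ∣ F ∣)
           (filter (λ (F , G) → F ⊆? G) (cartesianProduct (flats M) (flats M))) i j ⟩
    ∑ (filter (λ (F , G) → F ⊆? G) (cartesianProduct (flats M) (flats M))) value
      ≡⟨ ∑-filter (λ (F , G) → F ⊆? G) (cartesianProduct (flats M) (flats M)) value ⟩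
    ∑[ p ← cartesianProduct (flats M) (flats M) ] indicator (proj₁ p ⊆? proj₂ p) ℤ.* value p
      ≡⟨ ∑-cartesianProduct (flats M) (flats M) _ ⟩
    ∑[ F ← flats M ] ∑[ G ← flats M ] indicator (F ⊆? G) ℤ.* value (F , G)
      ≡⟨ trans (∑-flats M _) (∑-cong (subsets n) (λ F → trans
           (cong (λ u → 𝟙flat F ℤ.* u) (∑-flats M _)) (sym (∑-*ˡ (subsets n) (𝟙flat F) _)))) ⟩
    ∑[ F ← subsets n ] ∑[ G ← subsets n ]
      𝟙flat F ℤ.* (𝟙flat G ℤ.* (indicator (F ⊆? G) ℤ.* value (F , G)))
      ≡⟨ ∑-cong (subsets n) (λ F → trans (∑-cong (subsets n) (flat-pair F)) (∑-*ˡ (subsets n) (d F) _)) ⟩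
    ∑[ F ← subsets n ] d F ℤ.* (∑[ G ← subsets n ] 𝟙flat G ℤ.* (indicator (rk M G ℕ.≟ i) ℤ.* spanningSum M F G))
      ≡⟨ ∑-cong (subsets n) (λ F → trans
           (cong (λ u → d F ℤ.* u) (trans (∑-flats-spanningSum M F (λ G → indicator (rk M G ℕ.≟ i)))
             (∑-cong (subsets n) (λ A → cong (λ ρ → indicator (F ⊆? A) ℤ.* (sgn ∣ A ∣ ℤ.* indicator (ρ ℕ.≟ i))) (rk-cl M A)))))
           (trans (sym (∑-*ˡ (subsets n) (d F) _)) (∑-cong (subsets n) (expand F)))) ⟩
    ∑[ F ← subsets n ] ∑[ A ← subsets n ] ∑[ I ← subsets n ]
      κ i j F A I ℤ.* (𝟙indep I ℤ.* indicator (rk M A ℕ.≟ i)) ∎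
    where
    open ≡-Reasoning
    c : Subset n × Subset n → ℤ
    c (F , G) = + ℤ.∣ reducedEuler (independentIn M F) ∣ ℤ.* + ℤ.∣ möbius (flats M) F G ∣
    value : Subset n × Subset n → ℤ
    value (F , G) = (indicator (rk M G ℕ.≟ i) ℤ.* indicator (∣ F ∣ ℕ.≟ j)) ℤ.* c (F , G)
    d : Subset n → ℤ
    d F = (indicator (∣ F ∣ ℕ.≟ j) ℤ.* (sgn i ℤ.* sgn ∣ F ∣)) ℤ.* independentSum F

    -- Both absolute values carry the sign (-1)^(rk F), so it cancels; the remaining rk G becomes i
    -- under the indicator.
    c≡ : ∀ {F G} → IsFlat M G → F ⊆ G → c (F , G) ≡
         sgn (rk M G) ℤ.* ((sgn ∣ F ∣ ℤ.* independentSum F) ℤ.* spanningSum M F G)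
    c≡ {F} {G} flatG F⊆G = begin
      c (F , G)
        ≡⟨ cong₂ ℤ._*_ (∣reducedEuler∣ F) (∣möbius∣ F G flatG F⊆G) ⟩
      (sF ℤ.* X) ℤ.* (sgn (∣ F ∣ + rk M F + rk M G) ℤ.* S)
        ≡⟨ cong (λ s → (sF ℤ.* X) ℤ.* (s ℤ.* S)) (trans (sgn-+ (∣ F ∣ + rk M F) (rk M G))
             (cong (ℤ._* sgn (rk M G)) (sgn-+ ∣ F ∣ (rk M F)))) ⟩
      (sF ℤ.* X) ℤ.* (((sgn ∣ F ∣ ℤ.* sF) ℤ.* sgn (rk M G)) ℤ.* S)
        ≡⟨ solve 5 (λ a x f g s → (a :* x) :* (((f :* a) :* g) :* s) := (a :* a) :* (g :* ((f :* x) :* s))) refl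
             sF X (sgn ∣ F ∣) (sgn (rk M G)) S ⟩
      (sF ℤ.* sF) ℤ.* (sgn (rk M G) ℤ.* ((sgn ∣ F ∣ ℤ.* X) ℤ.* S))
        ≡⟨ cong (ℤ._* (sgn (rk M G) ℤ.* ((sgn ∣ F ∣ ℤ.* X) ℤ.* S))) (sgn² (rk M F)) ⟩
      1ℤ ℤ.* (sgn (rk M G) ℤ.* ((sgn ∣ F ∣ ℤ.* X) ℤ.* S))
        ≡⟨ ℤ.*-identityˡ _ ⟩
      sgn (rk M G) ℤ.* ((sgn ∣ F ∣ ℤ.* X) ℤ.* S) ∎
      where
      open ℤ-Solver.+-*-Solver
      sF = sgn (rk M F)
      X = independentSum F
      S = spanningSum M F G

    -- Pairs with F not flat or F ⊈ G are harmless: their spanningSum vanishes.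
    flat-pair : ∀ F G → 𝟙flat F ℤ.* (𝟙flat G ℤ.* (indicator (F ⊆? G) ℤ.* value (F , G))) ≡
                d F ℤ.* (𝟙flat G ℤ.* (indicator (rk M G ℕ.≟ i) ℤ.* spanningSum M F G))
    flat-pair F G = indicator-* (isFlat? M F)
      (λ _ → indicator-* (isFlat? M G)
        (λ flatG → indicator-* (F ⊆? G) (main flatG) (λ F⊈G → vanish (λ _ → spanningSum-⊈ M F⊈G)))
        (λ ¬flatG → vanish (λ flatG → contradiction flatG ¬flatG)))
      (λ ¬flatF → vanish (spanningSum-nonflat F G ¬flatF))
      where
      X = independentSum F
      S = spanningSum M F G
      𝟙rk = indicator (rk M G ℕ.≟ i)
      𝟙card = indicator (∣ F ∣ ℕ.≟ j)
      vanish : (IsFlat M G → S ≡ 0ℤ) → d F ℤ.* (𝟙flat G ℤ.* (𝟙rk ℤ.* S)) ≡ 0ℤ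
      vanish S≡0 = trans (cong (λ u → d F ℤ.* u) (indicator-* (isFlat? M G)
        (λ flatG → trans (cong (λ u → 𝟙rk ℤ.* u) (S≡0 flatG)) (ℤ.*-zeroʳ 𝟙rk)) (λ _ → refl))) (ℤ.*-zeroʳ (d F))
      open ℤ-Solver.+-*-Solver
      main : IsFlat M G → F ⊆ G → value (F , G) ≡ d F ℤ.* (𝟙flat G ℤ.* (𝟙rk ℤ.* S))
      main flatG F⊆G = begin
        (𝟙rk ℤ.* 𝟙card) ℤ.* c (F , G)
          ≡⟨ ℤ.*-assoc 𝟙rk 𝟙card (c (F , G)) ⟩
        𝟙rk ℤ.* (𝟙card ℤ.* c (F , G))
          ≡⟨ indicator-*-cong (rk M G ℕ.≟ i) (λ rk≡i → cong (λ u → 𝟙card ℤ.* u)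
               (trans (c≡ flatG F⊆G) (cong (λ ρ → sgn ρ ℤ.* ((sgn ∣ F ∣ ℤ.* X) ℤ.* S)) rk≡i))) ⟩
        𝟙rk ℤ.* (𝟙card ℤ.* (sgn i ℤ.* ((sgn ∣ F ∣ ℤ.* X) ℤ.* S)))
          ≡⟨ solve 6 (λ r a s f x t → r :* (a :* (s :* ((f :* x) :* t))) :=
                                      ((a :* (s :* f)) :* x) :* (con 1ℤ :* (r :* t))) refl
               𝟙rk 𝟙card (sgn i) (sgn ∣ F ∣) X S ⟩
        d F ℤ.* (1ℤ ℤ.* (𝟙rk ℤ.* S))
          ≡⟨ cong (λ u → d F ℤ.* (u ℤ.* (𝟙rk ℤ.* S))) (indicator-yes (isFlat? M G) flatG) ⟨
        d F ℤ.* (𝟙flat G ℤ.* (𝟙rk ℤ.* S)) ∎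

    expand : ∀ F A → d F ℤ.* (indicator (F ⊆? A) ℤ.* (sgn ∣ A ∣ ℤ.* indicator (rk M A ℕ.≟ i))) ≡
      ∑[ I ← subsets n ] κ i j F A I ℤ.* (𝟙indep I ℤ.* indicator (rk M A ℕ.≟ i))
    expand F A = trans
      (solve 5 (λ k x w s r → (k :* x) :* (w :* (s :* r)) := ((k :* (w :* s)) :* r) :* x) refl
        k₀ (independentSum F) (indicator (F ⊆? A)) (sgn ∣ A ∣) (indicator (rk M A ℕ.≟ i)))
      (trans (sym (∑-*ˡ (subsets n) ((k₀ ℤ.* (indicator (F ⊆? A) ℤ.* sgn ∣ A ∣)) ℤ.* indicator (rk M A ℕ.≟ i))
                    (λ I → (indicator (I ⊆? F) ℤ.* sgn ∣ I ∣) ℤ.* 𝟙indep I))) (∑-cong (subsets n) (λ I →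
        solve 5 (λ k w r u v → ((k :* w) :* r) :* (u :* v) := (k :* (w :* u)) :* (v :* r)) refl
          k₀ (indicator (F ⊆? A) ℤ.* sgn ∣ A ∣) (indicator (rk M A ℕ.≟ i))
          (indicator (I ⊆? F) ℤ.* sgn ∣ I ∣) (𝟙indep I))))
      where
      open ℤ-Solver.+-*-Solver
      k₀ = indicator (∣ F ∣ ℕ.≟ j) ℤ.* (sgn i ℤ.* sgn ∣ F ∣)

-- Valuativity

-- Since N exceeds every ∣ B ∩ A ∣, maximising this weight first maximises ∣ B ∩ I ∣.
lexWeight : ∀ {n} → ℕ → Subset n → Subset n → Vec ℕ n
lexWeight N = Vec.zipWith (λ i a → (if i then N else 0) + (if a then 1 else 0))

weight-lexWeight : ∀ {n} N (I A B : Subset n) →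
  weight (lexWeight N I A) B ≡ N ℕ.* ∣ B ∩ I ∣ + ∣ B ∩ A ∣
weight-lexWeight N []      []      []            = sym (cong (_+ 0) (ℕ.*-zeroʳ N))
weight-lexWeight N (i ∷ I) (a ∷ A) (outside ∷ B) = weight-lexWeight N I A B
weight-lexWeight N (i ∷ I) (a ∷ A) (inside ∷ B)  = trans
  (cong (λ u → (if i then N else 0) + (if a then 1 else 0) + u) (weight-lexWeight N I A B)) (regroup i a)
  where
  open CommutativeSemigroupProperties ℕ.+-commutativeSemigroup using (interchange)
  P = ∣ B ∩ I ∣
  Q = ∣ B ∩ A ∣
  head-I : ∀ i → (if i then N else 0) + N ℕ.* P ≡ N ℕ.* ∣ i ∷ (B ∩ I) ∣
  head-I inside  = sym (ℕ.*-suc N P)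
  head-I outside = refl
  regroup : ∀ i a → (if i then N else 0) + (if a then 1 else 0) + (N ℕ.* P + Q) ≡
                    N ℕ.* ∣ i ∷ (B ∩ I) ∣ + ∣ a ∷ (B ∩ A) ∣
  regroup i a = trans (interchange (if i then N else 0) (if a then 1 else 0) (N ℕ.* P) Q)
    (cong₂ _+_ (head-I i) (sym (∣∷∣ a (B ∩ A))))

digits-< : ∀ {N p q k} → q < N → p < k → N ℕ.* p + q < N ℕ.* k
digits-< {N} {p} {q} {k} q<N p<k = begin-strict
  N ℕ.* p + q  <⟨ ℕ.+-monoʳ-< (N ℕ.* p) q<N ⟩
  N ℕ.* p + N  ≡⟨ trans (ℕ.*-suc N p) (ℕ.+-comm N (N ℕ.* p)) ⟨
  N ℕ.* suc p  ≤⟨ ℕ.*-monoʳ-≤ N p<k ⟩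
  N ℕ.* k      ∎
  where open ℕ.≤-Reasoning

indicator-≤-step : ∀ i ρ → indicator (i ℕ.≤? ρ) ℤ.- indicator (suc i ℕ.≤? ρ) ≡ indicator (ρ ℕ.≟ i)
indicator-≤-step i ρ = by-cases (ρ ℕ.≟ i)
  where
  by-cases : (eq? : Dec (ρ ≡ i)) → indicator (i ℕ.≤? ρ) ℤ.- indicator (suc i ℕ.≤? ρ) ≡ indicator eq?
  by-cases (yes refl) = cong₂ ℤ._-_ (indicator-yes (i ℕ.≤? i) ℕ.≤-refl) (indicator-no (suc i ℕ.≤? i) ℕ.1+n≰n)
  by-cases (no ρ≢i)   = trans
    (cong (ℤ._- indicator (suc i ℕ.≤? ρ)) (indicator-cong (i ℕ.≤? ρ) (suc i ℕ.≤? ρ)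
      (λ i≤ρ → ℕ.≤∧≢⇒< i≤ρ (ρ≢i ∘ sym)) ℕ.<⇒≤))
    (ℤ.+-inverseʳ (indicator (suc i ℕ.≤? ρ)))

module _ {E} (M : Matroid E) where

  private
    n N : ℕ
    n = size E
    N = suc n

  -- As N exceeds ∣ B ∩ A ∣, reaching N ∣ I ∣ forces I ⊆ B, and ∣ B ∩ A ∣ has to supply the
  -- remaining i. Conversely, `extend` yields a basis that contains I and attains the rank of A;
  -- this is where I ⊆ A enters.
  heavy⇔ : ∀ {I A} i → I ⊆ A →
    indicator (hasBasisOfWeight≥? M (lexWeight N I A) (N ℕ.* ∣ I ∣ + i)) ≡
    indicator (isIndependent? M I) ℤ.* indicator (i ℕ.≤? rk M A)
  heavy⇔ {I} {A} i I⊆A = trans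
    (indicator-cong (hasBasisOfWeight≥? M (lexWeight N I A) (N ℕ.* ∣ I ∣ + i))
                    (isIndependent? M I ×-dec i ℕ.≤? rk M A) to from)
    (indicator-× (isIndependent? M I) (i ℕ.≤? rk M A))
    where
    open ℕ.≤-Reasoning
    B∩I : ∀ {B} → I ⊆ B → ∣ B ∩ I ∣ ≡ ∣ I ∣
    B∩I {B} I⊆B = cong ∣_∣ (⊆-antisym (p∩q⊆q B I) (λ x∈I → x∈p∩q⁺ (I⊆B x∈I , x∈I)))
    to : HasBasisOfWeight≥ M (lexWeight N I A) (N ℕ.* ∣ I ∣ + i) → IsIndependent M I × i ≤ rk M A
    to (B , hB , le) with ⊆-or-∉ I B
    ... | inj₁ I⊆B = (B , hB , I⊆B) , (begin
      i          ≤⟨ ℕ.+-cancelˡ-≤ (N ℕ.* ∣ I ∣) _ _ (begin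
                      N ℕ.* ∣ I ∣ + i              ≤⟨ le ⟩
                      weight (lexWeight N I A) B  ≡⟨ weight-lexWeight N I A B ⟩
                      N ℕ.* ∣ B ∩ I ∣ + ∣ B ∩ A ∣   ≡⟨ cong (λ u → N ℕ.* u + ∣ B ∩ A ∣) (B∩I I⊆B) ⟩
                      N ℕ.* ∣ I ∣ + ∣ B ∩ A ∣       ∎) ⟩
      ∣ B ∩ A ∣   ≡⟨ cong ∣_∣ (∩-comm B A) ⟩
      ∣ A ∩ B ∣   ≤⟨ rk-≥ M A hB ⟩
      rk M A     ∎)
    ... | inj₂ (x , x∈I , x∉B) = contradiction
      (ℕ.≤-trans (ℕ.m≤m+n _ i) (ℕ.≤-trans le (ℕ.≤-reflexive (weight-lexWeight N I A B))))
      (ℕ.<⇒≱ (digits-< (s≤s (∣p∣≤n (B ∩ A))) (p⊂q⇒∣p∣<∣q∣ (p∩q⊆q B I , x , x∈I , x∉B ∘ p∩q⊆p B I))))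
    from : IsIndependent M I × i ≤ rk M A → HasBasisOfWeight≥ M (lexWeight N I A) (N ℕ.* ∣ I ∣ + i)
    from (ind , i≤rk) with extend M I⊆A ind
    ... | B , hB , I⊆B , eq = B , hB , (begin
      N ℕ.* ∣ I ∣ + i               ≤⟨ ℕ.+-monoʳ-≤ (N ℕ.* ∣ I ∣) i≤rk ⟩
      N ℕ.* ∣ I ∣ + rk M A          ≡⟨ cong₂ (λ u v → N ℕ.* u + v) (B∩I I⊆B) (trans (cong ∣_∣ (∩-comm B A)) eq) ⟨
      N ℕ.* ∣ B ∩ I ∣ + ∣ B ∩ A ∣    ≡⟨ weight-lexWeight N I A B ⟨
      weight (lexWeight N I A) B   ∎)

  independent-rk-indicator : ∀ {I A} i → I ⊆ A →
    indicator (hasBasisOfWeight≥? M (lexWeight N I A) (N ℕ.* ∣ I ∣ + i)) ℤ.-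
    indicator (hasBasisOfWeight≥? M (lexWeight N I A) (N ℕ.* ∣ I ∣ + suc i)) ≡
    indicator (isIndependent? M I) ℤ.* indicator (rk M A ℕ.≟ i)
  independent-rk-indicator {I} {A} i I⊆A = trans
    (cong₂ ℤ._-_ (heavy⇔ i I⊆A) (heavy⇔ (suc i) I⊆A))
    (trans (solve 3 (λ d a b → d :* a :- d :* b := d :* (a :- b)) refl
             (indicator (isIndependent? M I)) (indicator (i ℕ.≤? rk M A)) (indicator (suc i ℕ.≤? rk M A)))
           (cong (λ u → indicator (isIndependent? M I) ℤ.* u) (indicator-≤-step i (rk M A))))
    where open ℤ-Solver.+-*-Solver

coefficient-· : ∀ z p i j → coefficient (_·_ ℤ[t,q] z p) i j ≡ z ℤ.* coefficient p i j
coefficient-· (+ m) p i j = natural m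
  where
  open RawMonoidDefinitions (AbelianGroup.rawMonoid ℤ[t,q]) renaming (_×_ to _×ᴾ_)
  natural : ∀ m → coefficient (m ×ᴾ p) i j ≡ + m ℤ.* coefficient p i j
  natural zero    = sym (ℤ.*-zeroˡ (coefficient p i j))
  natural (suc m) = trans (coefficient-++ p (m ×ᴾ p) i j)
    (trans (cong (λ u → coefficient p i j ℤ.+ u) (natural m)) (sym (ℤ.suc-* (+ m) (coefficient p i j))))
coefficient-· ℤ.-[1+ m ] p i j = trans (coefficient-neg (_·_ ℤ[t,q] (+ suc m) p) i j)
  (trans (cong ℤ.-_ (coefficient-· (+ suc m) p i j)) (ℤ.neg-distribˡ-* (+ suc m) (coefficient p i j)))

coefficient-sum : ∀ {s} (p : Fin s → Poly) i j →
  coefficient (RawMonoidDefinitions.sum (AbelianGroup.rawMonoid ℤ[t,q]) p) i j ≡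
  sum (λ k → coefficient (p k) i j)
coefficient-sum {zero}  p i j = refl
coefficient-sum {suc s} p i j = trans (coefficient-++ (p zero) _ i j)
  (cong (λ u → coefficient (p zero) i j ℤ.+ u) (coefficient-sum (p ∘ suc) i j))

Spec-isValuation : IsValuation ℤ[t,q] Spec
Spec-isValuation E s M a relation i j = trans
  (coefficient-sum (λ k → _·_ ℤ[t,q] (a k) (Spec (M k))) i j)
  (trans (sum-cong-≗ (λ k → coefficient-· (a k) (Spec (M k)) i j))
    (cancels-cong a (λ k → sym (coefficient-Spec (M k) i j))
      (cancels-∑ a S (λ F → cancels-∑ a S (λ A → cancels-∑ a S (λ I → cancels-term F A I))))))
  where
  S = subsets (size E)
  f : (A I : Subset (size E)) → Fin s → ℤ
  f A I k = indicator (isIndependent? (M k) I) ℤ.* indicator (rk (M k) A ℕ.≟ i)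
  -- Terms off the chains I ⊆ F ⊆ A vanish; on a chain I ⊆ A holds, as `independent-rk-indicator`
  -- requires.
  κ-0 : ∀ F A I → ¬ (I ⊆ F × F ⊆ A) → κ i j F A I ≡ 0ℤ
  κ-0 F A I ¬chain with ⊆-or-∉ I F | ⊆-or-∉ F A
  ... | inj₁ I⊆F | inj₁ F⊆A = contradiction ((λ {x} → I⊆F {x}) , (λ {x} → F⊆A {x})) ¬chain
  ... | inj₂ (x , x∈I , x∉F) | _ = trans
    (cong (λ u → (indicator (∣ F ∣ ℕ.≟ j) ℤ.* (sgn i ℤ.* sgn ∣ F ∣)) ℤ.*
                 ((indicator (F ⊆? A) ℤ.* sgn ∣ A ∣) ℤ.* (u ℤ.* sgn ∣ I ∣)))
      (indicator-no (I ⊆? F) (λ I⊆F → x∉F (I⊆F x∈I))))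
    (solve 4 (λ c w s t → c :* ((w :* s) :* (con 0ℤ :* t)) := con 0ℤ) refl
      (indicator (∣ F ∣ ℕ.≟ j) ℤ.* (sgn i ℤ.* sgn ∣ F ∣)) (indicator (F ⊆? A)) (sgn ∣ A ∣) (sgn ∣ I ∣))
    where open ℤ-Solver.+-*-Solver
  ... | inj₁ _ | inj₂ (x , x∈F , x∉A) = trans
    (cong (λ u → (indicator (∣ F ∣ ℕ.≟ j) ℤ.* (sgn i ℤ.* sgn ∣ F ∣)) ℤ.*
                 ((u ℤ.* sgn ∣ A ∣) ℤ.* (indicator (I ⊆? F) ℤ.* sgn ∣ I ∣)))
      (indicator-no (F ⊆? A) (λ F⊆A → x∉A (F⊆A x∈F))))
    (solve 4 (λ c w s t → c :* ((con 0ℤ :* s) :* (w :* t)) := con 0ℤ) refl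
      (indicator (∣ F ∣ ℕ.≟ j) ℤ.* (sgn i ℤ.* sgn ∣ F ∣)) (indicator (I ⊆? F)) (sgn ∣ A ∣) (sgn ∣ I ∣))
    where open ℤ-Solver.+-*-Solver
  cancels-term : ∀ F A I → Cancels a (λ k → κ i j F A I ℤ.* f A I k)
  cancels-term F A I = by-cases (I ⊆? F ×-dec F ⊆? A)
    where
    w = lexWeight (suc (size E)) I A
    b : ℕ
    b = suc (size E) ℕ.* ∣ I ∣
    heavy : ℕ → Fin s → ℤ
    heavy c k = indicator (hasBasisOfWeight≥? (M k) w c)
    cancels-f : I ⊆ A → Cancels a (f A I)
    cancels-f I⊆A = cancels-cong a {λ k → heavy (b + i) k ℤ.- heavy (b + suc i) k} {f A I}
      (λ k → independent-rk-indicator (M k) i I⊆A)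
      (cancels-minus a {heavy (b + i)} {heavy (b + suc i)}
        (cancels-maxWeight M a relation w (b + i)) (cancels-maxWeight M a relation w (b + suc i)))
    by-cases : Dec (I ⊆ F × F ⊆ A) → Cancels a (λ k → κ i j F A I ℤ.* f A I k)
    by-cases (yes (I⊆F , F⊆A)) =
      cancels-* a (κ i j F A I) {f A I} (cancels-f (λ {x} x∈I → F⊆A {x} (I⊆F x∈I)))
    by-cases (no ¬chain) = cancels-cong a {λ _ → 0ℤ} {λ k → κ i j F A I ℤ.* f A I k}
      (λ k → sym (trans (cong (ℤ._* f A I k) (κ-0 F A I ¬chain)) (ℤ.*-zeroˡ (f A I k)))) (cancels-0 a)

-- Invariance under isomorphism

-- As a sum over positions, the cardinality can be reindexed along a bijection.
∣∣-sum : ∀ {n} (A : Subset n) → ∣ A ∣ ≡ sumℕ (λ x → mem x A)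
∣∣-sum []      = refl
∣∣-sum (a ∷ A) = trans (∣∷∣ a A) (cong (λ u → (if a then 1 else 0) + u) (∣∣-sum A))

module _ {m n} (σ : Fin m ↔ Fin n) where

  open Inverse σ using (to; from; strictlyInverseˡ; strictlyInverseʳ)

  image : Subset m → Subset n
  image A = Vec.tabulate (lookup A ∘ from)

  preimage : Subset n → Subset m
  preimage B = Vec.tabulate (lookup B ∘ to)

  lookup-image : ∀ A y → lookup (image A) y ≡ lookup A (from y)
  lookup-image A y = Vec.lookup∘tabulate (lookup A ∘ from) y

  preimage-image : ∀ A → preimage (image A) ≡ A
  preimage-image A = trans
    (Vec.tabulate-cong (λ x → trans (lookup-image A (to x)) (cong (lookup A) (strictlyInverseʳ x))))
    (Vec.tabulate∘lookup A)

  image-preimage : ∀ B → image (preimage B) ≡ B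
  image-preimage B = trans
    (Vec.tabulate-cong (λ y → trans (Vec.lookup∘tabulate (lookup B ∘ to) (from y)) (cong (lookup B) (strictlyInverseˡ y))))
    (Vec.tabulate∘lookup B)

  ∣image∣ : ∀ A → ∣ image A ∣ ≡ ∣ A ∣
  ∣image∣ A = begin
    ∣ image A ∣                              ≡⟨ ∣∣-sum (image A) ⟩
    sumℕ (λ y → mem y (image A))             ≡⟨ sumℕ-permute (λ y → mem y (image A)) σ ⟩
    sumℕ (λ x → mem (to x) (image A))        ≡⟨ sumℕ-cong (λ x → cong (if_then 1 else 0)
                                                  (trans (lookup-image A (to x)) (cong (lookup A) (strictlyInverseʳ x)))) ⟩
    sumℕ (λ x → mem x A)                     ≡⟨ ∣∣-sum A ⟨
    ∣ A ∣                                    ∎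
    where open ≡-Reasoning

  image-∩ : ∀ A B → image A ∩ image B ≡ image (A ∩ B)
  image-∩ A B = trans (sym (Vec.tabulate∘lookup (image A ∩ image B))) (Vec.tabulate-cong (λ y → trans
    (Vec.lookup-zipWith _∧_ y (image A) (image B))
    (trans (cong₂ _∧_ (lookup-image A y) (lookup-image B y)) (sym (Vec.lookup-zipWith _∧_ (from y) A B)))))

  image-mono : ∀ {A B} → A ⊆ B → image A ⊆ image B
  image-mono {A} {B} A⊆B {y} y∈ = Vec.lookup⇒[]= y (image B) (trans (lookup-image B y)
    (Vec.[]=⇒lookup (A⊆B (Vec.lookup⇒[]= (from y) A (trans (sym (lookup-image A y)) (Vec.[]=⇒lookup y∈))))))

  image-cancel-⊆ : ∀ {A B} → image A ⊆ image B → A ⊆ B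
  image-cancel-⊆ {A} {B} imA⊆imB {x} x∈A = Vec.lookup⇒[]= x B (trans (sym (at B))
    (Vec.[]=⇒lookup (imA⊆imB (Vec.lookup⇒[]= (to x) (image A) (trans (at A) (Vec.[]=⇒lookup x∈A))))))
    where
    at : ∀ C → lookup (image C) (to x) ≡ lookup C x
    at C = trans (lookup-image C (to x)) (cong (lookup C) (strictlyInverseʳ x))

  κ-image : ∀ i j F A I → κ i j (image F) (image A) (image I) ≡ κ i j F A I
  κ-image i j F A I
    rewrite ∣image∣ F | ∣image∣ A | ∣image∣ I
          | indicator-cong (image F ⊆? image A) (F ⊆? A) image-cancel-⊆ image-mono
          | indicator-cong (image I ⊆? image F) (I ⊆? F) image-cancel-⊆ image-mono = refl

module _ {E E′} (M : Matroid E) (N : Matroid E′) (iso : M ≅ N) where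

  private
    σ = proj₁ iso

  basis⁺ : ∀ {B} → IsBasis M B → IsBasis N (image σ B)
  basis⁺ {B} = Equivalence.to (proj₂ iso B)

  basis⁻ : ∀ {B} → IsBasis N B → IsBasis M (preimage σ B)
  basis⁻ {B} hB = Equivalence.from (proj₂ iso (preimage σ B))
    (subst (IsBasis N) (sym (image-preimage σ B)) hB)

  rk-image : ∀ A → rk N (image σ A) ≡ rk M A
  rk-image A with rk-attained M A | rk-attained N (image σ A)
  ... | B , hB , eq | C , hC , eq′ = ℕ.≤-antisym
    (begin
      rk N (image σ A)                            ≡⟨ eq′ ⟨
      ∣ image σ A ∩ C ∣                           ≡⟨ cong (λ D → ∣ image σ A ∩ D ∣) (image-preimage σ C) ⟨
      ∣ image σ A ∩ image σ (preimage σ C) ∣      ≡⟨ ∣image∩image∣ A (preimage σ C) ⟩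
      ∣ A ∩ preimage σ C ∣                        ≤⟨ rk-≥ M A (basis⁻ hC) ⟩
      rk M A                                      ∎)
    (begin
      rk M A                                      ≡⟨ eq ⟨
      ∣ A ∩ B ∣                                   ≡⟨ ∣image∩image∣ A B ⟨
      ∣ image σ A ∩ image σ B ∣                   ≤⟨ rk-≥ N (image σ A) (basis⁺ hB) ⟩
      rk N (image σ A)                            ∎)
    where
    open ℕ.≤-Reasoning
    ∣image∩image∣ : ∀ A B → ∣ image σ A ∩ image σ B ∣ ≡ ∣ A ∩ B ∣
    ∣image∩image∣ A B = trans (cong ∣_∣ (image-∩ σ A B)) (∣image∣ σ (A ∩ B))

  indicator-independent-image : ∀ I →
    indicator (isIndependent? N (image σ I)) ≡ indicator (isIndependent? M I)
  indicator-independent-image I = indicator-cong (isIndependent? N (image σ I)) (isIndependent? M I)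
    (λ (B , hB , I⊆B) → preimage σ B , basis⁻ hB ,
      image-cancel-⊆ σ (λ {y} y∈ → subst (y ∈_) (sym (image-preimage σ B)) (I⊆B y∈)))
    (λ (B , hB , I⊆B) → image σ B , basis⁺ hB , image-mono σ I⊆B)

  -- Compared through `coefficient-Spec`, which leaves only inclusions, cardinalities, independence
  -- and ranks to be transported along the bijection.
  Spec-≅ : Spec M ≈ᴾ Spec N
  Spec-≅ i j = sym (begin
    coefficient (Spec N) i j
      ≡⟨ coefficient-Spec N i j ⟩
    ∑[ F ← S′ ] ∑[ A ← S′ ] ∑[ I ← S′ ] t N F A I
      ≡⟨ reindex (λ F → ∑[ A ← S′ ] ∑[ I ← S′ ] t N F A I) ⟩
    ∑[ F ← S ] ∑[ A ← S′ ] ∑[ I ← S′ ] t N (im F) A I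
      ≡⟨ ∑-cong S (λ F → reindex (λ A → ∑[ I ← S′ ] t N (im F) A I)) ⟩
    ∑[ F ← S ] ∑[ A ← S ] ∑[ I ← S′ ] t N (im F) (im A) I
      ≡⟨ ∑-cong S (λ F → ∑-cong S (λ A → reindex (t N (im F) (im A)))) ⟩
    ∑[ F ← S ] ∑[ A ← S ] ∑[ I ← S ] t N (im F) (im A) (im I)
      ≡⟨ ∑-cong S (λ F → ∑-cong S (λ A → ∑-cong S (term F A))) ⟩
    ∑[ F ← S ] ∑[ A ← S ] ∑[ I ← S ] t M F A I
      ≡⟨ coefficient-Spec M i j ⟨
    coefficient (Spec M) i j ∎)
    where
    open ≡-Reasoning
    S = subsets (size E)
    S′ = subsets (size E′)
    im = image σ
    t : ∀ {E} (M : Matroid E) (F A I : Subset (size E)) → ℤ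
    t M F A I = κ i j F A I ℤ.* (indicator (isIndependent? M I) ℤ.* indicator (rk M A ℕ.≟ i))
    reindex : ∀ g → ∑ S′ g ≡ ∑ S (g ∘ im)
    reindex = ∑-reindex im (preimage σ) (preimage-image σ) (image-preimage σ)
    term : ∀ F A I → t N (im F) (im A) (im I) ≡ t M F A I
    term F A I = cong₂ ℤ._*_ (κ-image σ i j F A I)
      (cong₂ ℤ._*_ (indicator-independent-image I) (cong (λ ρ → indicator (ρ ℕ.≟ i)) (rk-image A)))

corollary9p25 : IsValuativeInvariant ℤ[t,q] Spec
corollary9p25 = Spec-isValuation , Spec-≅
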